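{- For every $d\in\mathbb{N}$ there exists a constant $c=c(d)\in\mathbb{N}$ such that for every finite, non-empty set $A\subseteq\mathbb{R}^d$ with $\dim(A)=d$, there exist $a_1,\dots,a_c\in A$ satisfying \[ |A+\{a_1,\dots,a_c\}|\geq (d+1)|A|-5(d+1)^3. \]
   Context: For a finite non-empty $A\subseteq\mathbb{R}^d$, $\dim(A)$ denotes the dimension of the affine span of $A$. For $X,Y\subseteq\mathbb{R}^d$, $X+Y=\{x+y:x\in X,y\in Y\}$. -}

module Defs where

open import Level using (0ℓ)
open import Data.Nat as ℕ using (ℕ; zero; suc)
open import Data.Fin using (Fin; zero; suc)
open import Data.Product using (Σ; ∃; ∃-syntax; _×_; _,_)
open import Relation.Nullary using (¬_)
open import Relation.Binary.PropositionalEquality using (_≡_)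
open import Relation.Binary.Structures using (IsTotalOrder)
open import Algebra.Bundles using (CommutativeRing)

-- An axiomatisation of the real numbers: a Dedekind-complete ordered field
-- (this determines ℝ up to isomorphism classically).
record RealNumbers : Set₁ where
  field
    commutativeRing : CommutativeRing 0ℓ 0ℓ
  open CommutativeRing commutativeRing public
  field
    0≉1        : ¬ (0# ≈ 1#)
    inverse    : ∀ x → ¬ (x ≈ 0#) → ∃[ y ] (x * y ≈ 1#)
    _≤_        : Carrier → Carrier → Set
    isTotalOrder : IsTotalOrder _≈_ _≤_
    +-mono-≤   : ∀ x y z → x ≤ y → (x + z) ≤ (y + z)
    *-nonneg   : ∀ x y → 0# ≤ x → 0# ≤ y → 0# ≤ (x * y)
    complete   : (P : Carrier → Set) → ∃[ x ] P x → ∃[ b ] (∀ x → P x → x ≤ b) →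
                 ∃[ s ] ((∀ x → P x → x ≤ s) × (∀ b → (∀ x → P x → x ≤ b) → s ≤ b))

module _ (R : RealNumbers) where
  open RealNumbers R using (Carrier; _≈_; _+_; _*_; 0#; 1#)

  Point : ℕ → Set
  Point d = Fin d → Carrier

  _≈ᵖ_ : ∀ {d} → Point d → Point d → Set
  p ≈ᵖ q = ∀ k → p k ≈ q k

  _+ᵖ_ : ∀ {d} → Point d → Point d → Point d
  (p +ᵖ q) k = p k + q k

  _·ᵖ_ : ∀ {d} → Carrier → Point d → Point d
  (λ' ·ᵖ p) k = λ' * p k

  0ᵖ : ∀ {d} → Point d
  0ᵖ k = 0#

  Σˢ : ∀ {n} → (Fin n → Carrier) → Carrier
  Σˢ {zero}  f = 0#
  Σˢ {suc n} f = f zero + Σˢ (λ i → f (suc i))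

  Σᵖ : ∀ {n d} → (Fin n → Point d) → Point d
  Σᵖ {zero}  f = 0ᵖ
  Σᵖ {suc n} f = f zero +ᵖ Σᵖ (λ i → f (suc i))

  -- an enumeration a : Fin n → ℝ^d without repetitions (so it describes a set of size n)
  Distinct : ∀ {n d} → (Fin n → Point d) → Set
  Distinct a = ∀ i j → a i ≈ᵖ a j → i ≡ j

  InAffineSpan : ∀ {n d} → (Fin n → Point d) → Point d → Set
  InAffineSpan {n} a x = ∃[ λ' ] ((Σˢ λ' ≈ 1#) × (Σᵖ (λ i → λ' i ·ᵖ a i) ≈ᵖ x))

  -- dim(A) = d for A ⊆ ℝ^d : the affine span of A is all of ℝ^d
  FullDim : ∀ {n d} → (Fin n → Point d) → Set
  FullDim {d = d} a = ∀ (x : Point d) → InAffineSpan a x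

  SumsetAtLeast : ∀ {n c d} → (Fin n → Point d) → (Fin c → Point d) → ℕ → Set
  SumsetAtLeast {d = d} a b m =
    Σ (Fin m → Point d) λ s → Distinct s × (∀ k → ∃[ i ] ∃[ j ] (s k ≈ᵖ (a i +ᵖ b j)))

{-# OPTIONS --safe #-}
module Submission where

-- If v₀ and v₁ are the extreme elements of A for some linear functional, then A + {v₀ , v₁} has |A| elements
-- more than it has classes modulo v₁ - v₀.  Passing to the quotient by ℤ(v₁ - v₀) and continuing with a
-- functional that annihilates v₁ - v₀ gives 2d + 1 elements ws of A with |A + ws| ≥ (d + 1)|A| - O(m), where m
-- bounds the number of points of A on a hyperplane.  In dimension two, a few more translates improve the
-- constant 3 to 3 + 1/100: either some A + w is largely new, or the heights of A over v₁ - v₀ are equidistributed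
-- and the sums of the highest elements are too many.  By the previous step the same slack is available in every
-- dimension e ≥ 2.
--
-- Now let e ≥ 1 be minimal such that some e-dimensional flat contains a positive proportion of A.  If it has many
-- translates meeting A, then one element of A on each of them suffices.  Otherwise A lies on boundedly many
-- parallel flats, and a weighted form of Freiman's lemma for the set of flats applies: the sums over a pair of
-- flats with x and y points number at least x + y - 1, with three translates; over one flat with itself, they
-- number (e + 1 + 1/100) x - O(m) if e ≥ 2, with m small by the minimality of e.  For e = 1 there is no slack, and
-- one compares A with the set in which the x points on a line are replaced by {0 , … , x - 1}.
--
-- The statement is decidable for given A and number of translates, so that it suffices to prove its double
-- negation; completeness of ℝ makes equality and all negated propositions decidable.

-- Freiman's lemma yields (d + 1)|A| - d(d + 1)/2 elements of A + A, but with all of A as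
-- translates. The difficulty is to lose only a constant with boundedly many. The extreme-element
-- estimate loses a multiple of the largest hyperplane section m, which may itself be a positive
-- proportion of |A|. The surplus |A| / 100 pays for such losses once the sections are small enough.
-- On a bounded number of flats this turns a total error of order m into nothing, and the only loss
-- that remains is the d(d + 1)/2 of Freiman's lemma, which lies below 5(d + 1)³.
--
-- The quotients by ℤ(v₁ - v₀) are not vector spaces, so the first half is set in abelian groups
-- with translation invariant preorders. Dimension is never expressed by a basis. It is a game,
-- "against any fewer than e vectors there is a functional (or a subgroup) such that ...", and
-- passing to a quotient, a kernel or a smaller set amounts to playing one further vector.

open import Defs
open import Data.Nat using (ℕ; suc; _+_; _*_; _^_; _≤_; NonZero)
open import Data.Fin using (Fin)
open import Data.Product using (Σ; ∃-syntax; _×_)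

open import Level using (0ℓ)
open import Data.Nat as ℕ using (zero; pred; _<_; _≤?_; _≤ᵇ_; z≤n; s≤s)
import Data.Nat.Properties as ℕₚ
open import Data.Nat.DivMod using (_/_; m/n*n≤m; m*n/n≡m; /-monoˡ-≤)
open import Data.Bool using (Bool; true; T; _∧_)
open import Data.Bool.Properties using (T-∧)
open import Data.Unit using (⊤; tt)
open import Data.Empty using (⊥; ⊥-elim)
open import Data.Fin using (zero; suc; #_)
open import Data.Fin.Properties using (all?; any?; 0≢1+n; _≟_)
open import Data.Product using (∃; _,_; proj₁; proj₂)
open import Data.Sum as Sum using (_⊎_; inj₁; inj₂)
open import Data.Vec as Vec using (Vec; []; _∷_)
open import Data.List using (List; []; _∷_; _++_; allFin; cartesianProduct; cartesianProductWith; filter; length; lookup; map; tabulate; take; upTo)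
open import Data.List.Properties using (length-++; length-map; length-tabulate; length-take; length-upTo)
open import Data.List.Relation.Unary.All as All using (All; []; _∷_)
import Data.List.Relation.Unary.All.Properties as Allₚ
open import Data.List.Relation.Unary.Any as Any using (Any; here; there)
open import Data.List.Relation.Unary.AllPairs using (AllPairs; []; _∷_)
import Data.List.Relation.Unary.AllPairs.Properties as Pairsₚ
import Data.List.Relation.Unary.Unique.Propositional.Properties as Uniqueₚ
open import Data.List.Membership.Propositional using (_∈_; find; lose)
open import Data.List.Membership.Propositional.Properties
  using (∈-allFin; ∈-cartesianProduct⁺; ∈-cartesianProductWith⁺; ∈-cartesianProductWith⁻; ∈-filter⁺; ∈-filter⁻; ∈-lookup; ∈-map⁺; ∈-map⁻;
         ∈-tabulate⁺; ∈-tabulate⁻; ∈-upTo⁺; ∈-upTo⁻; ∈-++⁺ˡ; ∈-++⁺ʳ; ∈-++⁻)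
open import Data.List.Relation.Binary.Permutation.Propositional as ↭ using (_↭_)
open import Data.List.Relation.Binary.Permutation.Propositional.Properties using (All-resp-↭; ∈-resp-↭)
open import Function using (_∘_; id; Equivalence)
open import Relation.Nullary using (¬_; Dec; yes; no)
open import Relation.Nullary.Decidable using (¬?; _×-dec_; decidable-stable; map′)
open import Relation.Unary using (Decidable)
open import Relation.Binary.PropositionalEquality using (_≡_; refl; sym; trans; cong; cong₂; subst)
open import Relation.Binary.Structures using (IsTotalOrder)
open import Algebra.Bundles using (AbelianGroup)

-- Linear arithmetic over ℕ, by Farkas certificates: a ≤ b follows from the hypotheses lᵢ ≤ rᵢ as soon as
-- k a + Σ cᵢ rᵢ is coefficientwise at most k b + Σ cᵢ lᵢ, where k is positive.
module Linear where

  infixl 6 _:+_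
  infixl 7 _:*_
  infix 5 _:≤_

  data Lin (n : ℕ) : Set where
    con  : ℕ → Lin n
    var  : Fin n → Lin n
    _:+_ : Lin n → Lin n → Lin n
    _:*_ : ℕ → Lin n → Lin n

  u0 : ∀ {n} → Lin (suc n)
  u0 = var zero
  u1 : ∀ {n} → Lin (suc (suc n))
  u1 = var (suc zero)
  u2 : ∀ {n} → Lin (3 + n)
  u2 = var (suc (suc zero))
  u3 : ∀ {n} → Lin (4 + n)
  u3 = var (suc (suc (suc zero)))
  u4 : ∀ {n} → Lin (5 + n)
  u4 = var (suc (suc (suc (suc zero))))
  u5 : ∀ {n} → Lin (6 + n)
  u5 = var (suc (suc (suc (suc (suc zero)))))
  u6 : ∀ {n} → Lin (7 + n)
  u6 = var (suc (suc (suc (suc (suc (suc zero))))))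
  u7 : ∀ {n} → Lin (8 + n)
  u7 = var (suc (suc (suc (suc (suc (suc (suc zero)))))))
  u8 : ∀ {n} → Lin (9 + n)
  u8 = var (suc (suc (suc (suc (suc (suc (suc (suc zero))))))))

  -- Coefficients act from the right, as in `length A * 301` below, so that hypotheses match by
  -- computation. A strict inequality is entered with `con 1 :+`.
  ⟦_⟧ : ∀ {n} → Lin n → Vec ℕ n → ℕ
  ⟦ con k ⟧ ρ = k
  ⟦ var i ⟧ ρ = Vec.lookup ρ i
  ⟦ e :+ f ⟧ ρ = ⟦ e ⟧ ρ + ⟦ f ⟧ ρ
  ⟦ k :* e ⟧ ρ = ⟦ e ⟧ ρ * k

  Form : ℕ → Set
  Form n = ℕ × Vec ℕ n

  dot : ∀ {n} → Vec ℕ n → Vec ℕ n → ℕ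
  dot [] [] = 0
  dot (c ∷ cs) (x ∷ xs) = x * c + dot cs xs

  value : ∀ {n} → Form n → Vec ℕ n → ℕ
  value (k , cs) ρ = k + dot cs ρ

  unit : ∀ {n} → Fin n → Vec ℕ n
  unit {suc n} zero = 1 ∷ Vec.replicate n 0
  unit {suc n} (suc i) = 0 ∷ unit i

  form : ∀ {n} → Lin n → Form n
  form {n} (con k) = k , Vec.replicate n 0
  form (var i) = 0 , unit i
  form (e :+ f) = proj₁ (form e) + proj₁ (form f) , Vec.zipWith _+_ (proj₂ (form e)) (proj₂ (form f))
  form (k :* e) = proj₁ (form e) * k , Vec.map (_* k) (proj₂ (form e))

  private
    dot-0 : ∀ {n} (ρ : Vec ℕ n) → dot (Vec.replicate n 0) ρ ≡ 0
    dot-0 [] = refl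
    dot-0 (x ∷ ρ) = cong₂ _+_ (ℕₚ.*-zeroʳ x) (dot-0 ρ)

    dot-unit : ∀ {n} (i : Fin n) ρ → dot (unit i) ρ ≡ Vec.lookup ρ i
    dot-unit zero (x ∷ ρ) = trans (cong (x * 1 +_) (dot-0 ρ)) (trans (ℕₚ.+-identityʳ _) (ℕₚ.*-identityʳ x))
    dot-unit (suc i) (x ∷ ρ) = cong₂ _+_ (ℕₚ.*-zeroʳ x) (dot-unit i ρ)

    interchange : ∀ a b c d → (a + b) + (c + d) ≡ (a + c) + (b + d)
    interchange a b c d = trans (ℕₚ.+-assoc a b (c + d))
      (trans (cong (a +_) (trans (sym (ℕₚ.+-assoc b c d)) (trans (cong (_+ d) (ℕₚ.+-comm b c)) (ℕₚ.+-assoc c b d))))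
        (sym (ℕₚ.+-assoc a c (b + d))))

    dot-+ : ∀ {n} (cs ds ρ : Vec ℕ n) → dot (Vec.zipWith _+_ cs ds) ρ ≡ dot cs ρ + dot ds ρ
    dot-+ [] [] [] = refl
    dot-+ (c ∷ cs) (d ∷ ds) (x ∷ ρ) =
      trans (cong₂ _+_ (ℕₚ.*-distribˡ-+ x c d) (dot-+ cs ds ρ)) (interchange (x * c) (x * d) _ _)

    dot-* : ∀ {n} k (cs ρ : Vec ℕ n) → dot (Vec.map (_* k) cs) ρ ≡ dot cs ρ * k
    dot-* k [] [] = refl
    dot-* k (c ∷ cs) (x ∷ ρ) =
      trans (cong₂ _+_ (sym (ℕₚ.*-assoc x c k)) (dot-* k cs ρ)) (sym (ℕₚ.*-distribʳ-+ k (x * c) _))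

  form-correct : ∀ {n} (e : Lin n) ρ → value (form e) ρ ≡ ⟦ e ⟧ ρ
  form-correct (con k) ρ = trans (cong (k +_) (dot-0 ρ)) (ℕₚ.+-identityʳ k)
  form-correct (var i) ρ = dot-unit i ρ
  form-correct (e :+ f) ρ =
    trans (cong ((proj₁ (form e) + proj₁ (form f)) +_) (dot-+ (proj₂ (form e)) (proj₂ (form f)) ρ))
      (trans (interchange (proj₁ (form e)) _ _ _) (cong₂ _+_ (form-correct e ρ) (form-correct f ρ)))
  form-correct (k :* e) ρ =
    trans (cong (proj₁ (form e) * k +_) (dot-* k (proj₂ (form e)) ρ))
      (trans (sym (ℕₚ.*-distribʳ-+ k (proj₁ (form e)) _)) (cong (_* k) (form-correct e ρ)))

  leq : ∀ {n} → Vec ℕ n → Vec ℕ n → Bool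
  leq [] [] = true
  leq (c ∷ cs) (d ∷ ds) = (c ≤ᵇ d) ∧ leq cs ds

  private
    leq-correct : ∀ {n} (cs ds ρ : Vec ℕ n) → T (leq cs ds) → dot cs ρ ≤ dot ds ρ
    leq-correct [] [] [] _ = z≤n
    leq-correct (c ∷ cs) (d ∷ ds) (x ∷ ρ) p with Equivalence.to T-∧ p
    ... | q , r = ℕₚ.+-mono-≤ (ℕₚ.*-monoʳ-≤ x (ℕₚ.≤ᵇ⇒≤ c d q)) (leq-correct cs ds ρ r)

  data Ineq (n : ℕ) : Set where
    _:≤_ : Lin n → Lin n → Ineq n

  Holds : ∀ {n} → Vec ℕ n → Ineq n → Set
  Holds ρ (a :≤ b) = ⟦ a ⟧ ρ ≤ ⟦ b ⟧ ρ

  upper lower : ∀ {n} → List (ℕ × Ineq n) → Lin n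
  upper [] = con 0
  upper ((c , (l :≤ r)) ∷ hs) = c :* r :+ upper hs
  lower [] = con 0
  lower ((c , (l :≤ r)) ∷ hs) = c :* l :+ lower hs

  private
    lower≤upper : ∀ {n} ρ (hs : List (ℕ × Ineq n)) → All (Holds ρ ∘ proj₂) hs → ⟦ lower hs ⟧ ρ ≤ ⟦ upper hs ⟧ ρ
    lower≤upper ρ [] [] = z≤n
    lower≤upper ρ ((c , (l :≤ r)) ∷ hs) (p ∷ ps) = ℕₚ.+-mono-≤ (ℕₚ.*-monoˡ-≤ c p) (lower≤upper ρ hs ps)

  -- The multiplier of the goal is `suc k`, which is nonzero and is cancelled in `linear`. The check
  -- involves only closed coefficients, so it evaluates to `true` whatever the variables stand for.
  certified : ∀ {n} → List (ℕ × Ineq n) → ℕ → Ineq n → Bool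
  certified hs k (a :≤ b) =
    (proj₁ (form l) ≤ᵇ proj₁ (form r)) ∧ leq (proj₂ (form l)) (proj₂ (form r))
    where
    l r : Lin _
    l = suc k :* a :+ upper hs
    r = suc k :* b :+ lower hs

  linear : ∀ {n} (ρ : Vec ℕ n) (hs : List (ℕ × Ineq n)) (k : ℕ) (g : Ineq n) → {T (certified hs k g)} →
    All (Holds ρ ∘ proj₂) hs → Holds ρ g
  linear ρ hs k (a :≤ b) {ok} ps with Equivalence.to T-∧ ok
  ... | p , q = ℕₚ.*-cancelʳ-≤ _ _ (suc k) (ℕₚ.+-cancelʳ-≤ (⟦ upper hs ⟧ ρ) _ _
      (ℕₚ.≤-trans step (ℕₚ.+-monoʳ-≤ (⟦ b ⟧ ρ * suc k) (lower≤upper ρ hs ps))))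
    where
    l r : Lin _
    l = suc k :* a :+ upper hs
    r = suc k :* b :+ lower hs
    step : ⟦ l ⟧ ρ ≤ ⟦ r ⟧ ρ
    step = subst (_≤ ⟦ r ⟧ ρ) (form-correct l ρ) (subst (value (form l) ρ ≤_) (form-correct r ρ)
      (ℕₚ.+-mono-≤ (ℕₚ.≤ᵇ⇒≤ _ _ p) (leq-correct (proj₂ (form l)) (proj₂ (form r)) ρ q)))

-- Pigeonhole principle and lengths of filtered lists.

private
  remove : ∀ {A B : Set} (R : A → B → Set) {x} {ys : List B} → Any (R x) ys →
    ∃ λ ys' → (length ys ≡ suc (length ys')) ×
      (∀ x' → (∀ y → R x y → R x' y → ⊥) → Any (R x') ys → Any (R x') ys')
  remove R {ys = y ∷ ys} (here r) = ys , refl , λ where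
    x' ne (here r') → ⊥-elim (ne y r r')
    x' ne (there p) → p
  remove R {ys = y ∷ ys} (there p) with remove R p
  ... | ys' , eq , keep = y ∷ ys' , cong suc eq , λ where
    x' ne (here r') → here r'
    x' ne (there q) → there (keep x' ne q)

-- `R` is a relation in which no two entries of `xs` share a partner. Congruence modulo a subgroup
-- to the entries of a list is of this kind, so counting modulo a subgroup requires no quotient set.
pigeonhole : ∀ {A B : Set} (R : A → B → Set) (xs : List A) (ys : List B) →
  AllPairs (λ x x' → ∀ y → R x y → R x' y → ⊥) xs → All (λ x → Any (R x) ys) xs → length xs ≤ length ys
pigeonhole R [] ys _ _ = z≤n
pigeonhole R (x ∷ xs) ys (d ∷ ds) (m ∷ ms) with remove R m
... | ys' , eq , keep = subst (suc (length xs) ≤_) (sym eq)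
  (s≤s (pigeonhole R xs ys' ds (All.zipWith (λ { {x'} (ne , a) → keep x' ne a }) (d , ms))))

module _ {A : Set} {P : A → Set} (P? : Decidable P) where

  length-filter-∁ : ∀ xs → length xs ≡ length (filter P? xs) + length (filter (¬? ∘ P?) xs)
  length-filter-∁ [] = refl
  length-filter-∁ (x ∷ xs) with P? x
  ... | yes p = cong suc (length-filter-∁ xs)
  ... | no ¬p = trans (cong suc (length-filter-∁ xs)) (sym (ℕₚ.+-suc _ _))

  module _ {Q : A → Set} (Q? : Decidable Q) where

    length-filter-mono : ∀ xs → (∀ {x} → x ∈ xs → P x → Q x) → length (filter P? xs) ≤ length (filter Q? xs)
    length-filter-mono [] h = z≤n
    length-filter-mono (x ∷ xs) h with P? x | Q? x
    ... | yes p | yes q = s≤s (length-filter-mono xs (h ∘ there))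
    ... | yes p | no ¬q = ⊥-elim (¬q (h (here refl) p))
    ... | no ¬p | yes q = ℕₚ.m≤n⇒m≤1+n (length-filter-mono xs (h ∘ there))
    ... | no ¬p | no ¬q = length-filter-mono xs (h ∘ there)

    length-filter-strict : ∀ {y} xs → (∀ {x} → x ∈ xs → P x → Q x) → y ∈ xs → ¬ P y → Q y →
      length (filter P? xs) < length (filter Q? xs)
    length-filter-strict (x ∷ xs) h (here refl) ¬py qy with P? x | Q? x
    ... | yes p | _ = ⊥-elim (¬py p)
    ... | no _ | yes q = s≤s (length-filter-mono xs (h ∘ there))
    ... | no _ | no ¬q = ⊥-elim (¬q qy)
    length-filter-strict (x ∷ xs) h (there m) ¬py qy with P? x | Q? x
    ... | yes p | yes q = s≤s (length-filter-strict xs (h ∘ there) m ¬py qy)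
    ... | yes p | no ¬q = ⊥-elim (¬q (h (here refl) p))
    ... | no ¬p | yes q = ℕₚ.m≤n⇒m≤1+n (length-filter-strict xs (h ∘ there) m ¬py qy)
    ... | no ¬p | no ¬q = length-filter-strict xs (h ∘ there) m ¬py qy

    length-filter-⊎ : ∀ {R : A → Set} (R? : Decidable R) xs → (∀ {x} → x ∈ xs → P x → Q x ⊎ R x) →
      length (filter P? xs) ≤ length (filter Q? xs) + length (filter R? xs)
    length-filter-⊎ R? [] h = z≤n
    length-filter-⊎ R? (x ∷ xs) h with P? x | Q? x | R? x
    ... | no _ | yes _ | yes _ = ℕₚ.m≤n⇒m≤1+n (ℕₚ.≤-trans (length-filter-⊎ R? xs (h ∘ there)) (ℕₚ.+-monoʳ-≤ (length (filter Q? xs)) (ℕₚ.n≤1+n _)))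
    ... | no _ | yes _ | no _ = ℕₚ.m≤n⇒m≤1+n (length-filter-⊎ R? xs (h ∘ there))
    ... | no _ | no _ | yes _ = ℕₚ.≤-trans (length-filter-⊎ R? xs (h ∘ there)) (ℕₚ.+-monoʳ-≤ (length (filter Q? xs)) (ℕₚ.n≤1+n _))
    ... | no _ | no _ | no _ = length-filter-⊎ R? xs (h ∘ there)
    ... | yes _ | yes _ | yes _ = s≤s (ℕₚ.≤-trans (length-filter-⊎ R? xs (h ∘ there)) (ℕₚ.+-monoʳ-≤ (length (filter Q? xs)) (ℕₚ.n≤1+n _)))
    ... | yes _ | yes _ | no _ = s≤s (length-filter-⊎ R? xs (h ∘ there))
    ... | yes _ | no _ | yes _ = subst (suc (length (filter P? xs)) ≤_) (sym (ℕₚ.+-suc _ _)) (s≤s (length-filter-⊎ R? xs (h ∘ there)))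
    ... | yes p | no ¬q | no ¬r with h (here refl) p
    ...   | inj₁ q = ⊥-elim (¬q q)
    ...   | inj₂ r = ⊥-elim (¬r r)

-- Identities in abelian groups, by comparison of the multiplicities of the variables with positive and
-- with negative sign.
module GroupSolver (G : AbelianGroup 0ℓ 0ℓ) where
  open AbelianGroup G renaming (_∙_ to infixl 6 _⊕_; ε to 𝟘; _⁻¹ to ⊝_; refl to ≈-refl; sym to ≈-sym; trans to ≈-trans)
  open import Algebra.Properties.Monoid.Mult monoid using (×-homo-+) renaming (_×_ to _·_)
  open import Algebra.Properties.AbelianGroup G using (⁻¹-∙-comm; ε⁻¹≈ε; ⁻¹-involutive)
  open import Algebra.Properties.CommutativeSemigroup commutativeSemigroup using (interchange)
  open import Relation.Binary.Reasoning.Setoid setoid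

  infixl 6 _⊖_
  _⊖_ : Carrier → Carrier → Carrier
  x ⊖ y = x ⊕ (⊝ y)

  infixl 6 _:+_ _:-_
  data Expr (n : ℕ) : Set where
    :0   : Expr n
    var  : Fin n → Expr n
    _:+_ : Expr n → Expr n → Expr n
    _:-_ : Expr n → Expr n → Expr n

  x0 : ∀ {n} → Expr (suc n)
  x0 = var zero
  x1 : ∀ {n} → Expr (suc (suc n))
  x1 = var (suc zero)
  x2 : ∀ {n} → Expr (3 + n)
  x2 = var (suc (suc zero))
  x3 : ∀ {n} → Expr (4 + n)
  x3 = var (suc (suc (suc zero)))
  x4 : ∀ {n} → Expr (5 + n)
  x4 = var (suc (suc (suc (suc zero))))
  x5 : ∀ {n} → Expr (6 + n)
  x5 = var (suc (suc (suc (suc (suc zero)))))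

  ⟦_⟧ : ∀ {n} → Expr n → Vec Carrier n → Carrier
  ⟦ :0 ⟧ ρ = 𝟘
  ⟦ var i ⟧ ρ = Vec.lookup ρ i
  ⟦ e :+ f ⟧ ρ = ⟦ e ⟧ ρ ⊕ ⟦ f ⟧ ρ
  ⟦ e :- f ⟧ ρ = ⟦ e ⟧ ρ ⊖ ⟦ f ⟧ ρ

  pos neg : ∀ {n} → Expr n → Vec ℕ n
  pos {n} :0 = Vec.replicate n 0
  pos (var i) = Linear.unit i
  pos (e :+ f) = Vec.zipWith _+_ (pos e) (pos f)
  pos (e :- f) = Vec.zipWith _+_ (pos e) (neg f)
  neg {n} :0 = Vec.replicate n 0
  neg {n} (var i) = Vec.replicate n 0
  neg (e :+ f) = Vec.zipWith _+_ (neg e) (neg f)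
  neg (e :- f) = Vec.zipWith _+_ (neg e) (pos f)

  private
    comb : ∀ {n} → Vec ℕ n → Vec Carrier n → Carrier
    comb [] [] = 𝟘
    comb (k ∷ ks) (x ∷ ρ) = k · x ⊕ comb ks ρ

    comb-0 : ∀ {n} (ρ : Vec Carrier n) → comb (Vec.replicate n 0) ρ ≈ 𝟘
    comb-0 [] = ≈-refl
    comb-0 (x ∷ ρ) = ≈-trans (identityˡ _) (comb-0 ρ)

    comb-unit : ∀ {n} (i : Fin n) ρ → comb (Linear.unit i) ρ ≈ Vec.lookup ρ i
    comb-unit zero (x ∷ ρ) = ≈-trans (∙-cong (identityʳ x) (comb-0 ρ)) (identityʳ x)
    comb-unit (suc i) (x ∷ ρ) = ≈-trans (identityˡ _) (comb-unit i ρ)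

    comb-+ : ∀ {n} (ks ls : Vec ℕ n) ρ → comb (Vec.zipWith _+_ ks ls) ρ ≈ comb ks ρ ⊕ comb ls ρ
    comb-+ [] [] [] = ≈-sym (identityˡ 𝟘)
    comb-+ (k ∷ ks) (l ∷ ls) (x ∷ ρ) = ≈-trans (∙-cong (×-homo-+ x k l) (comb-+ ks ls ρ)) (interchange _ _ _ _)

    ⊖-⊕ : ∀ a b c d → (a ⊖ b) ⊕ (c ⊖ d) ≈ (a ⊕ c) ⊖ (b ⊕ d)
    ⊖-⊕ a b c d = ≈-trans (interchange a (⊝ b) c (⊝ d)) (∙-congˡ (⁻¹-∙-comm b d))

    ⊖-⊖ : ∀ a b c d → (a ⊖ b) ⊖ (c ⊖ d) ≈ (a ⊕ d) ⊖ (b ⊕ c)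
    ⊖-⊖ a b c d = begin
      (a ⊖ b) ⊕ (⊝ (c ⊖ d))       ≈⟨ ∙-congˡ (⁻¹-∙-comm c (⊝ d)) ⟨
      (a ⊖ b) ⊕ ((⊝ c) ⊖ (⊝ d))   ≈⟨ ∙-congˡ (∙-congˡ (⁻¹-involutive d)) ⟩
      (a ⊖ b) ⊕ ((⊝ c) ⊕ d)       ≈⟨ ∙-congˡ (comm (⊝ c) d) ⟩
      (a ⊖ b) ⊕ (d ⊖ c)           ≈⟨ ⊖-⊕ a b d c ⟩
      (a ⊕ d) ⊖ (b ⊕ c)           ∎

    correct : ∀ {n} (e : Expr n) ρ → ⟦ e ⟧ ρ ≈ comb (pos e) ρ ⊖ comb (neg e) ρ
    correct :0 ρ = ≈-sym (≈-trans (∙-cong (comb-0 ρ) (⁻¹-cong (comb-0 ρ))) (inverseʳ 𝟘))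
    correct (var i) ρ = ≈-sym (≈-trans (∙-cong (comb-unit i ρ) (≈-trans (⁻¹-cong (comb-0 ρ)) ε⁻¹≈ε)) (identityʳ _))
    correct (e :+ f) ρ = ≈-trans (∙-cong (correct e ρ) (correct f ρ)) (≈-trans (⊖-⊕ _ _ _ _)
      (≈-sym (∙-cong (comb-+ (pos e) (pos f) ρ) (⁻¹-cong (comb-+ (neg e) (neg f) ρ)))))
    correct (e :- f) ρ = ≈-trans (∙-cong (correct e ρ) (⁻¹-cong (correct f ρ))) (≈-trans (⊖-⊖ _ _ _ _)
      (≈-sym (∙-cong (comb-+ (pos e) (neg f) ρ) (⁻¹-cong (comb-+ (neg e) (pos f) ρ)))))

    transfer : ∀ a b c d → a ⊕ d ≈ c ⊕ b → a ⊖ b ≈ c ⊖ d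
    transfer a b c d h = begin
      a ⊖ b                ≈⟨ identityʳ _ ⟨
      (a ⊖ b) ⊕ 𝟘          ≈⟨ ∙-congˡ (inverseʳ d) ⟨
      (a ⊖ b) ⊕ (d ⊖ d)    ≈⟨ ⊖-⊕ a b d d ⟩
      (a ⊕ d) ⊖ (b ⊕ d)    ≈⟨ ∙-cong h (⁻¹-cong (comm b d)) ⟩
      (c ⊕ b) ⊖ (d ⊕ b)    ≈⟨ ⊖-⊕ c d b b ⟨
      (c ⊖ d) ⊕ (b ⊖ b)    ≈⟨ ∙-congˡ (inverseʳ b) ⟩
      (c ⊖ d) ⊕ 𝟘          ≈⟨ identityʳ _ ⟩
      c ⊖ d                ∎

  solve : ∀ {n} (e f : Expr n) (ρ : Vec Carrier n) →
    Vec.zipWith _+_ (pos e) (neg f) ≡ Vec.zipWith _+_ (pos f) (neg e) → ⟦ e ⟧ ρ ≈ ⟦ f ⟧ ρ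
  solve e f ρ eq = begin
    ⟦ e ⟧ ρ                           ≈⟨ correct e ρ ⟩
    comb (pos e) ρ ⊖ comb (neg e) ρ   ≈⟨ transfer _ _ _ _ balanced ⟩
    comb (pos f) ρ ⊖ comb (neg f) ρ   ≈⟨ correct f ρ ⟨
    ⟦ f ⟧ ρ                           ∎
    where
    balanced : comb (pos e) ρ ⊕ comb (neg f) ρ ≈ comb (pos f) ρ ⊕ comb (neg e) ρ
    balanced = begin
      comb (pos e) ρ ⊕ comb (neg f) ρ             ≈⟨ comb-+ (pos e) (neg f) ρ ⟨
      comb (Vec.zipWith _+_ (pos e) (neg f)) ρ    ≡⟨ cong (λ ks → comb ks ρ) eq ⟩
      comb (Vec.zipWith _+_ (pos f) (neg e)) ρ    ≈⟨ comb-+ (pos f) (neg e) ρ ⟩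
      comb (pos f) ρ ⊕ comb (neg e) ρ             ∎

allPairs-map∈ : ∀ {A : Set} {R S : A → A → Set} {xs : List A} → (∀ {x y} → x ∈ xs → y ∈ xs → R x y → S x y) →
  AllPairs R xs → AllPairs S xs
allPairs-map∈ {xs = []} h [] = []
allPairs-map∈ {xs = x ∷ xs} h (p ∷ ps) =
  All.tabulate (λ m → h (here refl) (there m) (All.lookup p m)) ∷ allPairs-map∈ (λ mx my → h (there mx) (there my)) ps

length-filter₂ : ∀ {A : Set} {P Q R : A → Set} (P? : ∀ x → Dec (P x)) (Q? : ∀ x → Dec (Q x)) (R? : ∀ x → Dec (R x)) xs →
  (∀ {x} → x ∈ xs → P x → Q x → R x) → length (filter Q? (filter P? xs)) ≤ length (filter R? xs)
length-filter₂ P? Q? R? [] h = z≤n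
length-filter₂ P? Q? R? (x ∷ xs) h with P? x
... | no _ with R? x
...   | yes _ = ℕₚ.m≤n⇒m≤1+n (length-filter₂ P? Q? R? xs (h ∘ there))
...   | no _ = length-filter₂ P? Q? R? xs (h ∘ there)
length-filter₂ P? Q? R? (x ∷ xs) h | yes p with Q? x | R? x
...   | yes _ | yes _ = s≤s (length-filter₂ P? Q? R? xs (h ∘ there))
...   | yes q | no ¬r = ⊥-elim (¬r (h (here refl) p q))
...   | no _ | yes _ = ℕₚ.m≤n⇒m≤1+n (length-filter₂ P? Q? R? xs (h ∘ there))
...   | no _ | no _ = length-filter₂ P? Q? R? xs (h ∘ there)

length-filter-filter : ∀ {A : Set} {P Q : A → Set} (P? : ∀ x → Dec (P x)) (Q? : ∀ x → Dec (Q x)) xs →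
  length (filter Q? (filter P? xs)) ≤ length (filter Q? xs)
length-filter-filter P? Q? xs = length-filter₂ P? Q? Q? xs (λ _ _ q → q)

length-filter-all : ∀ {A : Set} {P : A → Set} (P? : ∀ x → Dec (P x)) xs → (∀ {x} → x ∈ xs → P x) →
  length xs ≤ length (filter P? xs)
length-filter-all P? [] h = z≤n
length-filter-all P? (x ∷ xs) h with P? x
... | yes _ = s≤s (length-filter-all P? xs (h ∘ there))
... | no ¬p = ⊥-elim (¬p (h (here refl)))

-- Subgroups, translation invariant preorders and extreme elements.

module Core (G : AbelianGroup 0ℓ 0ℓ) (¬-dec : (P : Set) → Dec (¬ P)) where
  open AbelianGroup G public using (Carrier; _≈_; monoid)
    renaming (_∙_ to infixl 6 _⊕_; ε to 𝟘; ∙-cong to ⊕-cong; refl to ≈-refl; sym to ≈-sym; trans to ≈-trans)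
  open GroupSolver G public
  open Linear using (linear; _:+_; _:≤_; u0; u1; u2; u3; u4; u5)
  open import Algebra.Properties.Monoid.Mult monoid using (×-homo-+) renaming (_×_ to _·_)

  -- A subgroup stands for the quotient by it: elements stay in `Carrier` and only distinctness
  -- changes, so one list can be counted in several quotients.
  record Subgroup : Set₁ where
    field
      In   : Carrier → Set
      resp : ∀ {x y} → x ≈ y → In x → In y
      zero∈ : In 𝟘
      add  : ∀ {x y} → In x → In y → In (x ⊕ y)
      opp  : ∀ {x} → In x → In (𝟘 ⊖ x)
      dec  : ∀ x → Dec (In x)

    sub : ∀ {x y} → In x → In y → In (x ⊖ y)
    sub {x} {y} p q = resp (solve (x0 :+ (:0 :- x1)) (x0 :- x1) (x ∷ y ∷ []) refl) (add p (opp q))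

  -- The cone of nonnegative elements of a translation invariant total preorder.
  record Cone : Set₁ where
    field
      Pos   : Carrier → Set
      resp  : ∀ {x y} → x ≈ y → Pos x → Pos y
      add   : ∀ {x y} → Pos x → Pos y → Pos (x ⊕ y)
      total : ∀ x → Pos x ⊎ Pos (𝟘 ⊖ x)
      dec   : ∀ x → Dec (Pos x)

    pos-0 : Pos 𝟘
    pos-0 with total 𝟘
    ... | inj₁ p = p
    ... | inj₂ p = resp (solve (:0 :- :0) :0 [] refl) p

    flip : ∀ x y → ¬ Pos (x ⊖ y) → Pos (y ⊖ x)
    flip x y ¬p with total (x ⊖ y)
    ... | inj₁ p = ⊥-elim (¬p p)
    ... | inj₂ p = resp (solve (:0 :- (x0 :- x1)) (x1 :- x0) (x ∷ y ∷ []) refl) p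

    Ker : Carrier → Set
    Ker x = Pos x × Pos (𝟘 ⊖ x)

    ker? : ∀ x → Dec (Ker x)
    ker? x = dec x ×-dec dec (𝟘 ⊖ x)

    infix 4 _≼_ _≺_
    _≼_ _≺_ : Carrier → Carrier → Set
    x ≼ y = Pos (y ⊖ x)
    x ≺ y = ¬ Pos (x ⊖ y)

    ≼-trans : ∀ {x y z} → x ≼ y → y ≼ z → x ≼ z
    ≼-trans {x} {y} {z} p q = resp (solve ((x1 :- x0) :+ (x2 :- x1)) (x2 :- x0) (x ∷ y ∷ z ∷ []) refl) (add p q)

    ≼-refl : ∀ x → x ≼ x
    ≼-refl x = resp (solve :0 (x0 :- x0) (x ∷ []) refl) pos-0

    ≺-≼-trans : ∀ {x y z} → x ≺ y → y ≼ z → x ≺ z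
    ≺-≼-trans p q r = p (≼-trans q r)

    least : ∀ x xs → ∃ λ y → y ∈ (x ∷ xs) × (∀ {z} → z ∈ (x ∷ xs) → y ≼ z)
    least x [] = x , here refl , λ { (here refl) → ≼-refl x }
    least x (x' ∷ xs) with least x' xs
    ... | y , m , min with dec (y ⊖ x)
    ...   | yes x≼y = x , here refl , λ { (here refl) → ≼-refl x ; (there q) → ≼-trans x≼y (min q) }
    ...   | no y≺x = y , there m , λ { (here refl) → flip y x y≺x ; (there q) → min q }

    least∈ : ∀ {x} xs → x ∈ xs → ∃ λ y → y ∈ xs × (∀ {z} → z ∈ xs → y ≼ z)
    least∈ (x ∷ xs) _ = least x xs

    -- `≺` need not be well-founded on the group. On a finite list, the number of strictly smaller
    -- entries serves as a measure.
    list-induction : ∀ (xs : List Carrier) (P : Carrier → Set) →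
      (∀ {x} → x ∈ xs → (∀ {y} → y ∈ xs → y ≺ x → P y) → P x) → ∀ {x} → x ∈ xs → P x
    list-induction xs P step {x} m = go _ m ℕₚ.≤-refl
      where
      below : Carrier → ℕ
      below x = length (filter (λ z → ¬? (dec (z ⊖ x))) xs)
      go : ∀ k {x} → x ∈ xs → below x ≤ k → P x
      smaller : ∀ k {x y} → y ∈ xs → y ≺ x → below x ≤ k → P y
      go k m le = step m (λ my lt → smaller k my lt le)
      smaller k {x} {y} my y≺x le with ℕₚ.<-≤-trans
        (length-filter-strict (λ z → ¬? (dec (z ⊖ y))) (λ z → ¬? (dec (z ⊖ x))) {y} xs
          (λ _ z≺y → ≺-≼-trans z≺y (flip y x y≺x)) my (λ y≺y → y≺y (≼-refl y)) y≺x) le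
      smaller (suc k) my y≺x le | s≤s lt = go k my lt

  open Subgroup
  open Cone using (Pos)

  opposite : Cone → Cone
  opposite C = record
    { Pos = λ x → Pos C (𝟘 ⊖ x)
    ; resp = λ e → Cone.resp C (⊕-cong ≈-refl (AbelianGroup.⁻¹-cong G e))
    ; add = λ {x} {y} p q → Cone.resp C (solve ((:0 :- x0) :+ (:0 :- x1)) (:0 :- (x0 :+ x1)) (x ∷ y ∷ []) refl) (Cone.add C p q)
    ; total = λ x → swap x (Cone.total C x)
    ; dec = λ x → Cone.dec C (𝟘 ⊖ x)
    }
    where
    swap : ∀ x → Pos C x ⊎ Pos C (𝟘 ⊖ x) → Pos C (𝟘 ⊖ x) ⊎ Pos C (𝟘 ⊖ (𝟘 ⊖ x))
    swap x (inj₁ p) = inj₂ (Cone.resp C (solve x0 (:0 :- (:0 :- x0)) (x ∷ []) refl) p)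
    swap x (inj₂ p) = inj₁ p

  opposite⁺ : ∀ C {x y} → Pos C (x ⊖ y) → Pos (opposite C) (y ⊖ x)
  opposite⁺ C {x} {y} = Cone.resp C (solve (x0 :- x1) (:0 :- (x1 :- x0)) (x ∷ y ∷ []) refl)

  opposite⁻ : ∀ C {x y} → Pos (opposite C) (y ⊖ x) → Pos C (x ⊖ y)
  opposite⁻ C {x} {y} = Cone.resp C (solve (:0 :- (x1 :- x0)) (x0 :- x1) (x ∷ y ∷ []) refl)

  greatest : ∀ C x xs → ∃ λ y → y ∈ (x ∷ xs) × (∀ {z} → z ∈ (x ∷ xs) → Cone._≼_ C z y)
  greatest C x xs with Cone.least (opposite C) x xs
  ... | y , m , max = y , m , λ q → opposite⁻ C (max q)

  greatest∈ : ∀ C {x} xs → x ∈ xs → ∃ λ y → y ∈ xs × (∀ {z} → z ∈ xs → Cone._≼_ C z y)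
  greatest∈ C (x ∷ xs) _ = greatest C x xs

  DistinctMod : Subgroup → List Carrier → Set
  DistinctMod L = AllPairs (λ x y → ¬ In L (x ⊖ y))

  infix 4 _⊑_
  -- As `L` is closed under inverses, it then lies in the kernel of the cone, and the preorder
  -- descends to the quotient by `L`.
  _⊑_ : Subgroup → Cone → Set
  L ⊑ C = ∀ {x} → In L x → Pos C x

  ⊑-opposite : ∀ {L C} → L ⊑ C → L ⊑ opposite C
  ⊑-opposite {L} LC p = LC (opp L p)

  -- The double negation makes membership decidable.
  adjoin : Subgroup → Carrier → Subgroup
  adjoin L D = record
    { In = λ x → ¬ ¬ Multiple x
    ; resp = λ {x} {y} e ¬¬p ¬q → ¬¬p λ { (i , j , p) → ¬q (i , j , resp L (⊕-cong (⊕-cong ≈-refl e) ≈-refl) p) }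
    ; zero∈ = λ ¬p → ¬p (0 , 0 , resp L (solve :0 ((:0 :+ :0) :- :0) [] refl) (zero∈ L))
    ; add = λ {x} {y} ¬¬p ¬¬q ¬r → ¬¬p λ { (i , j , p) → ¬¬q λ { (i' , j' , q) → ¬r (i + i' , j + j' ,
        resp L (≈-trans (solve (((x0 :+ x1) :- x2) :+ ((x3 :+ x4) :- x5)) (((x0 :+ x3) :+ (x1 :+ x4)) :- (x2 :+ x5))
              (i · D ∷ x ∷ j · D ∷ i' · D ∷ y ∷ j' · D ∷ []) refl)
            (≈-sym (⊕-cong (⊕-cong (×-homo-+ D i i') ≈-refl) (AbelianGroup.⁻¹-cong G (×-homo-+ D j j')))))
          (add L p q)) } }
    ; opp = λ {x} ¬¬p ¬q → ¬¬p λ { (i , j , p) → ¬q (j , i ,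
        resp L (solve (:0 :- ((x0 :+ x1) :- x2)) ((x2 :+ (:0 :- x1)) :- x0) (i · D ∷ x ∷ j · D ∷ []) refl) (opp L p)) }
    ; dec = λ x → ¬-dec (¬ Multiple x)
    }
    where
    Multiple : Carrier → Set
    Multiple x = ∃ λ i → ∃ λ j → In L ((i · D ⊕ x) ⊖ j · D)

  ⊆-adjoin : ∀ L D {x} → In L x → In (adjoin L D) x
  ⊆-adjoin L D {x} p ¬q = ¬q (0 , 0 , resp L (solve x0 ((:0 :+ x0) :- :0) (x ∷ []) refl) p)

  ∈-adjoin : ∀ L D → In (adjoin L D) D
  ∈-adjoin L D ¬q = ¬q (0 , 1 , resp L (solve :0 ((:0 :+ x0) :- (x0 :+ :0)) (D ∷ []) refl) (zero∈ L))

  private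
    multiple-pos : ∀ C {D} → Pos C D → ∀ k → Pos C (k · D)
    multiple-pos C p zero = Cone.pos-0 C
    multiple-pos C p (suc k) = Cone.add C p (multiple-pos C p k)

  adjoin-⊑ : ∀ L D C → L ⊑ C → Cone.Ker C D → adjoin L D ⊑ C
  adjoin-⊑ L D C LC (p , n) {x} h = decidable-stable (Cone.dec C x) λ ¬x → h λ { (i , j , q) →
    ¬x (Cone.resp C (solve (((x0 :+ x1) :- x2) :+ ((:0 :- x0) :+ x2)) x1 (i · D ∷ x ∷ j · D ∷ []) refl)
      (Cone.add C (LC q) (Cone.add C (negative i) (multiple-pos C p j)))) }
    where
    negative : ∀ k → Pos C (𝟘 ⊖ k · D)
    negative zero = Cone.resp C (solve :0 (:0 :- :0) [] refl) (Cone.pos-0 C)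
    negative (suc k) = Cone.resp C (solve ((:0 :- x0) :+ (:0 :- x1)) (:0 :- (x0 :+ x1)) (D ∷ k · D ∷ []) refl)
      (Cone.add C n (negative k))

  -- The strip from `v₀` to `v₁` is half-open: two elements that differ by a nonzero multiple of `D`
  -- modulo `L` cannot both lie in it, as the upper one would reach `v₁`.
  adjoin-strip : ∀ L C → L ⊑ C → ∀ {v₀ v₁ a b} → Cone._≼_ C v₀ v₁ →
    Cone._≼_ C v₀ a → Cone._≺_ C a v₁ → Cone._≼_ C v₀ b → Cone._≺_ C b v₁ →
    In (adjoin L (v₁ ⊖ v₀)) (a ⊖ b) → In L (a ⊖ b)
  adjoin-strip L C LC {v₀} {v₁} {a} {b} v₀≼v₁ la ua lb ub h =
    decidable-stable (dec L _) λ ¬p → h λ { (i , j , q) → ¬p (cancel i j q) }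
    where
    D : Carrier
    D = v₁ ⊖ v₀
    cancel : ∀ i j → In L ((i · D ⊕ (a ⊖ b)) ⊖ j · D) → In L (a ⊖ b)
    cancel zero zero q = resp L (solve ((:0 :+ x0) :- :0) x0 (a ⊖ b ∷ []) refl) q
    cancel (suc i) (suc j) q = cancel i j (resp L
      (solve (((x0 :+ x1) :+ x2) :- (x0 :+ x3)) ((x1 :+ x2) :- x3) (D ∷ i · D ∷ a ⊖ b ∷ j · D ∷ []) refl) q)
    cancel zero (suc j) q = ⊥-elim (ua (Cone.resp C
      (solve ((((:0 :+ (x0 :- x1)) :- ((x2 :- x3) :+ x4)) :+ x4) :+ (x1 :- x3)) (x0 :- x2) (a ∷ b ∷ v₁ ∷ v₀ ∷ j · D ∷ []) refl)
      (Cone.add C (Cone.add C (LC q) (multiple-pos C v₀≼v₁ j)) lb)))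
    cancel (suc i) zero q = ⊥-elim (ub (Cone.resp C
      (solve (((:0 :- ((((x2 :- x3) :+ x4) :+ (x0 :- x1)) :- :0)) :+ x4) :+ (x0 :- x3)) (x1 :- x2) (a ∷ b ∷ v₁ ∷ v₀ ∷ i · D ∷ []) refl)
      (Cone.add C (Cone.add C (LC (opp L q)) (multiple-pos C v₀≼v₁ i)) la)))

  -- Distinctness modulo `L` depends only on the classes, so every entry may be exchanged for a
  -- member of its class with property `Q`.
  relabel : ∀ L (Q : Carrier → Set) ys → DistinctMod L ys → All (λ y → ∃ λ y' → Q y' × In L (y' ⊖ y)) ys →
    ∃ λ ys' → (length ys' ≡ length ys) × DistinctMod L ys' × All Q ys'
  relabel L Q ys d h with go ys d h
    where
    go : ∀ ys → DistinctMod L ys → All (λ y → ∃ λ y' → Q y' × In L (y' ⊖ y)) ys →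
      ∃ λ ys' → (length ys' ≡ length ys) × DistinctMod L ys' × All Q ys' × All (λ y' → Any (λ y → In L (y' ⊖ y)) ys) ys'
    go [] _ _ = [] , refl , [] , [] , []
    go (y ∷ ys) (d ∷ ds) ((y' , q , e) ∷ hs) with go ys ds hs
    ... | ys' , len , ds' , qs , cs = y' ∷ ys' , cong suc len ,
      All.map (λ {z'} c p → All.lookupWith (λ { {z} ¬r r → ¬r (resp L
          (solve (((x0 :- x1) :+ (x1 :- x3)) :- (x0 :- x2)) (x2 :- x3) (y' ∷ z' ∷ y ∷ z ∷ []) refl)
          (sub L (add L p r) e)) }) d c) cs ∷ ds' ,
      q ∷ qs , here e ∷ All.map there cs
  ... | ys' , len , ds' , qs , _ = ys' , len , ds' , qs

  ∈mod? : ∀ L x ys → Dec (Any (λ y → In L (x ⊖ y)) ys)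
  ∈mod? L x ys = Any.any? (λ y → dec L (x ⊖ y)) ys

  distinct-shift : ∀ L v {xs} → DistinctMod L xs → DistinctMod L (map (_⊕ v) xs)
  distinct-shift L v d = Pairsₚ.map⁺ (allPairs-map∈ (λ {x} {y} _ _ ¬p p → ¬p (resp L
    (solve ((x0 :+ x2) :- (x1 :+ x2)) (x0 :- x1) (x ∷ y ∷ v ∷ []) refl) p)) d)

  -- Every class of X modulo v₁ - v₀ contains a point outside A + v₁: descend from a + v₁ to a + v₀.
  excess : ∀ L C → L ⊑ C → ∀ v₀ v₁ → Cone._≺_ C v₀ v₁ → ∀ A → DistinctMod L A → (X : Carrier → Set) →
    (∀ {a} → a ∈ A → X (a ⊕ v₀)) → (∀ {a} → a ∈ A → X (a ⊕ v₁)) →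
    ∀ ys → DistinctMod (adjoin L (v₁ ⊖ v₀)) ys → All X ys →
    ∃ λ zs → (length zs ≡ length A + length ys) × DistinctMod L zs × All X zs
  excess L C LC v₀ v₁ lt A dA X X₀ X₁ ys dys xys with relabel L' Q ys dys (All.map move xys)
    where
    L' : Subgroup
    L' = adjoin L (v₁ ⊖ v₀)
    A₁ : List Carrier
    A₁ = map (_⊕ v₁) A
    Q : Carrier → Set
    Q y = X y × ¬ Any (λ z → In L (y ⊖ z)) A₁
    -- If `a ⊕ v₀` lies in `A₁` modulo `L`, it is some `b ⊕ v₁`. Then `b ≺ a`, because `v₀ ≺ v₁`,
    -- and `b` is in the class of `a` modulo `L'`; so the descent stays in the class and stops.
    low : ∀ {a} → a ∈ A → ∃ λ a' → a' ∈ A × In L' (a' ⊖ a) × ¬ Any (λ z → In L ((a' ⊕ v₀) ⊖ z)) A₁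
    low = Cone.list-induction C A _ λ {a} m ih → descend m ih (∈mod? L (a ⊕ v₀) A₁)
      where
      descend : ∀ {a} → a ∈ A →
        (∀ {b} → b ∈ A → Cone._≺_ C b a → ∃ λ a' → a' ∈ A × In L' (a' ⊖ b) × ¬ Any (λ z → In L ((a' ⊕ v₀) ⊖ z)) A₁) →
        Dec (Any (λ z → In L ((a ⊕ v₀) ⊖ z)) A₁) →
        ∃ λ a' → a' ∈ A × In L' (a' ⊖ a) × ¬ Any (λ z → In L ((a' ⊕ v₀) ⊖ z)) A₁
      descend {a} m ih (no ¬p) = a , m , resp L' (solve :0 (x0 :- x0) (a ∷ []) refl) (zero∈ L') , ¬p
      descend {a} m ih (yes p) with find p
      ... | z , mz , q with ∈-map⁻ (_⊕ v₁) mz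
      ...   | b , mb , refl with ih mb (λ a≼b → lt (Cone.resp C
                (solve ((x1 :- x0) :+ ((x0 :+ x2) :- (x1 :+ x3))) (x2 :- x3) (a ∷ b ∷ v₀ ∷ v₁ ∷ []) refl) (Cone.add C a≼b (LC q))))
      ...     | a' , ma' , c , ¬p' = a' , ma' , resp L'
                (solve ((x4 :- x1) :- (((x0 :+ x2) :- (x1 :+ x3)) :+ (x3 :- x2))) (x4 :- x0) (a ∷ b ∷ v₀ ∷ v₁ ∷ a' ∷ []) refl)
                (sub L' c (add L' (⊆-adjoin L _ q) (∈-adjoin L _))) , ¬p'
    move : ∀ {y} → X y → ∃ λ y' → Q y' × In L' (y' ⊖ y)
    move {y} xy with ∈mod? L y A₁
    ... | no ¬p = y , (xy , ¬p) , resp L' (solve :0 (x0 :- x0) (y ∷ []) refl) (zero∈ L')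
    ... | yes p with find p
    ...   | z , mz , q with ∈-map⁻ (_⊕ v₁) mz
    ...     | a , ma , refl with low ma
    ...       | a' , ma' , c , ¬p' = a' ⊕ v₀ , (X₀ ma' , ¬p') , resp L'
                (solve ((x1 :- x0) :- ((x4 :- (x0 :+ x3)) :+ (x3 :- x2))) ((x1 :+ x2) :- x4) (a ∷ a' ∷ v₀ ∷ v₁ ∷ y ∷ []) refl)
                (sub L' c (add L' (⊆-adjoin L _ q) (∈-adjoin L _)))
  ... | ys' , len , d , qs = map (_⊕ v₁) A ++ ys' ,
    trans (length-++ (map (_⊕ v₁) A)) (cong₂ _+_ (length-map (_⊕ v₁) A) len) ,
    Pairsₚ.++⁺ (distinct-shift L v₁ dA) (allPairs-map∈ (λ _ _ ¬p p → ¬p (⊆-adjoin L _ p)) d)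
      (All.tabulate λ {z} mz → All.map (λ { {y} (_ , ¬p) q → ¬p (lose mz (resp L
        (solve (:0 :- (x0 :- x1)) (x1 :- x0) (z ∷ y ∷ []) refl) (opp L q))) }) qs) ,
    Allₚ.++⁺ (Allₚ.map⁺ (All.tabulate X₁)) (All.map proj₁ qs)

  -- Expansion by few translates, up to multiples of hyperplane sections.

  Sums : List Carrier → List Carrier → Carrier → Set
  Sums A ws x = ∃ λ a → ∃ λ w → a ∈ A × w ∈ ws × x ≈ a ⊕ w

  sums-mono : ∀ {A A' ws ws' x} → (∀ {a} → a ∈ A → a ∈ A') → (∀ {w} → w ∈ ws → w ∈ ws') → Sums A ws x → Sums A' ws' x
  sums-mono f g (a , w , ma , mw , e) = a , w , f ma , g mw , e

  -- `points` certifies a lower bound for the size of the sumset in the quotient by `L`.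
  record Expansion (L : Subgroup) (A : List Carrier) (c : ℕ) : Set where
    field
      translates : List Carrier
      translates∈ : All (_∈ A) translates
      few : length translates ≤ c
      points : List Carrier
      distinct : DistinctMod L points
      points∈ : All (Sums A translates) points

    size : ℕ
    size = length points

  open Expansion

  trivial : ∀ {L A c} → Expansion L A c
  trivial = record { translates = [] ; translates∈ = [] ; few = z≤n ; points = [] ; distinct = [] ; points∈ = [] }

  -- For the preorder of a linear functional, these are the sections of `A` by parallel hyperplanes.
  Thin : Cone → ℕ → List Carrier → Set
  Thin C m A = ∀ x → length (filter (λ a → Cone.ker? C (a ⊖ x)) A) ≤ m

  thin-filter : ∀ C m A {P : Carrier → Set} (P? : ∀ x → Dec (P x)) → Thin C m A → Thin C m (filter P? A)
  thin-filter C m A P? t x = ℕₚ.≤-trans (length-filter-filter P? _ A) (t x)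

  -- "A has e independent directions, each with thin fibres", as a game: any fewer than e vectors are
  -- annihilated by such a direction.
  Directions : Subgroup → ℕ → List Carrier → ℕ → Set₁
  Directions L m A e = ∀ vs → length vs < e → Σ Cone λ C → (L ⊑ C) × All (Cone.Ker C) vs × Thin C m A

  directions-filter : ∀ {L m A e} {P : Carrier → Set} (P? : ∀ x → Dec (P x)) → Directions L m A e → Directions L m (filter P? A) e
  directions-filter {m = m} {A} P? D vs lt with D vs lt
  ... | C , LC , ks , t = C , LC , ks , thin-filter C m A P? t

  -- |A + ws| ≥ (P / Q)|A| - (K / Q) m
  Expands : (P Q K c e : ℕ) → Set₁
  Expands P Q K c e = ∀ m L A → DistinctMod L A → Directions L m A e →
    Σ (Expansion L A c) λ E → length A * P ≤ size E * Q + m * K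

  -- `B` omits the level of the greatest element `v₁`: what remains lies in a half-open strip, where
  -- reduction modulo `v₁ ⊖ v₀` is injective.
  record Peeling (L : Subgroup) (m : ℕ) (A : List Carrier) (C : Cone) : Set where
    field
      v₀ v₁ : Carrier
      v₀∈ : v₀ ∈ A
      v₁∈ : v₁ ∈ A
      v₀≺v₁ : Cone._≺_ C v₀ v₁
    B? : ∀ a → Dec (Cone._≺_ C a v₁)
    B? a = ¬? (Cone.dec C (a ⊖ v₁))
    B : List Carrier
    B = filter B? A
    field
      B-distinct : DistinctMod (adjoin L (v₁ ⊖ v₀)) B
      B-large : length A ≤ length B + m

  peel : ∀ L m A C → L ⊑ C → DistinctMod L A → Thin C m A → length A ≤ m ⊎ Peeling L m A C
  peel L m [] C LC dA thin = inj₁ z≤n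
  peel L m A@(a₀ ∷ A') C LC dA thin with Cone.least C a₀ A' | greatest C a₀ A'
  ... | v₀ , m₀ , min | v₁ , m₁ , max with Cone.dec C (v₀ ⊖ v₁)
  -- The least and the greatest element are on one level, so all of `A` is a single fibre of `C`.
  ...   | yes v₁≼v₀ = inj₁ (ℕₚ.≤-trans (length-filter-all (λ a → Cone.ker? C (a ⊖ v₁)) A λ {a} ma → Cone.≼-trans C v₁≼v₀ (min ma) ,
      Cone.resp C (solve (x1 :- x0) (:0 :- (x0 :- x1)) (a ∷ v₁ ∷ []) refl) (max ma)) (thin v₁))
  ...   | no v₀≺v₁ = inj₂ (record { v₀ = v₀ ; v₁ = v₁ ; v₀∈ = m₀ ; v₁∈ = m₁ ; v₀≺v₁ = v₀≺v₁
    ; B-distinct = allPairs-map∈ (λ mx my ¬p p → ¬p (adjoin-strip L C LC (min m₁)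
        (min (proj₁ (∈-filter⁻ B? {xs = A} mx))) (proj₂ (∈-filter⁻ B? {xs = A} mx))
        (min (proj₁ (∈-filter⁻ B? {xs = A} my))) (proj₂ (∈-filter⁻ B? {xs = A} my)) p)) (Pairsₚ.filter⁺ B? dA)
    ; B-large = ℕₚ.≤-trans (ℕₚ.≤-reflexive (length-filter-∁ B? A)) (ℕₚ.+-monoʳ-≤ (length (filter B? A))
        (ℕₚ.≤-trans (length-filter-mono (λ a → ¬? (B? a)) (λ a → Cone.ker? C (a ⊖ v₁)) A
          (λ {a} ma ¬¬p → decidable-stable (Cone.dec C (a ⊖ v₁)) ¬¬p ,
            Cone.resp C (solve (x1 :- x0) (:0 :- (x0 :- x1)) (a ∷ v₁ ∷ []) refl) (max ma))) (thin v₁))) })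
    where
    B? : ∀ a → Dec (Cone._≺_ C a v₁)
    B? a = ¬? (Cone.dec C (a ⊖ v₁))

  private
    trivial-bound : ∀ {a m} p k → a ≤ m → a * p ≤ m * (k + p)
    trivial-bound {m = m} p k le = ℕₚ.≤-trans (ℕₚ.*-monoˡ-≤ p le) (ℕₚ.*-monoʳ-≤ m (ℕₚ.m≤n+m p k))

  -- The quotient by `v₁ ⊖ v₀` contributes `P` and the additional |A| from `excess` contributes `Q`.
  -- `Directions` is played with `v₁ ⊖ v₀` as first vector, so that the later cones descend to the
  -- quotient. The error `P + Q` covers both the level missing from `B` and the case |A| ≤ m.
  expands-suc : ∀ {P Q K c e} → Expands P Q K c e → Expands (P + Q) Q (K + (P + Q)) (2 + c) (suc e)
  expands-suc {P} {Q} {K} {c} {e} ih m L A dA dirs with dirs [] (s≤s z≤n)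
  ... | C , LC , _ , thin with peel L m A C LC dA thin
  ...   | inj₁ small = trivial , trivial-bound (P + Q) K small
  ...   | inj₂ pl with ih m (adjoin L (v₁ ⊖ v₀)) B B-distinct (λ vs lt → next vs (dirs (v₁ ⊖ v₀ ∷ vs) (s≤s lt)))
    where
    open Peeling pl
    next : ∀ vs → (Σ Cone λ C → (L ⊑ C) × All (Cone.Ker C) (v₁ ⊖ v₀ ∷ vs) × Thin C m A) →
      Σ Cone λ C → (adjoin L (v₁ ⊖ v₀) ⊑ C) × All (Cone.Ker C) vs × Thin C m B
    next vs (C' , LC' , k ∷ ks , t) = C' , adjoin-⊑ L _ C' LC' k , ks , thin-filter C' m A B? t
  ...     | E , bound = record
      { translates = v₀ ∷ v₁ ∷ translates E
      ; translates∈ = v₀∈ ∷ v₁∈ ∷ All.map (proj₁ ∘ ∈-filter⁻ B?) (translates∈ E)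
      ; few = s≤s (s≤s (few E))
      ; points = proj₁ ex
      ; distinct = proj₁ (proj₂ (proj₂ ex))
      ; points∈ = proj₂ (proj₂ (proj₂ ex)) } , final
    where
    open Peeling pl
    ex = excess L C LC v₀ v₁ v₀≺v₁ A dA (Sums A (v₀ ∷ v₁ ∷ translates E))
      (λ {a} ma → a , v₀ , ma , here refl , ≈-refl) (λ {a} ma → a , v₁ , ma , there (here refl) , ≈-refl)
      (points E) (distinct E) (All.map (sums-mono (proj₁ ∘ ∈-filter⁻ B?) (there ∘ there)) (points∈ E))
    a b s : ℕ
    a = length A
    b = length B
    s = size E
    open ℕₚ.≤-Reasoning
    final : a * (P + Q) ≤ length (proj₁ ex) * Q + m * (K + (P + Q))
    final = begin
      a * (P + Q)                                 ≡⟨ ℕₚ.*-distribˡ-+ a P Q ⟩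
      a * P + a * Q                               ≤⟨ ℕₚ.+-monoˡ-≤ (a * Q) (ℕₚ.*-monoˡ-≤ P B-large) ⟩
      (b + m) * P + a * Q                         ≡⟨ cong (_+ a * Q) (ℕₚ.*-distribʳ-+ P b m) ⟩
      b * P + m * P + a * Q                       ≤⟨ linear (b * P ∷ m * P ∷ a * Q ∷ s * Q ∷ m * K ∷ m * Q ∷ [])
                                                       ((1 , u0 :≤ u3 :+ u4) ∷ []) 0
                                                       (u0 :+ u1 :+ u2 :≤ (u2 :+ u3) :+ (u4 :+ (u1 :+ u5))) (bound ∷ []) ⟩
      (a * Q + s * Q) + (m * K + (m * P + m * Q)) ≡⟨ cong₂ _+_ (ℕₚ.*-distribʳ-+ Q a s)
                                                       (trans (ℕₚ.*-distribˡ-+ m K (P + Q)) (cong (m * K +_) (ℕₚ.*-distribˡ-+ m P Q))) ⟨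
      (a + s) * Q + m * (K + (P + Q))             ≡⟨ cong (λ t → t * Q + m * (K + (P + Q))) (proj₁ (proj₂ ex)) ⟨
      length (proj₁ ex) * Q + m * (K + (P + Q))   ∎

  expands-0 : Expands 1 1 0 1 0
  expands-0 m L [] dA _ = trivial , z≤n
  expands-0 m L A@(a₀ ∷ _) dA _ = record
    { translates = a₀ ∷ [] ; translates∈ = here refl ∷ [] ; few = s≤s z≤n
    ; points = map (_⊕ a₀) A ; distinct = distinct-shift L a₀ dA
    ; points∈ = Allₚ.map⁺ (All.tabulate λ {a} ma → a , a₀ , ma , here refl , ≈-refl) } ,
    ℕₚ.≤-trans (ℕₚ.≤-reflexive (cong (_* 1) (sym (length-map (_⊕ a₀) A)))) (ℕₚ.m≤m+n _ _)

-- A better constant in dimension two, and hence in all higher dimensions.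

-- In dimension 2 + j the ratio is (3 + j) + 1/100. The initial error 30100 = 301 · 100 makes the
-- bound trivial for |A| ≤ 100 m, and the initial 9 counts two pairs of extreme elements and the
-- five translates of `expands₂`. The recursion is that of `expands-suc`.
slackP slackK slackC : ℕ → ℕ
slackP zero = 301
slackP (suc j) = slackP j + 100
slackK zero = 30100
slackK (suc j) = slackK j + (slackP j + 100)
slackC zero = 9
slackC (suc j) = 2 + slackC j

slackP≡ : ∀ j → slackP j ≡ suc ((3 + j) * 100)
slackP≡ zero = refl
slackP≡ (suc j) = trans (cong (_+ 100) (slackP≡ j)) (cong suc (ℕₚ.+-comm ((3 + j) * 100) 100))

module Planar (G : AbelianGroup 0ℓ 0ℓ) (¬-dec : (P : Set) → Dec (¬ P)) where
  open Core G ¬-dec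
  open Linear using (linear; Lin; con; _:+_; _:*_; _:≤_; u0; u1; u2; u3; u4; u5; u6; u7; u8)
  open Subgroup
  open Cone using (Pos)
  open Expansion

  module Heights (L : Subgroup) (C : Cone) (LC : L ⊑ C) (m : ℕ) (B : List Carrier) (dB : DistinctMod L B) (thin : Thin C m B)
    (b t : Carrier) (min : ∀ {a} → a ∈ B → Cone._≼_ C b a) (max : ∀ {a} → a ∈ B → Cone._≼_ C a t) where
    open Cone C using (_≼_; _≺_) renaming (dec to pos?)

    above? : ∀ a → Dec (b ≺ a)
    above? a = ¬? (pos? (b ⊖ a))

    B° : List Carrier
    B° = filter above? B

    B°-large : length B ≤ length B° + m
    B°-large = ℕₚ.≤-trans (ℕₚ.≤-reflexive (length-filter-∁ above? B)) (ℕₚ.+-monoʳ-≤ (length B°)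
      (ℕₚ.≤-trans (length-filter-mono (λ a → ¬? (above? a)) (λ a → Cone.ker? C (a ⊖ b)) B
        (λ {a} ma ¬¬p → min ma , Cone.resp C (solve (x1 :- x0) (:0 :- (x0 :- x1)) (a ∷ b ∷ []) refl)
          (decidable-stable (pos? (b ⊖ a)) ¬¬p))) (thin b)))

    two-translates : List Carrier → List Carrier
    two-translates S = map (_⊕ b) B ++ map (_⊕ t) S

    -- Heights separate the two parts: `a ⊕ b` is at most `t ⊕ b`, which `a' ⊕ t` exceeds as soon as
    -- `b ≺ a'`.
    two-translates-distinct : ∀ S → DistinctMod L S → All (b ≺_) S → DistinctMod L (two-translates S)
    two-translates-distinct S dS high = Pairsₚ.++⁺ (distinct-shift L b dB) (distinct-shift L t dS)
      (Allₚ.map⁺ (All.tabulate λ {a} ma → Allₚ.map⁺ (All.map (λ {a'} b≺a' p → b≺a' (Cone.resp C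
        (solve (((x0 :+ x1) :- (x2 :+ x3)) :+ (x3 :- x0)) (x1 :- x2) (a ∷ b ∷ a' ∷ t ∷ []) refl)
        (Cone.add C (LC p) (max ma)))) high)))

    base : List Carrier
    base = two-translates B°

    base-distinct : DistinctMod L base
    base-distinct = two-translates-distinct B° (Pairsₚ.filter⁺ above? dB) (All.tabulate (proj₂ ∘ ∈-filter⁻ above? {xs = B}))

    length-two-translates : ∀ S → length (two-translates S) ≡ length B + length S
    length-two-translates S = trans (length-++ (map (_⊕ b) B)) (cong₂ _+_ (length-map _ B) (length-map _ S))

    new? : ∀ w a → Dec (¬ Any (λ z → In L ((a ⊕ w) ⊖ z)) base)
    new? w a = ¬? (∈mod? L (a ⊕ w) base)

    new : Carrier → List Carrier
    new w = filter (new? w) B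

    #≼ #≺ : Carrier → ℕ
    #≼ w = length (filter (λ a → pos? (w ⊖ a)) B)
    #≺ w = length (filter (λ a → ¬? (pos? (a ⊖ w))) B)

    -- `w` is the least element with a fifth of `B` at or below it. The greatest element strictly
    -- below `w` fails this condition, which bounds `#≺ w`. A fifth is chosen because `v₀-low`
    -- requires a proportion less than a quarter.
    quantile : t ∈ B → ∃ λ w → w ∈ B × (length B ≤ #≼ w * 5) × (#≺ w * 5 ≤ length B)
    quantile t∈ with Cone.least∈ C (filter (λ w → length B ≤? #≼ w * 5) B) (∈-filter⁺ (λ w → length B ≤? #≼ w * 5) t∈
        (ℕₚ.≤-trans (length-filter-all (λ a → pos? (t ⊖ a)) B max) (ℕₚ.m≤m*n _ 5)))
    ... | w , m , first with ∈-filter⁻ (λ w → length B ≤? #≼ w * 5) {xs = B} m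
    ...   | w∈ , big = w , w∈ , big , small _ refl
      where
      small : ∀ ls → ls ≡ filter (λ a → ¬? (pos? (a ⊖ w))) B → length ls * 5 ≤ length B
      small [] _ = z≤n
      small (l ∷ ls) eq with greatest∈ C (l ∷ ls) (here refl)
      ... | g , g∈ , last with ∈-filter⁻ (λ a → ¬? (pos? (a ⊖ w))) {xs = B} (subst (g ∈_) eq g∈)
      ...   | g∈B , g≺w with length B ≤? #≼ g * 5
      ...     | yes le = ⊥-elim (g≺w (first (∈-filter⁺ (λ w → length B ≤? #≼ w * 5) g∈B le)))
      ...     | no nle = ℕₚ.≤-trans (ℕₚ.*-monoˡ-≤ 5 (ℕₚ.≤-trans (ℕₚ.≤-reflexive (cong length eq))
          (length-filter-mono _ (λ a → pos? (g ⊖ a)) B (λ ma a≺w → last (subst (_ ∈_) (sym eq) (∈-filter⁺ _ ma a≺w))))))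
          (ℕₚ.<⇒≤ (ℕₚ.≰⇒> nle))

    #≼-#≺ : ∀ w → #≼ w ≤ #≺ w + m
    #≼-#≺ w = ℕₚ.≤-trans (length-filter-⊎ (λ a → pos? (w ⊖ a)) (λ a → ¬? (pos? (a ⊖ w))) (λ a → Cone.ker? C (a ⊖ w)) B
      (λ {a} _ a≼w → split a a≼w (pos? (a ⊖ w)))) (ℕₚ.+-monoʳ-≤ (#≺ w) (thin w))
      where
      split : ∀ a → a ≼ w → Dec (w ≼ a) → a ≺ w ⊎ Cone.Ker C (a ⊖ w)
      split a a≼w (no p) = inj₁ p
      split a a≼w (yes p) = inj₂ (p , Cone.resp C (solve (x1 :- x0) (:0 :- (x0 :- x1)) (a ∷ w ∷ []) refl) a≼w)

    module Shift (w : Carrier) where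

      Old : Carrier → Set
      Old a = Any (λ z → In L ((a ⊕ w) ⊖ z)) base

      locate : ∀ {a} → Old a → (∃ λ a' → a' ∈ B × In L ((a ⊕ w) ⊖ (a' ⊕ b))) ⊎
        (∃ λ a' → a' ∈ B × b ≺ a' × In L ((a ⊕ w) ⊖ (a' ⊕ t)))
      locate old with find old
      ... | z , mz , p with ∈-++⁻ (map (_⊕ b) B) mz
      ...   | inj₁ mz' with ∈-map⁻ (_⊕ b) mz'
      ...     | a' , ma' , refl = inj₁ (a' , ma' , p)
      locate old | z , mz , p | inj₂ mz' with ∈-map⁻ (_⊕ t) mz'
      ...     | a' , ma' , refl = inj₂ (a' , proj₁ (∈-filter⁻ above? {xs = B} ma') , proj₂ (∈-filter⁻ above? {xs = B} ma') , p)

      -- `a'` determines `a` modulo `L`. Hence the elements with `P` inject into those with `Q`,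
      -- apart from those whose translate by `w` is new.
      shift : ∀ s {P Q : Carrier → Set} (P? : ∀ a → Dec (P a)) (Q? : ∀ a → Dec (Q a)) →
        (∀ {a} → a ∈ B → P a → Old a → ∃ λ a' → a' ∈ B × Q a' × In L ((a ⊕ w) ⊖ (a' ⊕ s))) →
        length (filter P? B) ≤ length (new w) + length (filter Q? B)
      shift s {P} {Q} P? Q? h = ℕₚ.≤-trans (length-filter-⊎ P? (new? w) R? B (λ {a} _ p → split a p (∈mod? L (a ⊕ w) base)))
        (ℕₚ.+-monoʳ-≤ (length (new w)) (pigeonhole (λ a a' → In L ((a ⊕ w) ⊖ (a' ⊕ s))) (filter R? B) (filter Q? B)
          (allPairs-map∈ (λ {x} {y} _ _ ¬p z p q → ¬p (resp L
            (solve (((x0 :+ x1) :- (x2 :+ x3)) :- ((x4 :+ x1) :- (x2 :+ x3))) (x0 :- x4) (x ∷ w ∷ z ∷ s ∷ y ∷ []) refl) (sub L p q)))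
            (Pairsₚ.filter⁺ R? dB))
          (All.tabulate (λ ma → image (∈-filter⁻ R? {xs = B} ma)))))
        where
        R? : ∀ a → Dec (P a × Old a)
        R? a = P? a ×-dec ∈mod? L (a ⊕ w) base
        split : ∀ a → P a → Dec (Old a) → (¬ Old a) ⊎ (P a × Old a)
        split a p (yes o) = inj₂ (p , o)
        split a p (no ¬o) = inj₁ ¬o
        image : ∀ {a} → a ∈ B × (P a × Old a) → Any (λ a' → In L ((a ⊕ w) ⊖ (a' ⊕ s))) (filter Q? B)
        image (ma , p , o) with h ma p o
        ... | a' , ma' , q , i = lose (∈-filter⁺ Q? ma' q) i

      -- With heights normalised so that b has height 0 and t height 1, and g the height of w, these are the
      -- elements of height greater than 1 - g and than 1 - 2g.
      high? : ∀ a → Dec ((t ⊕ b) ≺ (a ⊕ w))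
      high? a = ¬? (pos? ((t ⊕ b) ⊖ (a ⊕ w)))
      high₂? : ∀ a → Dec ((t ⊕ b ⊕ b) ≺ (a ⊕ w ⊕ w))
      high₂? a = ¬? (pos? ((t ⊕ b ⊕ b) ⊖ (a ⊕ w ⊕ w)))

      #high #high₂ : ℕ
      #high = length (filter high? B)
      #high₂ = length (filter high₂? B)

      -- For `a` of height in (1 - 2g, 1 - g], the height of `a ⊕ w` is at most 1. Unless new, it is
      -- therefore some `a' ⊕ b`, and `a'` has height greater than 1 - g.
      high₂≤ : #high₂ ≤ #high + (length (new w) + #high)
      high₂≤ = ℕₚ.≤-trans (length-filter-⊎ high₂? high? P? B (λ {a} _ h₂ → split a h₂ (high? a)))
        (ℕₚ.+-monoʳ-≤ #high (shift b P? high? image))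
        where
        P? : ∀ a → Dec (((t ⊕ b ⊕ b) ≺ (a ⊕ w ⊕ w)) × ¬ ((t ⊕ b) ≺ (a ⊕ w)))
        P? a = high₂? a ×-dec ¬? (high? a)
        split : ∀ a → (t ⊕ b ⊕ b) ≺ (a ⊕ w ⊕ w) → Dec ((t ⊕ b) ≺ (a ⊕ w)) →
          ((t ⊕ b) ≺ (a ⊕ w)) ⊎ (((t ⊕ b ⊕ b) ≺ (a ⊕ w ⊕ w)) × ¬ ((t ⊕ b) ≺ (a ⊕ w)))
        split a h₂ (yes h) = inj₁ h
        split a h₂ (no ¬h) = inj₂ (h₂ , ¬h)
        image : ∀ {a} → a ∈ B → ((t ⊕ b ⊕ b) ≺ (a ⊕ w ⊕ w)) × ¬ ((t ⊕ b) ≺ (a ⊕ w)) → Old a →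
          ∃ λ a' → a' ∈ B × ((t ⊕ b) ≺ (a' ⊕ w)) × In L ((a ⊕ w) ⊖ (a' ⊕ b))
        image {a} ma (h₂ , ¬h) old with locate old
        ... | inj₁ (a' , ma' , p) = a' , ma' , (λ q → h₂ (Cone.resp C
          (solve (((x0 :+ x1) :- (x2 :+ x3)) :+ (:0 :- ((x4 :+ x3) :- (x2 :+ x1)))) ((x0 :+ x1 :+ x1) :- (x4 :+ x3 :+ x3))
            (t ∷ b ∷ a' ∷ w ∷ a ∷ []) refl) (Cone.add C q (LC (opp L p))))) , p
        ... | inj₂ (a' , ma' , b≺a' , p) = ⊥-elim (¬h λ q → b≺a' (Cone.resp C
          (solve (((x0 :+ x1) :- (x4 :+ x3)) :+ ((x4 :+ x3) :- (x2 :+ x0))) (x1 :- x2)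
            (t ∷ b ∷ a' ∷ w ∷ a ∷ []) refl) (Cone.add C q (LC p))))

      -- Here `a ⊕ w` is higher than 1, so it can be old only as `a' ⊕ t`, and `a ≼ t` gives
      -- `a' ≼ w`.
      high≤ : #high ≤ length (new w) + #≼ w
      high≤ = shift t high? (λ a → pos? (w ⊖ a)) image
        where
        image : ∀ {a} → a ∈ B → (t ⊕ b) ≺ (a ⊕ w) → Old a → ∃ λ a' → a' ∈ B × a' ≼ w × In L ((a ⊕ w) ⊖ (a' ⊕ t))
        image {a} ma h old with locate old
        ... | inj₁ (a' , ma' , p) = ⊥-elim (h (Cone.resp C
          (solve ((x0 :- x2) :+ (:0 :- ((x4 :+ x3) :- (x2 :+ x1)))) ((x0 :+ x1) :- (x4 :+ x3)) (t ∷ b ∷ a' ∷ w ∷ a ∷ []) refl)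
          (Cone.add C (max ma') (LC (opp L p)))))
        ... | inj₂ (a' , ma' , _ , p) = a' , ma' , Cone.resp C
          (solve ((x0 :- x4) :+ ((x4 :+ x3) :- (x2 :+ x0))) (x3 :- x2) (t ∷ b ∷ a' ∷ w ∷ a ∷ []) refl)
          (Cone.add C (max ma) (LC p)) , p

      -- By complements: if `a` is not high and `a ⊕ w` is old, then `a ⊕ w` is some `a' ⊕ b`, and
      -- `b ≼ a` gives `w ≼ a'`.
      ≺≤high : #≺ w ≤ #high + length (new w)
      ≺≤high = linear (length B ∷ #≺ w ∷ #high ∷ length (new w) ∷ nh ∷ ge ∷ [])
        ((1 , u0 :≤ u2 :+ u4) ∷ (1 , u1 :+ u5 :≤ u0) ∷ (1 , u4 :≤ u3 :+ u5) ∷ []) 0 (u1 :≤ u2 :+ u3)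
        (ℕₚ.≤-reflexive (length-filter-∁ high? B)
          ∷ ℕₚ.≤-reflexive (sym (length-filter-∁ (λ a → ¬? (pos? (a ⊖ w))) B))
          ∷ shift b (λ a → ¬? (high? a)) (λ a → ¬? (¬? (pos? (a ⊖ w)))) image ∷ [])
        where
        nh ge : ℕ
        nh = length (filter (λ a → ¬? (high? a)) B)
        ge = length (filter (λ a → ¬? (¬? (pos? (a ⊖ w)))) B)
        image : ∀ {a} → a ∈ B → ¬ ((t ⊕ b) ≺ (a ⊕ w)) → Old a → ∃ λ a' → a' ∈ B × (¬ (a' ≺ w)) × In L ((a ⊕ w) ⊖ (a' ⊕ b))
        image {a} ma ¬h old with locate old
        ... | inj₁ (a' , ma' , p) = a' , ma' , (λ ¬q → ¬q (Cone.resp C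
          (solve ((x4 :- x1) :+ (:0 :- ((x4 :+ x3) :- (x2 :+ x1)))) (x2 :- x3) (t ∷ b ∷ a' ∷ w ∷ a ∷ []) refl)
          (Cone.add C (min ma) (LC (opp L p))))) , p
        ... | inj₂ (a' , ma' , b≺a' , p) = ⊥-elim (¬h λ q → b≺a' (Cone.resp C
          (solve (((x0 :+ x1) :- (x4 :+ x3)) :+ ((x4 :+ x3) :- (x2 :+ x0))) (x1 :- x2)
            (t ∷ b ∷ a' ∷ w ∷ a ∷ []) refl) (Cone.add C q (LC p))))

  expands₂ : Expands 3 1 5 5 2
  expands₂ = expands-suc (expands-suc expands-0)

  module _ (m : ℕ) (L : Subgroup) (A : List Carrier) (dA : DistinctMod L A) (dirs : Directions L m A 2)
    (large : m * 100 < length A) (C₁ : Cone) (LC₁ : L ⊑ C₁) (pl : Peeling L m A C₁) where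
    open Peeling pl

    private
      L' : Subgroup
      L' = adjoin L (v₁ ⊖ v₀)

      B⊆A : ∀ {a} → a ∈ B → a ∈ A
      B⊆A = proj₁ ∘ ∈-filter⁻ B? {xs = A}

      v₀∈B : v₀ ∈ B
      v₀∈B = ∈-filter⁺ B? v₀∈ v₀≺v₁

    -- The hypothesis `half` is what places `v₀` low enough in `without-new`; when it fails,
    -- `planar` turns to the opposite cone.
    module _ (C : Cone) (L'C : L' ⊑ C) (thin : Thin C m B)
      (half : length B ≤ length (filter (λ a → Cone.dec C (a ⊖ v₀)) B) * 2) where
      private
        open Cone C using (_≼_; _≺_; flip) renaming (dec to pos?)
        B-least = Cone.least∈ C B v₀∈B
        B-greatest = greatest∈ C B v₀∈B
        b t : Carrier
        b = proj₁ B-least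
        t = proj₁ B-greatest
        b∈ : b ∈ B
        b∈ = proj₁ (proj₂ B-least)
        t∈ : t ∈ B
        t∈ = proj₁ (proj₂ B-greatest)
        min : ∀ {a} → a ∈ B → b ≼ a
        min = proj₂ (proj₂ B-least)
        max : ∀ {a} → a ∈ B → a ≼ t
        max = proj₂ (proj₂ B-greatest)

        open Heights L' C L'C m B B-distinct thin b t min max

        LC : L ⊑ C
        LC p = L'C (⊆-adjoin L _ p)

        ws₀ : List Carrier
        ws₀ = v₀ ∷ v₁ ∷ b ∷ t ∷ []

        ws₀∈ : All (_∈ A) ws₀
        ws₀∈ = v₀∈ ∷ v₁∈ ∷ B⊆A b∈ ∷ B⊆A t∈ ∷ []

        two-translates∈ : ∀ {ws} (f : ∀ {w} → w ∈ ws₀ → w ∈ ws) S → (∀ {a} → a ∈ S → a ∈ B) → All (Sums A ws) (two-translates S)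
        two-translates∈ f S S⊆ = Allₚ.++⁺
          (Allₚ.map⁺ (All.tabulate λ {a} ma → a , b , B⊆A ma , f (there (there (here refl))) , ≈-refl))
          (Allₚ.map⁺ (All.tabulate λ {a} ma → a , t , B⊆A (S⊆ ma) , f (there (there (there (here refl)))) , ≈-refl))

      -- Modulo `v₁ ⊖ v₀`, `base` has almost 2|A| elements and the new ones are |A| / 100 more;
      -- `excess` adds |A|.
      with-new : ∀ w → w ∈ B → length A ≤ length (new w) * 100 →
        Σ (Expansion L A 9) λ E → length A * 301 ≤ size E * 100 + m * 30100
      with-new w w∈ gain = record
        { translates = w ∷ ws₀ ; translates∈ = B⊆A w∈ ∷ ws₀∈ ; few = s≤s (s≤s (s≤s (s≤s (s≤s z≤n))))
        ; points = proj₁ ex ; distinct = proj₁ (proj₂ (proj₂ ex)) ; points∈ = proj₂ (proj₂ (proj₂ ex)) } ,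
        linear (length A ∷ length B ∷ length B° ∷ length (new w) ∷ length (proj₁ ex) ∷ m ∷ [])
          ((100 , u0 :+ (u1 :+ u2 :+ u3) :≤ u4) ∷ (1 , u0 :≤ 100 :* u3) ∷ (100 , u1 :≤ u2 :+ u5) ∷ (200 , u0 :≤ u1 :+ u5) ∷ [])
          0 (301 :* u0 :≤ 100 :* u4 :+ 30100 :* u5)
          (ℕₚ.≤-reflexive (sym (trans (proj₁ (proj₂ ex)) (cong (length A +_) ys-length))) ∷ gain ∷ B°-large ∷ B-large ∷ [])
        where
        ys : List Carrier
        ys = base ++ map (_⊕ w) (new w)
        ys-length : length ys ≡ length B + length B° + length (new w)
        ys-length = trans (length-++ base) (cong₂ _+_ (length-two-translates B°) (length-map (_⊕ w) (new w)))
        ys-distinct : DistinctMod L' ys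
        ys-distinct = Pairsₚ.++⁺ base-distinct (distinct-shift L' w (Pairsₚ.filter⁺ (new? w) B-distinct))
          (All.tabulate λ {z} mz → Allₚ.map⁺ (All.tabulate λ {a} ma p → proj₂ (∈-filter⁻ (new? w) {xs = B} ma)
            (lose mz (resp L' (solve (:0 :- (x0 :- x1)) (x1 :- x0) (z ∷ a ⊕ w ∷ []) refl) (opp L' p)))))
        ex = excess L C₁ LC₁ v₀ v₁ v₀≺v₁ A dA (Sums A (w ∷ ws₀))
          (λ {a} ma → a , v₀ , ma , there (here refl) , ≈-refl) (λ {a} ma → a , v₁ , ma , there (there (here refl)) , ≈-refl)
          ys ys-distinct (Allₚ.++⁺ (two-translates∈ there B° (proj₁ ∘ ∈-filter⁻ above? {xs = B}))
            (Allₚ.map⁺ (All.tabulate λ {a} ma → a , w , B⊆A (proj₁ (∈-filter⁻ (new? w) {xs = B} ma)) , here refl , ≈-refl)))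

      -- Without new translates the heights are equidistributed, so that #high₂ ≈ 2 #high, whereas the sums of
      -- two high elements number about 3 #high; all of them lie above the sums with v₀, v₁ and b.
      without-new : (∀ {w} → w ∈ B → length (new w) * 100 ≤ length A) →
        Σ (Expansion L A 9) λ E → length A * 301 ≤ size E * 100 + m * 30100
      without-new old with quantile t∈
      ... | w , w∈ , q₁ , q₂ = record
          { translates = ws₀ ++ translates E
          ; translates∈ = Allₚ.++⁺ ws₀∈ (All.map (B⊆A ∘ H⊆B) (translates∈ E))
          ; few = s≤s (s≤s (s≤s (s≤s (few E))))
          ; points = proj₁ ex ++ points E
          ; distinct = Pairsₚ.++⁺ (proj₁ (proj₂ (proj₂ ex))) (distinct E)
              (All.map (λ { (_ , low) → All.map (separate low) (points∈ E) }) (proj₂ (proj₂ (proj₂ ex))))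
          ; points∈ = Allₚ.++⁺ (All.map proj₁ (proj₂ (proj₂ (proj₂ ex))))
              (All.map (sums-mono (B⊆A ∘ H⊆B) (∈-++⁺ʳ ws₀)) (points∈ E)) } ,
          ℕₚ.≤-trans final (ℕₚ.≤-reflexive (cong (λ k → k * 100 + m * 30100) (sym (length-++ (proj₁ ex)))))
        where
        open Shift w
        H : List Carrier
        H = filter high? B
        H⊆B : ∀ {a} → a ∈ H → a ∈ B
        H⊆B = proj₁ ∘ ∈-filter⁻ high? {xs = B}
        H-high : ∀ {a} → a ∈ H → (t ⊕ b) ≺ (a ⊕ w)
        H-high = proj₂ ∘ ∈-filter⁻ high? {xs = B}

        -- Otherwise `#high₂` counts all elements at or above `v₀`, at least half of `B`, whereas
        -- `high₂≤` and `high≤` bound it by 2|B| / 5 up to small terms.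
        v₀-low : ¬ ((t ⊕ b ⊕ b) ≺ (v₀ ⊕ w ⊕ w))
        v₀-low hi = ℕₚ.<⇒≱ (s≤s z≤n) (linear (length A ∷ m ∷ length B ∷ length (new w) ∷ #high ∷ #≺ w ∷ #≼ w ∷ #high₂ ∷ [])
          ((2000 , u0 :≤ u2 :+ u1) ∷ (10000 , u2 :≤ 2 :* u7) ∷ (20000 , u7 :≤ u4 :+ (u3 :+ u4)) ∷ (40000 , u4 :≤ u3 :+ u6) ∷ (40000 , u6 :≤ u5 :+ u1)
            ∷ (8000 , 5 :* u5 :≤ u2) ∷ (600 , 100 :* u3 :≤ u0) ∷ (1400 , con 1 :+ 100 :* u1 :≤ u0) ∷ []) 0 (con 1 :≤ con 0)
          (B-large ∷ ℕₚ.≤-trans half (ℕₚ.*-monoˡ-≤ 2 cnt) ∷ high₂≤ ∷ high≤ ∷ #≼-#≺ w ∷ q₂ ∷ old w∈ ∷ large ∷ []))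
          where
          cnt : length (filter (λ a → pos? (a ⊖ v₀)) B) ≤ #high₂
          cnt = length-filter-mono (λ a → pos? (a ⊖ v₀)) high₂? B (λ {a} _ v₀≼a p → hi (Cone.resp C
            (solve (((x0 :+ x1 :+ x1) :- (x2 :+ x3 :+ x3)) :+ (x2 :- x4)) ((x0 :+ x1 :+ x1) :- (x4 :+ x3 :+ x3))
              (t ∷ b ∷ a ∷ w ∷ v₀ ∷ []) refl) (Cone.add C p v₀≼a)))

        v₀-low' : (v₀ ⊕ w ⊕ w) ≼ (t ⊕ b ⊕ b)
        v₀-low' = decidable-stable (pos? _) v₀-low

        -- In normalised heights: at most 2 - 2g, which every sum of two elements of `H` exceeds.
        Low : Carrier → Set
        Low x = (x ⊕ w ⊕ w) ≼ (t ⊕ b ⊕ t ⊕ b)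

        low? : ∀ a → Dec (¬ ((t ⊕ b ⊕ b) ≺ (a ⊕ w ⊕ w)))
        low? a = ¬? (high₂? a)

        -- `a ⊕ t` is `Low` for `a` outside `high₂?`. Restricting `B°` to such elements costs at
        -- most `#high₂`.
        S : List Carrier
        S = filter low? B°

        S⊆B° : ∀ {a} → a ∈ S → a ∈ B°
        S⊆B° = proj₁ ∘ ∈-filter⁻ low? {xs = B°}

        S-large : length B° ≤ #high₂ + length S
        S-large = ℕₚ.≤-trans (ℕₚ.≤-reflexive (length-filter-∁ high₂? B°)) (ℕₚ.+-monoˡ-≤ (length S) (length-filter-filter above? high₂? B))

        v₁∼v₀ : Cone.Pos C (v₀ ⊖ v₁)
        v₁∼v₀ = Cone.resp C (solve (:0 :- (x0 :- x1)) (x1 :- x0) (v₁ ∷ v₀ ∷ []) refl) (L'C (opp L' (∈-adjoin L _)))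

        a+v₀-low : ∀ {a} → a ∈ B → Low (a ⊕ v₀)
        a+v₀-low {a} ma = Cone.resp C
          (solve (((x0 :+ x1 :+ x1) :- (x2 :+ x3 :+ x3)) :+ (x0 :- x4)) ((x0 :+ x1 :+ x0 :+ x1) :- (x4 :+ x2 :+ x3 :+ x3))
            (t ∷ b ∷ v₀ ∷ w ∷ a ∷ []) refl) (Cone.add C v₀-low' (max ma))

        a+v₁-low : ∀ {a} → a ∈ B → Low (a ⊕ v₁)
        a+v₁-low {a} ma = Cone.resp C
          (solve (((x0 :+ x1 :+ x0 :+ x1) :- (x4 :+ x2 :+ x3 :+ x3)) :+ (x2 :- x5)) ((x0 :+ x1 :+ x0 :+ x1) :- (x4 :+ x5 :+ x3 :+ x3))
            (t ∷ b ∷ v₀ ∷ w ∷ a ∷ v₁ ∷ []) refl) (Cone.add C (a+v₀-low ma) v₁∼v₀)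

        a+b-low : ∀ {a} → a ∈ B → Low (a ⊕ b)
        a+b-low {a} ma = Cone.resp C
          (solve (((x0 :+ x1 :+ x0 :+ x1) :- (x4 :+ x2 :+ x3 :+ x3)) :+ (x2 :- x1)) ((x0 :+ x1 :+ x0 :+ x1) :- (x4 :+ x1 :+ x3 :+ x3))
            (t ∷ b ∷ v₀ ∷ w ∷ a ∷ []) refl) (Cone.add C (a+v₀-low ma) (min v₀∈B))

        a+t-low : ∀ {a} → a ∈ S → Low (a ⊕ t)
        a+t-low {a} ma = Cone.resp C
          (solve ((x0 :+ x1 :+ x1) :- (x2 :+ x3 :+ x3)) ((x0 :+ x1 :+ x0 :+ x1) :- (x2 :+ x0 :+ x3 :+ x3))
            (t ∷ b ∷ a ∷ w ∷ []) refl) (decidable-stable (pos? _) (proj₂ (∈-filter⁻ low? {xs = B°} ma)))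

        E : Expansion L H 5
        E = proj₁ (expands₂ m L H (Pairsₚ.filter⁺ high? (Pairsₚ.filter⁺ B? dA)) (directions-filter {L} {m} {B} {2} high? (directions-filter {L} {m} {A} {2} B? dirs)))
        E-large : length H * 3 ≤ size E * 1 + m * 5
        E-large = proj₂ (expands₂ m L H (Pairsₚ.filter⁺ high? (Pairsₚ.filter⁺ B? dA)) (directions-filter {L} {m} {B} {2} high? (directions-filter {L} {m} {A} {2} B? dirs)))
        separate : ∀ {x z} → Low x → Sums H (translates E) z → ¬ In L (x ⊖ z)
        separate {x} {z} low (a , a' , ma , ma' , e) p = H-high (All.lookup (translates∈ E) ma') (Cone.resp C
          (solve ((((x0 :+ x1 :+ x0 :+ x1) :- (x2 :+ x3 :+ x3)) :+ (x2 :- (x4 :+ x5))) :+ ((x4 :+ x3) :- (x0 :+ x1)))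
            ((x0 :+ x1) :- (x5 :+ x3)) (t ∷ b ∷ x ∷ w ∷ a ∷ a' ∷ []) refl)
          (Cone.add C (Cone.add C low (Cone.resp C (⊕-cong ≈-refl (AbelianGroup.⁻¹-cong G e)) (LC p))) (flip (t ⊕ b) (a ⊕ w) (H-high ma))))

        ys : List Carrier
        ys = two-translates S

        -- `excess` is applied to `B` instead of `A`, because the bound `max` on heights, and with
        -- it `Low`, is known on `B`.
        ex = excess L C₁ LC₁ v₀ v₁ v₀≺v₁ B (Pairsₚ.filter⁺ B? dA) (λ x → Sums A (ws₀ ++ translates E) x × Low x)
          (λ {a} ma → (a , v₀ , B⊆A ma , here refl , ≈-refl) , a+v₀-low ma)
          (λ {a} ma → (a , v₁ , B⊆A ma , there (here refl) , ≈-refl) , a+v₁-low ma)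
          ys (two-translates-distinct S (Pairsₚ.filter⁺ low? (Pairsₚ.filter⁺ above? B-distinct))
            (All.tabulate (proj₂ ∘ ∈-filter⁻ above? {xs = B} ∘ S⊆B°)))
          (All.zip (two-translates∈ ∈-++⁺ˡ S (proj₁ ∘ ∈-filter⁻ above? {xs = B} ∘ S⊆B°) ,
            Allₚ.++⁺ (Allₚ.map⁺ (All.tabulate a+b-low)) (Allₚ.map⁺ (All.tabulate a+t-low))))

        -- Up to multiples of m and of the number of new elements, the count is 3|B| - `#high₂` + 3
        -- `#high`, hence at least 3|B| + `#high`, where `#high` is at least |B| / 5.
        final : length A * 301 ≤ (length (proj₁ ex) + size E) * 100 + m * 30100
        final = linear (length A ∷ m ∷ length B ∷ length (new w) ∷ #high ∷ #≺ w ∷ #≼ w ∷ #high₂ ∷ length S ∷ length (proj₁ ex) ∷ size E ∷ length B° ∷ [])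
          ((320 , u0 :≤ u2 :+ u1) ∷ (100 , u7 :≤ u4 :+ (u3 :+ u4)) ∷ (100 , u5 :≤ u4 :+ u3) ∷ (100 , u6 :≤ u5 :+ u1) ∷ (20 , u2 :≤ 5 :* u6)
            ∷ (2 , 100 :* u3 :≤ u0) ∷ (100 , u2 :+ (u2 :+ u8) :≤ u9) ∷ (100 , 3 :* u4 :≤ 1 :* u10 :+ 5 :* u1) ∷ (100 , u11 :≤ u7 :+ u8)
            ∷ (100 , u2 :≤ u11 :+ u1) ∷ []) 0
          (301 :* u0 :≤ 100 :* (u9 :+ u10) :+ 30100 :* u1)
          (B-large ∷ high₂≤ ∷ ≺≤high ∷ #≼-#≺ w ∷ q₁ ∷ old w∈
            ∷ ℕₚ.≤-reflexive (sym (trans (proj₁ (proj₂ ex)) (cong (length B +_) (length-two-translates S))))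
            ∷ E-large ∷ S-large ∷ B°-large ∷ [])
          where
          u9 u10 u11 : Lin 12
          u9 = Linear.var (# 9)
          u10 = Linear.var (# 10)
          u11 = Linear.var (# 11)

      planar-oriented : Σ (Expansion L A 9) λ E → length A * 301 ≤ size E * 100 + m * 30100
      planar-oriented with Any.any? (λ w → length A ≤? length (new w) * 100) B
      ... | yes p with find p
      ...   | w , w∈ , gain = with-new w w∈ gain
      planar-oriented | no ¬p = without-new λ w∈ → ℕₚ.<⇒≤ (ℕₚ.≰⇒> λ q → ¬p (lose w∈ q))

  planar : Expands 301 100 30100 9 2
  planar m L A dA dirs with length A ≤? m * 100
  ... | yes small = trivial , linear (length A ∷ m ∷ []) ((301 , u0 :≤ 100 :* u1) ∷ []) 0 (301 :* u0 :≤ 100 :* con 0 :+ 30100 :* u1) (small ∷ [])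
  ... | no large with dirs [] (s≤s z≤n)
  ...   | C₁ , LC₁ , _ , thin₁ with peel L m A C₁ LC₁ dA thin₁
  ...     | inj₁ small = trivial , linear (length A ∷ m ∷ []) ((301 , u0 :≤ u1) ∷ []) 0 (301 :* u0 :≤ 100 :* con 0 :+ 30100 :* u1) (small ∷ [])
  ...     | inj₂ pl with dirs (Peeling.v₁ pl ⊖ Peeling.v₀ pl ∷ []) (s≤s (s≤s z≤n))
  ...       | C , LC , k ∷ [] , thin = orient (length B ≤? length (filter (λ a → Cone.dec C (a ⊖ v₀)) B) * 2)
    where
    open Peeling pl
    L'C : adjoin L (v₁ ⊖ v₀) ⊑ C
    L'C = adjoin-⊑ L _ C LC k
    thinB : Thin C m B
    thinB = thin-filter C m A B? thin
    Goal : Set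
    Goal = Σ (Expansion L A 9) λ E → length A * 301 ≤ size E * 100 + m * 30100
    orient : Dec (length B ≤ length (filter (λ a → Cone.dec C (a ⊖ v₀)) B) * 2) → Goal
    orient (yes half) = planar-oriented m L A dA dirs (ℕₚ.≰⇒> large) C₁ LC₁ pl C L'C thinB half
    -- More than half of `B` is now below `v₀`. Reversing the order preserves the fibres, so
    -- thinness carries over.
    orient (no ¬half) = planar-oriented m L A dA dirs (ℕₚ.≰⇒> large) C₁ LC₁ pl (opposite C) (⊑-opposite {adjoin L (v₁ ⊖ v₀)} {C} L'C)
      (λ x → ℕₚ.≤-trans (length-filter-mono (λ a → Cone.ker? (opposite C) (a ⊖ x)) (λ a → Cone.ker? C (a ⊖ x)) B
        (λ { {a} _ (p , q) → Cone.resp C (solve (:0 :- (:0 :- (x0 :- x1))) (x0 :- x1) (a ∷ x ∷ []) refl) q , p })) (thinB x))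
      (linear (length B ∷ length (filter P? B) ∷ length (filter (λ a → ¬? (P? a)) B) ∷ length (filter Q? B) ∷ [])
        ((2 , u0 :≤ u1 :+ u2) ∷ (1 , con 1 :+ 2 :* u1 :≤ u0) ∷ (2 , u2 :≤ u3) ∷ []) 0 (u0 :≤ 2 :* u3)
        (ℕₚ.≤-reflexive (length-filter-∁ P? B) ∷ ℕₚ.≰⇒> ¬half ∷ length-filter-mono (λ a → ¬? (P? a)) Q? B
          (λ {a} _ ¬p → opposite⁺ C (Cone.flip C a v₀ ¬p)) ∷ []))
      where
      P? : ∀ a → Dec (Pos C (a ⊖ v₀))
      P? a = Cone.dec C (a ⊖ v₀)
      Q? : ∀ a → Dec (Pos (opposite C) (a ⊖ v₀))
      Q? a = Cone.dec (opposite C) (a ⊖ v₀)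

  slack : ∀ j → Expands (slackP j) 100 (slackK j) (slackC j) (2 + j)
  slack zero = planar
  slack (suc j) = expands-suc (slack j)

-- Sums over lists and double counting.

total : ∀ {A : Set} → (A → ℕ) → List A → ℕ
total f [] = 0
total f (x ∷ xs) = f x + total f xs

total-++ : ∀ {A : Set} (f : A → ℕ) xs ys → total f (xs ++ ys) ≡ total f xs + total f ys
total-++ f [] ys = refl
total-++ f (x ∷ xs) ys = trans (cong (f x +_) (total-++ f xs ys)) (sym (ℕₚ.+-assoc (f x) _ _))

total-map : ∀ {A B : Set} (f : B → ℕ) (g : A → B) xs → total f (map g xs) ≡ total (f ∘ g) xs
total-map f g [] = refl
total-map f g (x ∷ xs) = cong (f (g x) +_) (total-map f g xs)

total-≥ : ∀ {A : Set} (f : A → ℕ) k xs → (∀ {x} → x ∈ xs → k ≤ f x) → length xs * k ≤ total f xs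
total-≥ f k [] h = z≤n
total-≥ f k (x ∷ xs) h = ℕₚ.+-mono-≤ (h (here refl)) (total-≥ f k xs (h ∘ there))

total-≤ : ∀ {A : Set} (f : A → ℕ) k xs → (∀ {x} → x ∈ xs → f x ≤ k) → total f xs ≤ length xs * k
total-≤ f k [] h = z≤n
total-≤ f k (x ∷ xs) h = ℕₚ.+-mono-≤ (h (here refl)) (total-≤ f k xs (h ∘ there))

module _ {A B : Set} {F : A → B → Set} (F? : ∀ x y → Dec (F x y)) where

  private
    row : List B → A → ℕ
    row ys x = length (filter (F? x) ys)

    column : List A → B → ℕ
    column xs y = length (filter (λ x → F? x y) xs)

    column-0 : ∀ ys → total (column []) ys ≡ 0
    column-0 [] = refl
    column-0 (y ∷ ys) = column-0 ys

    swap : ∀ a b c {d} → a + c ≡ d → a + (b + c) ≡ b + d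
    swap a b c refl = trans (sym (ℕₚ.+-assoc a b c)) (trans (cong (_+ c) (ℕₚ.+-comm a b)) (ℕₚ.+-assoc b a c))

    column-suc : ∀ x xs ys → row ys x + total (column xs) ys ≡ total (column (x ∷ xs)) ys
    column-suc x xs [] = refl
    column-suc x xs (y ∷ ys) with F? x y
    ... | yes _ = cong suc (swap (row ys x) (column xs y) _ (column-suc x xs ys))
    ... | no _ = swap (row ys x) (column xs y) _ (column-suc x xs ys)

    rows≡columns : ∀ xs ys → total (row ys) xs ≡ total (column xs) ys
    rows≡columns [] ys = sym (column-0 ys)
    rows≡columns (x ∷ xs) ys = trans (cong (row ys x +_) (rows≡columns xs ys)) (column-suc x xs ys)

  total-columns : ∀ xs ys k → (∀ {x} → x ∈ xs → k ≤ length (filter (F? x) ys)) →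
    length xs * k ≤ total (λ y → length (filter (λ x → F? x y) xs)) ys
  total-columns xs ys k h = ℕₚ.≤-trans (total-≥ (row ys) k xs h) (ℕₚ.≤-reflexive (rows≡columns xs ys))

  double-counting : ∀ xs ys j k → (∀ {x} → x ∈ xs → k ≤ length (filter (F? x) ys)) →
    (∀ {y} → y ∈ ys → length (filter (λ x → F? x y) xs) ≤ j) → length xs * k ≤ length ys * j
  double-counting xs ys j k h h' = ℕₚ.≤-trans (total-columns xs ys k h) (total-≤ (column xs) j ys h')

-- Three translates that give |A| + |B| - 1 sums.

module Sumsets (G : AbelianGroup 0ℓ 0ℓ) (¬-dec : (P : Set) → Dec (¬ P)) where
  open Core G ¬-dec
  open Linear using (linear; con; _:+_; _:≤_; u0; u1; u2; u3; u4; u5; u6)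
  open Subgroup
  open Cone using (Pos)

  representatives : ∀ L A → ∃ λ ys → DistinctMod L ys × All (_∈ A) ys × (∀ {a} → a ∈ A → Any (λ y → In L (a ⊖ y)) ys)
  representatives L [] = [] , [] , [] , λ ()
  representatives L (a ∷ A) with representatives L A
  ... | ys , d , ys∈ , cover with ∈mod? L a ys
  ...   | yes p = ys , d , All.map there ys∈ , λ { (here refl) → p ; (there m) → cover m }
  ...   | no ¬p = a ∷ ys , Allₚ.¬Any⇒All¬ ys ¬p ∷ d , here refl ∷ All.map there ys∈ ,
    λ { (here refl) → here (resp L (solve :0 (x0 :- x0) (a ∷ []) refl) (zero∈ L)) ; (there m) → there (cover m) }

  -- Two of the translates are the extreme elements v₀ and v₁ of B; the third is found by averaging over B
  -- modulo v₁ - v₀.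
  module _ (L : Subgroup) (C : Cone) (LC : L ⊑ C) (CL : ∀ {x} → Cone.Ker C x → In L x) (A B : List Carrier)
    (dA : DistinctMod L A) (dB : DistinctMod L B) where

    private
      Goal : Set
      Goal = ∃ λ ws → All (_∈ B) ws × length ws ≤ 3 ×
        ∃ λ zs → DistinctMod L zs × All (Sums A ws) zs × length A + length B ≤ suc (length zs)

      -- Since the kernel of `C` is contained in `L`, a level of `B` is a single point. The loss of
      -- one level is therefore a loss of 1, the 1 in `suc (length zs)`.
      B-thin : Thin C 1 B
      B-thin x = pigeonhole (λ a y → Cone.Ker C (a ⊖ y)) (filter (λ a → Cone.ker? C (a ⊖ x)) B) (x ∷ [])
        (allPairs-map∈ (λ {a} {a'} _ _ ¬p y p q → ¬p (resp L
          (solve ((x0 :- x2) :- (x1 :- x2)) (x0 :- x1) (a ∷ a' ∷ y ∷ []) refl) (sub L (CL p) (CL q))))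
          (Pairsₚ.filter⁺ (λ a → Cone.ker? C (a ⊖ x)) dB))
        (All.tabulate λ m → here (proj₂ (∈-filter⁻ (λ a → Cone.ker? C (a ⊖ x)) {xs = B} m)))

      module Main (pl : Peeling L 1 B C) (B≤A : length B ≤ length A) where
        open Peeling pl renaming (B to B⁻)
        L' : Subgroup
        L' = adjoin L (v₁ ⊖ v₀)
        reps = representatives L' A
        Ys : List Carrier
        Ys = proj₁ reps
        covered : ∀ {a} → a ∈ A → Any (λ y → In L' (a ⊖ y)) Ys
        covered = proj₂ (proj₂ (proj₂ reps))
        -- The classes modulo `L'` met by A + v₀ are also those met by A + v₁, and `zs₀` is confined
        -- to them. A sum outside these classes is certainly not in `zs₀`.
        Stale : Carrier → Set
        Stale x = Any (λ y → In L' (x ⊖ (y ⊕ v₀))) Ys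
        stale? : ∀ x → Dec (Stale x)
        stale? x = Any.any? (λ y → dec L' (x ⊖ (y ⊕ v₀))) Ys
        stale₀ : ∀ {a} → a ∈ A → Stale (a ⊕ v₀)
        stale₀ {a} m = Any.map (λ {y} p → resp L' (solve (x0 :- x1) ((x0 :+ x2) :- (x1 :+ x2)) (a ∷ y ∷ v₀ ∷ []) refl) p) (covered m)
        stale₁ : ∀ {a} → a ∈ A → Stale (a ⊕ v₁)
        stale₁ {a} m = Any.map (λ {y} p → resp L' (solve ((x0 :- x1) :+ (x3 :- x2)) ((x0 :+ x3) :- (x1 :+ x2)) (a ∷ y ∷ v₀ ∷ v₁ ∷ []) refl)
          (add L' p (∈-adjoin L _))) (covered m)
        ex = excess L C LC v₀ v₁ v₀≺v₁ A dA (λ x → Sums A (v₀ ∷ v₁ ∷ []) x × Stale x)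
          (λ {a} m → (a , v₀ , m , here refl , ≈-refl) , stale₀ m)
          (λ {a} m → (a , v₁ , m , there (here refl) , ≈-refl) , stale₁ m)
          (map (_⊕ v₀) Ys) (distinct-shift L' v₀ (proj₁ (proj₂ reps)))
          (Allₚ.map⁺ (All.map (λ {y} m → (y , v₀ , m , here refl , ≈-refl) , stale₀ m) (proj₁ (proj₂ (proj₂ reps)))))
        zs₀ : List Carrier
        zs₀ = proj₁ ex
        zs₀-length : length A + length Ys ≡ length zs₀
        zs₀-length = sym (trans (proj₁ (proj₂ ex)) (cong (length A +_) (length-map (_⊕ v₀) Ys)))
        fresh? : ∀ w a → Dec (¬ Stale (a ⊕ w))
        fresh? w a = ¬? (stale? (a ⊕ w))
        fresh : Carrier → List Carrier
        fresh w = filter (fresh? w) A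

        enough : length B⁻ ≤ length Ys → Goal
        enough le = v₀ ∷ v₁ ∷ [] , v₀∈ ∷ v₁∈ ∷ [] , s≤s (s≤s z≤n) , zs₀ , proj₁ (proj₂ (proj₂ ex)) ,
          All.map proj₁ (proj₂ (proj₂ (proj₂ ex))) ,
          linear (length A ∷ length B ∷ length B⁻ ∷ length Ys ∷ length zs₀ ∷ [])
            ((1 , u1 :≤ u2 :+ con 1) ∷ (1 , u2 :≤ u3) ∷ (1 , u0 :+ u3 :≤ u4) ∷ []) 0 (u0 :+ u1 :≤ con 1 :+ u4)
            (B-large ∷ le ∷ ℕₚ.≤-reflexive zs₀-length ∷ [])

        use : ∀ w → w ∈ B⁻ → length B⁻ ≤ length Ys + length (fresh w) → Goal
        use w w∈ le = w ∷ v₀ ∷ v₁ ∷ [] , proj₁ (∈-filter⁻ B? {xs = B} w∈) ∷ v₀∈ ∷ v₁∈ ∷ [] , s≤s (s≤s (s≤s z≤n)) ,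
          zs₀ ++ map (_⊕ w) (fresh w) ,
          Pairsₚ.++⁺ (proj₁ (proj₂ (proj₂ ex))) (distinct-shift L w (Pairsₚ.filter⁺ (fresh? w) dA))
            (All.map (λ { {z} (_ , stale) → Allₚ.map⁺ (All.tabulate λ {a} ma p → proj₂ (∈-filter⁻ (fresh? w) {xs = A} ma)
              (Any.map (λ {y} q → resp L' (solve ((x0 :- x1) :- (x0 :- x2)) (x2 :- x1) (z ∷ y ⊕ v₀ ∷ a ⊕ w ∷ []) refl)
                (sub L' q (⊆-adjoin L _ p))) stale)) }) (proj₂ (proj₂ (proj₂ ex)))) ,
          Allₚ.++⁺ (All.map (sums-mono id there ∘ proj₁) (proj₂ (proj₂ (proj₂ ex))))
            (Allₚ.map⁺ (All.tabulate λ {a} ma → a , w , proj₁ (∈-filter⁻ (fresh? w) {xs = A} ma) , here refl , ≈-refl)) ,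
          linear (length A ∷ length B ∷ length B⁻ ∷ length Ys ∷ length zs₀ ∷ length (fresh w) ∷ length (zs₀ ++ map (_⊕ w) (fresh w)) ∷ [])
            ((1 , u1 :≤ u2 :+ con 1) ∷ (1 , u2 :≤ u3 :+ u5) ∷ (1 , u0 :+ u3 :≤ u4) ∷ (1 , u4 :+ u5 :≤ u6) ∷ []) 0 (u0 :+ u1 :≤ con 1 :+ u6)
            (B-large ∷ le ∷ ℕₚ.≤-reflexive zs₀-length
              ∷ ℕₚ.≤-reflexive (sym (trans (length-++ zs₀) (cong (length zs₀ +_) (length-map (_⊕ w) (fresh w))))) ∷ [])

        -- `B⁻` is distinct modulo `L'`, so for fixed `a` each of the |Ys| stale classes contains at
        -- most one `a ⊕ w`.
        many-fresh : ∀ {a} → a ∈ A → length B⁻ ≤ length Ys + length (filter (λ w → fresh? w a) B⁻)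
        many-fresh {a} ma = ℕₚ.≤-trans (ℕₚ.≤-reflexive (length-filter-∁ (λ w → stale? (a ⊕ w)) B⁻))
          (ℕₚ.+-monoˡ-≤ _ (pigeonhole (λ w y → In L' ((a ⊕ w) ⊖ (y ⊕ v₀))) (filter (λ w → stale? (a ⊕ w)) B⁻) Ys
            (allPairs-map∈ (λ {w} {w'} _ _ ¬p y p q → ¬p (resp L'
              (solve (((x0 :+ x1) :- x3) :- ((x0 :+ x2) :- x3)) (x1 :- x2) (a ∷ w ∷ w' ∷ y ⊕ v₀ ∷ []) refl) (sub L' p q)))
              (Pairsₚ.filter⁺ (λ w → stale? (a ⊕ w)) B-distinct))
            (All.tabulate λ m → proj₂ (∈-filter⁻ (λ w → stale? (a ⊕ w)) {xs = B⁻} m))))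

        -- Here `suc k` is |B⁻| - |Ys|. Every `a` has at least `suc k` fresh partners; if every `w`
        -- had at most `k`, double counting would give |A| (k + 1) ≤ |B⁻| k, against |B⁻| ≤ |A|.
        average : length Ys < length B⁻ → ¬ (∀ {w} → w ∈ B⁻ → ¬ (length B⁻ ≤ length Ys + length (fresh w)))
        average lt none with ℕₚ.m≤n⇒∃[o]m+o≡n lt
        ... | k , eq = ℕₚ.<⇒≱ less (ℕₚ.≤-trans (ℕₚ.*-monoˡ-≤ (suc k) B⁻≤A)
            (double-counting (λ a w → fresh? w a) A B⁻ k (suc k)
              (λ ma → ℕₚ.+-cancelˡ-≤ (length Ys) _ _ (ℕₚ.≤-trans (ℕₚ.≤-reflexive (sym eq')) (many-fresh ma)))
              (λ mw → ℕₚ.+-cancelˡ-≤ (suc (length Ys)) _ _ (ℕₚ.≤-trans (ℕₚ.≰⇒> (none mw)) (ℕₚ.≤-reflexive (sym eq))))))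
          where
          eq' : length B⁻ ≡ length Ys + suc k
          eq' = trans (sym eq) (sym (ℕₚ.+-suc (length Ys) k))
          B⁻≤A : length B⁻ ≤ length A
          B⁻≤A = ℕₚ.≤-trans (ℕₚ.≤-trans (ℕₚ.m≤m+n _ _) (ℕₚ.≤-reflexive (sym (length-filter-∁ B? B)))) B≤A
          less : length B⁻ * k < length B⁻ * suc k
          less = subst (length B⁻ * k <_) (sym (ℕₚ.*-suc (length B⁻) k))
            (ℕₚ.m<n+m (length B⁻ * k) (ℕₚ.≤-trans (s≤s z≤n) lt))

        main : Goal
        main with length B⁻ ≤? length Ys
        ... | yes le = enough le
        ... | no ¬le with Any.any? (λ w → length B⁻ ≤? length Ys + length (fresh w)) B⁻
        ...   | yes p = let w , w∈ , le = find p in use w w∈ le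
        ...   | no ¬p = ⊥-elim (average (ℕₚ.≰⇒> ¬le) λ w∈ le → ¬p (lose w∈ le))

    three-translates : ∀ {b} → b ∈ B → length B ≤ length A → Goal
    three-translates {b} b∈ B≤A with peel L 1 B C LC dB B-thin
    ... | inj₂ pl = Main.main pl B≤A
    ... | inj₁ small = b ∷ [] , b∈ ∷ [] , s≤s z≤n , map (_⊕ b) A , distinct-shift L b dA ,
      Allₚ.map⁺ (All.tabulate λ {a} ma → a , b , ma , here refl , ≈-refl) ,
      linear (length A ∷ length B ∷ length (map (_⊕ b) A) ∷ []) ((1 , u1 :≤ con 1) ∷ (1 , u0 :≤ u2) ∷ []) 0 (u0 :+ u1 :≤ con 1 :+ u2)
        (small ∷ ℕₚ.≤-reflexive (sym (length-map (_⊕ b) A)) ∷ [])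

-- Freiman's lemma with weights.

data Tag (I : Set) : Set where
  diag : I → Tag I
  off  : I → I → Tag I

data On {I : Set} (B : List I) : Tag I → Set where
  diag : ∀ {i} → i ∈ B → On B (diag i)
  off  : ∀ {i j} → i ∈ B → j ∈ B → On B (off i j)

on-⊆ : ∀ {I : Set} {B B' : List I} {z} → (∀ {i} → i ∈ B → i ∈ B') → On B z → On B' z
on-⊆ f (diag m) = diag (f m)
on-⊆ f (off m m') = off (f m) (f m')

total-↭ : ∀ {I : Set} (f : I → ℕ) {xs ys} → xs ↭ ys → total f xs ≡ total f ys
total-↭ f ↭.refl = refl
total-↭ f (↭.prep x p) = cong (f x +_) (total-↭ f p)
total-↭ f (↭.swap {xs} {ys} x y p) = trans (sym (ℕₚ.+-assoc (f x) (f y) (total f xs)))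
  (trans (cong₂ _+_ (ℕₚ.+-comm (f x) (f y)) (total-↭ f p)) (ℕₚ.+-assoc (f y) (f x) (total f ys)))
total-↭ f (↭.trans p q) = trans (total-↭ f p) (total-↭ f q)

triangular : ℕ → ℕ
triangular zero = 0
triangular (suc k) = suc k + triangular k

triangular-mono : ∀ {k l} → k ≤ l → triangular k ≤ triangular l
triangular-mono z≤n = z≤n
triangular-mono (s≤s le) = ℕₚ.+-mono-≤ (s≤s le) (triangular-mono le)

-- A weighted version of Freiman's lemma |B + B| ≥ (k + 1)|B| - k(k + 1)/2 for a k-dimensional set B: the point i
-- has weight 1 + κ i, the sum of two distinct points i and j has weight 1 + κ i + κ j, and the double of i has
-- weight ε i.
module Freiman (G : AbelianGroup 0ℓ 0ℓ) (¬-dec : (P : Set) → Dec (¬ P)) where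
  open Core G ¬-dec
  open Linear using (linear; con; _:+_; _:≤_; u0; u1; u2; u3; u4; u5; u6)
  open Subgroup
  open Cone using (Pos)

  module _ (L : Subgroup) (C : Cone) (LC : L ⊑ C) {I : Set} (pt : I → Carrier) where
    open Cone C using (_≼_; _≺_; flip; ≼-refl)

    OneCoset : Subgroup → List I → Set
    OneCoset K B = ∀ {i j} → i ∈ B → j ∈ B → In K (pt i ⊖ pt j)

    -- "B has dimension at least k", as a game: any fewer than k vectors lie in a subgroup of which B meets
    -- several cosets.
    Rank : ℕ → List I → Set₁
    Rank k B = ∀ vs → length vs < k → Σ Subgroup λ K → (∀ {x} → In L x → In K x) × All (In K) vs × ¬ OneCoset K B

    sum-point : Tag I → Carrier
    sum-point (diag i) = pt i ⊕ pt i
    sum-point (off i j) = pt i ⊕ pt j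

    Sorted : List I → Set
    Sorted = AllPairs (λ i j → pt i ≺ pt j)

    private
      insert : (∀ {x} → Cone.Ker C x → In L x) → ∀ i B → Sorted B → All (λ j → ¬ In L (pt i ⊖ pt j)) B → ∃ λ B' → Sorted B' × (i ∷ B) ↭ B'
      insert CL i [] _ _ = i ∷ [] , [] ∷ [] , ↭.refl
      insert CL i (j ∷ B) (j≺ ∷ sorted) (i≁j ∷ i≁) with Cone.dec C (pt i ⊖ pt j)
      ... | no i≺j = i ∷ j ∷ B , (i≺j ∷ All.map (λ {k} j≺k → Cone.≺-≼-trans C i≺j (flip (pt j) (pt k) j≺k)) j≺) ∷ j≺ ∷ sorted , ↭.refl
      ... | yes j≼i with insert CL i B sorted i≁
      ...   | B' , sorted' , perm = j ∷ B' , All-resp-↭ perm ((λ i≼j → i≁j (CL (j≼i , Cone.resp C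
                (solve (x0 :- x1) (:0 :- (x1 :- x0)) (pt j ∷ pt i ∷ []) refl) i≼j))) ∷ j≺) ∷ sorted' ,
              ↭.trans (↭.swap i j ↭.refl) (↭.prep j perm)

      sort : (∀ {x} → Cone.Ker C x → In L x) → ∀ B → AllPairs (λ i j → ¬ In L (pt i ⊖ pt j)) B → ∃ λ B' → Sorted B' × B ↭ B'
      sort CL [] [] = [] , [] , ↭.refl
      sort CL (i ∷ B) (i≁ ∷ d) with sort CL B d
      ... | B' , sorted , perm with insert CL i B' sorted (All-resp-↭ perm i≁)
      ...   | B'' , sorted' , perm' = B'' , sorted' , ↭.trans (↭.prep i perm) perm'

    module Weights (κ ε : I → ℕ) where

      weight : I → ℕ
      weight i = suc (κ i)

      value : Tag I → ℕ
      value (diag i) = ε i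
      value (off i j) = suc (κ i + κ j)

      SumFamily : List I → ℕ → Set
      SumFamily B t = ∃ λ zs → AllPairs (λ s t → ¬ In L (sum-point s ⊖ sum-point t)) zs × All (On B) zs × t ≤ total value zs

      private
        diag<on : ∀ {p B z} → All (λ q → pt p ≺ pt q) B → On B z → ¬ In L (sum-point (diag p) ⊖ sum-point z)
        diag<on {p} below (diag {i} m) e = All.lookup below m (Cone.resp C
          (solve (((x0 :+ x0) :- (x1 :+ x1)) :+ (x1 :- x0)) (x0 :- x1) (pt p ∷ pt i ∷ []) refl)
          (Cone.add C (LC e) (flip (pt p) (pt i) (All.lookup below m))))
        diag<on {p} below (off {i} {j} m m') e = All.lookup below m (Cone.resp C
          (solve (((x0 :+ x0) :- (x1 :+ x2)) :+ (x2 :- x0)) (x0 :- x1) (pt p ∷ pt i ∷ pt j ∷ []) refl)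
          (Cone.add C (LC e) (flip (pt p) (pt j) (All.lookup below m'))))

        -- The double of the least element `p` lies below all other sums, so only the sums of `p`
        -- with `S` have to be assumed apart from those of `B`.
        extend : ∀ {p B zs S} → All (λ q → pt p ≺ pt q) B → Sorted S → (∀ {q} → q ∈ S → q ∈ B) →
          (∀ {q z} → q ∈ S → On B z → ¬ In L ((pt p ⊕ pt q) ⊖ sum-point z)) →
          AllPairs (λ s t → ¬ In L (sum-point s ⊖ sum-point t)) zs → All (On B) zs →
          AllPairs (λ s t → ¬ In L (sum-point s ⊖ sum-point t)) (diag p ∷ map (off p) S ++ zs) ×
            All (On (p ∷ B)) (diag p ∷ map (off p) S ++ zs)
        extend {p} {B} {zs} {S} below sorted S⊆ apart d on =
          (Allₚ.++⁺ (Allₚ.map⁺ (All.tabulate λ {q} m e → All.lookup below (S⊆ m) (Cone.resp C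
              (solve ((x0 :+ x0) :- (x0 :+ x1)) (x0 :- x1) (pt p ∷ pt q ∷ []) refl) (LC e))))
            (All.map (diag<on below) on) ∷
           Pairsₚ.++⁺ (Pairsₚ.map⁺ (allPairs-map∈ (λ {i} {j} _ _ i≺j e → i≺j (Cone.resp C
              (solve ((x0 :+ x1) :- (x0 :+ x2)) (x1 :- x2) (pt p ∷ pt i ∷ pt j ∷ []) refl) (LC e))) sorted)) d
             (Allₚ.map⁺ (All.tabulate λ m → All.map (apart m) on))) ,
          diag (here refl) ∷ Allₚ.++⁺ (Allₚ.map⁺ (All.tabulate λ m → off (here refl) (there (S⊆ m)))) (All.map (on-⊆ there) on)

        total-extend : ∀ p S zs → total value (diag p ∷ map (off p) S ++ zs) ≡ ε p + (total (λ q → suc (κ p + κ q)) S + total value zs)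
        total-extend p S zs = cong (ε p +_) (trans (total-++ value (map (off p) S) zs) (cong (_+ _) (total-map value (off p) S)))

        total-off : ∀ p S → total (λ q → suc (κ p + κ q)) S ≡ total weight S + length S * κ p
        total-off p [] = refl
        total-off p (q ∷ S) = trans (cong (suc (κ p + κ q) +_) (total-off p S)) (cong suc (rearrange (κ p) (κ q) (total weight S) (length S * κ p)))
          where
          rearrange : ∀ a b c d → (a + b) + (c + d) ≡ (b + c) + (a + d)
          rearrange a b c d = ℕₚ.≤-antisym (linear (a ∷ b ∷ c ∷ d ∷ []) [] 0 ((u0 :+ u1) :+ (u2 :+ u3) :≤ (u1 :+ u2) :+ (u0 :+ u3)) [])
            (linear (a ∷ b ∷ c ∷ d ∷ []) [] 0 ((u1 :+ u2) :+ (u0 :+ u3) :≤ (u0 :+ u1) :+ (u2 :+ u3)) [])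

        total-suc : ∀ k B → total (λ i → ε i + weight i * suc k) B ≡ total weight B + total (λ i → ε i + weight i * k) B
        total-suc k [] = refl
        total-suc k (i ∷ B) = trans (cong₂ _+_ (cong (ε i +_) (ℕₚ.*-suc (weight i) k)) (total-suc k B))
          (rearrange (ε i) (weight i) (weight i * k) (total weight B) _)
          where
          rearrange : ∀ a b c d e → (a + (b + c)) + (d + e) ≡ (b + d) + ((a + c) + e)
          rearrange a b c d e = ℕₚ.≤-antisym
            (linear (a ∷ b ∷ c ∷ d ∷ e ∷ []) [] 0 ((u0 :+ (u1 :+ u2)) :+ (u3 :+ u4) :≤ (u1 :+ u3) :+ ((u0 :+ u2) :+ u4)) [])
            (linear (a ∷ b ∷ c ∷ d ∷ e ∷ []) [] 0 ((u1 :+ u3) :+ ((u0 :+ u2) :+ u4) :≤ (u0 :+ (u1 :+ u2)) :+ (u3 :+ u4)) [])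

        coset-cons : ∀ K {p B} → (∀ {q} → q ∈ B → In K (pt q ⊖ pt p)) → OneCoset K (p ∷ B)
        coset-cons K {p} {B} h {i} {j} mi mj = resp K (solve ((x0 :- x2) :- (x1 :- x2)) (x0 :- x1) (pt i ∷ pt j ∷ pt p ∷ []) refl)
          (sub K (h' mi) (h' mj))
          where
          h' : ∀ {q} → q ∈ (p ∷ B) → In K (pt q ⊖ pt p)
          h' (here refl) = resp K (solve :0 (x0 :- x0) (pt p ∷ []) refl) (zero∈ K)
          h' (there m) = h m

        rank-length : ∀ k {p B} → Rank k (p ∷ B) → k ≤ length B
        rank-length k {p} {B} rank = ℕₚ.≮⇒≥ λ lt → let K , LK , vs , ¬coset = rank (map (λ q → pt q ⊖ pt p) B) (subst (_< k) (sym (length-map _ B)) lt)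
          in ¬coset (coset-cons K (All.lookup (Allₚ.map⁻ vs)))

        Target : ℕ → List I → ℕ
        Target k B = total (λ i → ε i + weight i * k) B

      -- p is the least element of p ∷ B.  If B has full dimension, then the q with p + q ∉ B + B generate: any
      -- other q satisfies q - p = (b - p) + (c - p) with b, c ∈ B smaller than q.
      peel-full : ∀ k p B → Sorted (p ∷ B) → Rank k (p ∷ B) →
        ∀ {t} → SumFamily B t → SumFamily (p ∷ B) (ε p + (weight p * k + t))
      peel-full k p B (below ∷ sorted) rank {t} (zs , d , on , t≤) =
        diag p ∷ map (off p) S ++ zs , proj₁ ext , proj₂ ext , final
        where
        old? : ∀ q → Dec (Any (λ i → Any (λ j → In L ((pt p ⊕ pt q) ⊖ (pt i ⊕ pt j))) B) B)
        old? q = Any.any? (λ i → Any.any? (λ j → dec L ((pt p ⊕ pt q) ⊖ (pt i ⊕ pt j))) B) B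
        S : List I
        S = filter (¬? ∘ old?) B
        apart : ∀ {q z} → q ∈ S → On B z → ¬ In L ((pt p ⊕ pt q) ⊖ sum-point z)
        apart m (diag mi) e = proj₂ (∈-filter⁻ (¬? ∘ old?) {xs = B} m) (lose mi (lose mi e))
        apart m (off mi mj) e = proj₂ (∈-filter⁻ (¬? ∘ old?) {xs = B} m) (lose mi (lose mj e))
        ext = extend {zs = zs} below (Pairsₚ.filter⁺ (¬? ∘ old?) sorted) (proj₁ ∘ ∈-filter⁻ (¬? ∘ old?) {xs = B}) apart d on
        generates : ∀ K → (∀ {x} → In L x → In K x) → (∀ {q} → q ∈ S → In K (pt q ⊖ pt p)) → ∀ {q} → q ∈ B → In K (pt q ⊖ pt p)
        generates K LK S⊆K {q} mq = Cone.list-induction C (map pt B) (λ x → In K (x ⊖ pt p)) step (∈-map⁺ pt mq)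
          where
          step : ∀ {x} → x ∈ map pt B → (∀ {y} → y ∈ map pt B → y ≺ x → In K (y ⊖ pt p)) → In K (x ⊖ pt p)
          step mx ih with ∈-map⁻ pt mx
          ... | q , mq , refl with old? q
          ...   | no ¬o = S⊆K (∈-filter⁺ (¬? ∘ old?) mq ¬o)
          ...   | yes o with find o
          ...     | i , mi , o' with find o'
          ...       | j , mj , e = resp K
              (solve (((x0 :- x2) :+ (x1 :- x2)) :+ ((x2 :+ x3) :- (x0 :+ x1))) (x3 :- x2) (pt i ∷ pt j ∷ pt p ∷ pt q ∷ []) refl)
              (add K (add K (ih (∈-map⁺ pt mi) i≺q) (ih (∈-map⁺ pt mj) j≺q)) (LK e))
            where
            i≺q : pt i ≺ pt q
            i≺q h = All.lookup below mj (Cone.resp C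
              (solve ((x0 :- x3) :+ ((x2 :+ x3) :- (x0 :+ x1))) (x2 :- x1) (pt i ∷ pt j ∷ pt p ∷ pt q ∷ []) refl) (Cone.add C h (LC e)))
            j≺q : pt j ≺ pt q
            j≺q h = All.lookup below mi (Cone.resp C
              (solve ((x1 :- x3) :+ ((x2 :+ x3) :- (x0 :+ x1))) (x2 :- x0) (pt i ∷ pt j ∷ pt p ∷ pt q ∷ []) refl) (Cone.add C h (LC e)))
        S-large : k ≤ length S
        S-large = ℕₚ.≮⇒≥ λ lt → let K , LK , vs , ¬coset = rank (map (λ q → pt q ⊖ pt p) S) (subst (_< k) (sym (length-map _ S)) lt)
          in ¬coset (coset-cons K (generates K LK (All.lookup (Allₚ.map⁻ vs))))
        final : ε p + (weight p * k + t) ≤ total value (diag p ∷ map (off p) S ++ zs)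
        final = ℕₚ.≤-trans (ℕₚ.+-monoʳ-≤ (ε p) (ℕₚ.+-mono-≤
          (ℕₚ.≤-trans (ℕₚ.≤-reflexive (ℕₚ.*-comm (weight p) k)) (ℕₚ.≤-trans (ℕₚ.*-monoˡ-≤ (weight p) S-large)
            (total-≥ _ (weight p) S (λ {q} _ → s≤s (ℕₚ.m≤m+n (κ p) (κ q)))))) t≤))
          (ℕₚ.≤-reflexive (sym (total-extend p S zs)))

      -- As `B` lies in one coset of `K` and `p` does not, no sum of `p` with an element of `B` is a
      -- sum of two elements of `B`. All of them count: they contribute `total weight B`, and `κ p`
      -- as often as `B` has elements, at least `k` times.
      peel-flat : ∀ k p B → Sorted (p ∷ B) → k ≤ length B →
        ∀ K → (∀ {x} → In L x → In K x) → OneCoset K B → ¬ OneCoset K (p ∷ B) →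
        ∀ {t} → SumFamily B t → SumFamily (p ∷ B) (ε p + (κ p * k + (total weight B + t)))
      peel-flat k p B (below ∷ sorted) B-large K LK coset ¬coset {t} (zs , d , on , t≤) =
        diag p ∷ map (off p) B ++ zs , proj₁ ext , proj₂ ext , final
        where
        apart' : ∀ {q i j} → q ∈ B → i ∈ B → j ∈ B → ¬ In L ((pt p ⊕ pt q) ⊖ (pt i ⊕ pt j))
        apart' {q} {i} {j} m mi mj e = ¬coset (coset-cons K (λ {r} mr → resp K
          (solve (((x4 :- x2) :+ (x1 :- x3)) :- ((x0 :+ x1) :- (x2 :+ x3))) (x4 :- x0) (pt p ∷ pt q ∷ pt i ∷ pt j ∷ pt r ∷ []) refl)
          (sub K (add K (coset mr mi) (coset m mj)) (LK e))))
        apart : ∀ {q z} → q ∈ B → On B z → ¬ In L ((pt p ⊕ pt q) ⊖ sum-point z)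
        apart m (diag mi) e = apart' m mi mi e
        apart m (off mi mj) e = apart' m mi mj e
        ext = extend {zs = zs} below sorted id apart d on
        final : ε p + (κ p * k + (total weight B + t)) ≤ total value (diag p ∷ map (off p) B ++ zs)
        final = ℕₚ.≤-trans (ℕₚ.+-monoʳ-≤ (ε p) (ℕₚ.≤-trans
          (linear (κ p * k ∷ length B * κ p ∷ total weight B ∷ t ∷ total value zs ∷ [])
            ((1 , u0 :≤ u1) ∷ (1 , u3 :≤ u4) ∷ []) 0 (u0 :+ (u2 :+ u3) :≤ (u2 :+ u1) :+ u4)
            (ℕₚ.≤-trans (ℕₚ.≤-reflexive (ℕₚ.*-comm (κ p) k)) (ℕₚ.*-monoˡ-≤ (κ p) B-large) ∷ t≤ ∷ []))
          (ℕₚ.≤-reflexive (cong (_+ total value zs) (sym (total-off p B))))))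
          (ℕₚ.≤-reflexive (sym (total-extend p B zs)))

      -- If the rest `B` still has rank `k`, `peel-full` applies. If not, `peel-flat` applies and
      -- the rank drops by one, at a loss of `k`, the difference of consecutive triangular numbers.
      -- The rank is not decided, hence the double negation.
      freiman-sorted : ∀ k B → Sorted B → Rank k B →
        ¬ ¬ (∃ λ t → SumFamily B t × total (λ i → ε i + weight i * k) B ≤ t + triangular k)
      freiman-sorted k [] _ _ ¬goal = ¬goal (0 , ([] , [] , [] , z≤n) , z≤n)
      freiman-sorted k (p ∷ B) sorted@(_ ∷ sortedB) rank ¬goal = freiman-sorted k B sortedB full λ { (t , fam , le) →
        ¬goal (_ , peel-full k p B sorted rank fam , linear (ε p ∷ weight p * k ∷ t ∷ triangular k ∷ Target k B ∷ [])
          ((1 , u4 :≤ u2 :+ u3) ∷ []) 0 ((u0 :+ u1) :+ u4 :≤ (u0 :+ (u1 :+ u2)) :+ u3) (le ∷ [])) }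
        where
        flat : ∀ k → Rank k (p ∷ B) → (¬ (∃ λ t → SumFamily (p ∷ B) t × Target k (p ∷ B) ≤ t + triangular k)) → 0 < k →
          ∀ K → (∀ {x} → In L x → In K x) → OneCoset K B → ¬ OneCoset K (p ∷ B) → ⊥
        flat (suc k) rank ¬goal _ K LK coset ¬coset = freiman-sorted k B sortedB lower λ { (t , fam , le) →
          ¬goal (_ , peel-flat (suc k) p B sorted (rank-length (suc k) rank) K LK coset ¬coset fam ,
            ℕₚ.≤-trans (ℕₚ.≤-reflexive (cong ((ε p + weight p * suc k) +_) (total-suc k B)))
              (linear (ε p ∷ κ p * suc k ∷ t ∷ triangular k ∷ Target k B ∷ total weight B ∷ k ∷ [])
                ((1 , u4 :≤ u2 :+ u3) ∷ []) 0
                ((u0 :+ ((con 1 :+ u6) :+ u1)) :+ (u5 :+ u4) :≤ (u0 :+ (u1 :+ (u5 :+ u2))) :+ ((con 1 :+ u6) :+ u3)) (le ∷ []))) }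
          where
          member : ∀ {k B} → suc k ≤ length B → ∃ λ (b : I) → b ∈ B
          member {B = b ∷ _} _ = b , here refl
          lower : Rank k B
          -- With `pt p ⊖ pt b` as first vector of the game, a coset of `K'` that contained `B`
          -- would contain `p` too.
          lower vs lt with member {k} {B} (rank-length (suc k) rank)
          ... | b , b∈ with rank (pt p ⊖ pt b ∷ vs) (s≤s lt)
          ...   | K' , LK' , v ∷ vs' , ¬coset' = K' , LK' , vs' , λ cosetB → ¬coset' (coset-cons K' (λ {q} mq → resp K'
              (solve ((x0 :- x1) :- (x2 :- x1)) (x0 :- x2) (pt q ∷ pt b ∷ pt p ∷ []) refl) (sub K' (cosetB mq b∈) v)))
        full : Rank k B
        full vs lt with rank vs lt
        ... | K , LK , vs' , ¬coset = K , LK , vs' , λ coset → flat k rank ¬goal (ℕₚ.≤-trans (s≤s z≤n) lt) K LK coset ¬coset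

      freiman : (∀ {x} → Cone.Ker C x → In L x) → ∀ k B → AllPairs (λ i j → ¬ In L (pt i ⊖ pt j)) B → Rank k B →
        ¬ ¬ (∃ λ zs → AllPairs (λ s t → ¬ In L (sum-point s ⊖ sum-point t)) zs × All (On B) zs ×
          total (λ i → ε i + weight i * k) B ≤ total value zs + triangular k)
      freiman CL k B d rank ¬goal with sort CL B d
      ... | B' , sorted , perm = freiman-sorted k B' sorted
        (λ vs lt → let K , LK , vs' , ¬coset = rank vs lt in
          K , LK , vs' , λ coset → ¬coset (λ mi mj → coset (∈-resp-↭ perm mi) (∈-resp-↭ perm mj)))
        λ { (t , (zs , d' , on , t≤) , le) → ¬goal (zs , d' , All.map (on-⊆ (∈-resp-↭ (↭.↭-sym perm))) on ,
          ℕₚ.≤-trans (ℕₚ.≤-reflexive (total-↭ _ perm)) (ℕₚ.≤-trans le (ℕₚ.+-monoˡ-≤ (triangular k) t≤))) }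

-- The real numbers: consequences of completeness.

module Field (R : RealNumbers) where
  open RealNumbers R hiding (zero) renaming (Carrier to ℝ; _+_ to _+ʳ_; _*_ to _*ʳ_; _≤_ to _≤ʳ_; refl to ≈-refl; sym to ≈-sym; trans to ≈-trans) public
  open IsTotalOrder isTotalOrder using (antisym; ≤-respʳ-≈; ≤-respˡ-≈) renaming (total to ≤ʳ-total; refl to ≤ʳ-refl; trans to ≤ʳ-trans; reflexive to ≤ʳ-reflexive) public
  open GroupSolver +-abelianGroup public using (solve; _:+_; _:-_; :0; x0; x1; x2; x3) renaming (_⊖_ to _-ʳ_)
  open import Algebra.Properties.Ring ring using (-‿distribˡ-*; -‿distribʳ-*; -0#≈0#; -‿involutive)

  private
    ≤-cancel : ∀ x y z → (x +ʳ z) ≤ʳ (y +ʳ z) → x ≤ʳ y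
    ≤-cancel x y z h = ≤-respˡ-≈ (solve ((x0 :+ x1) :+ (:0 :- x1)) x0 (x ∷ z ∷ []) refl)
      (≤-respʳ-≈ (solve ((x0 :+ x1) :+ (:0 :- x1)) x0 (y ∷ z ∷ []) refl) (+-mono-≤ _ _ (0# -ʳ z) h))

    neg-nonneg : ∀ {x} → x ≤ʳ 0# → 0# ≤ʳ (- x)
    neg-nonneg {x} h = ≤-respˡ-≈ (-‿inverseʳ x) (≤-respʳ-≈ (+-identityˡ (- x)) (+-mono-≤ _ _ (- x) h))

    0≤1 : 0# ≤ʳ 1#
    0≤1 with ≤ʳ-total 0# 1#
    ... | inj₁ p = p
    ... | inj₂ p = ≤-respʳ-≈ (≈-trans (≈-sym (-‿distribˡ-* 1# (- 1#))) (≈-trans (-‿cong (*-identityˡ (- 1#))) (-‿involutive 1#)))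
      (*-nonneg (- 1#) (- 1#) (neg-nonneg p) (neg-nonneg p))

    1≰0 : ¬ (1# ≤ʳ 0#)
    1≰0 p = 0≉1 (antisym 0≤1 p)

  +-nonneg : ∀ {x y} → 0# ≤ʳ x → 0# ≤ʳ y → 0# ≤ʳ (x +ʳ y)
  +-nonneg {x} {y} p q = ≤ʳ-trans q (≤-respˡ-≈ (+-identityˡ y) (+-mono-≤ 0# x y p))

  -- Completeness applied to {0} ∪ {1 | P}: its supremum is at least 1 or at most 0.
  ¬-dec : (P : Set) → Dec (¬ P)
  ¬-dec P with complete (λ y → (y ≈ 0#) ⊎ ((y ≈ 1#) × P)) (0# , inj₁ ≈-refl)
    (1# , λ { x (inj₁ e) → ≤-respˡ-≈ (≈-sym e) 0≤1 ; x (inj₂ (e , _)) → ≤ʳ-reflexive e })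
  ... | s , upper , least with ≤ʳ-total (s +ʳ s) 1#
  ...   | inj₁ h = yes λ p → let 1≤s = upper 1# (inj₂ (≈-refl , p)) in
            1≰0 (≤-cancel 1# 0# 1# (≤ʳ-trans (≤ʳ-trans (+-mono-≤ 1# s 1# 1≤s)
              (≤-respˡ-≈ (+-comm 1# s) (≤-respʳ-≈ (≈-refl {s +ʳ s}) (+-mono-≤ 1# s s 1≤s)))) (≤-respʳ-≈ (≈-sym (+-identityˡ 1#)) h)))
  ...   | inj₂ h = no λ ¬p → let s≤0 = least 0# (λ { x (inj₁ e) → ≤ʳ-reflexive e ; x (inj₂ (_ , p)) → ⊥-elim (¬p p) }) in
            1≰0 (≤ʳ-trans h (≤ʳ-trans (+-mono-≤ s 0# s s≤0) (≤-respˡ-≈ (≈-sym (+-identityˡ s)) s≤0)))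

  private
    -- The supremum s of the additive subgroup {y | ¬ ¬ y ≈ 0} satisfies s ≤ s - x for each of its elements x.
    ≤0-stable : ∀ x → ¬ ¬ (x ≈ 0#) → x ≤ʳ 0#
    ≤0-stable x ¬¬x with complete (λ y → ¬ ¬ (y ≈ 0#)) (x , ¬¬x) (1# , bounded)
      where
      bounded : ∀ y → ¬ ¬ (y ≈ 0#) → y ≤ʳ 1#
      bounded y ¬¬y with ≤ʳ-total y 1#
      ... | inj₁ p = p
      ... | inj₂ p = ⊥-elim (¬¬y λ e → 1≰0 (≤-respʳ-≈ e p))
    ... | s , upper , least = ≤-respˡ-≈ (solve (x1 :+ (x0 :- x1)) x0 (x ∷ s ∷ []) refl)
      (≤-respʳ-≈ (solve ((x1 :- x0) :+ (x0 :- x1)) :0 (x ∷ s ∷ []) refl) (+-mono-≤ s (s -ʳ x) (x -ʳ s) (least (s -ʳ x)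
        λ y ¬¬y → ≤-respˡ-≈ (solve ((x0 :+ x1) :+ (:0 :- x1)) x0 (y ∷ x ∷ []) refl)
          (≤-respʳ-≈ (solve (x0 :+ (:0 :- x1)) (x0 :- x1) (s ∷ x ∷ []) refl)
            (+-mono-≤ (y +ʳ x) s (0# -ʳ x) (upper (y +ʳ x) λ ¬e → ¬¬x λ ex → ¬¬y λ ey → ¬e (≈-trans (+-cong ey ex) (+-identityˡ 0#))))))))

  ≈0-stable : ∀ x → ¬ ¬ (x ≈ 0#) → x ≈ 0#
  ≈0-stable x ¬¬x = antisym (≤0-stable x ¬¬x)
    (≤-respʳ-≈ (-‿involutive x) (neg-nonneg (≤0-stable (- x) λ ¬e → ¬¬x λ e → ¬e (≈-trans (-‿cong e) -0#≈0#))))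

  ≈0? : ∀ x → Dec (x ≈ 0#)
  ≈0? x with ¬-dec (x ≈ 0#)
  ... | yes ¬e = no ¬e
  ... | no ¬¬e = yes (≈0-stable x ¬¬e)

  *-nonzero : ∀ {x y} → ¬ x ≈ 0# → ¬ y ≈ 0# → ¬ (x *ʳ y ≈ 0#)
  *-nonzero {x} {y} x≉0 y≉0 e with inverse x x≉0
  ... | i , xi≈1 = y≉0 (≈-trans (≈-sym (*-identityˡ y)) (≈-trans (*-congʳ (≈-trans (≈-sym xi≈1) (*-comm x i)))
    (≈-trans (*-assoc i x y) (≈-trans (*-congˡ e) (zeroʳ i)))))

  nonneg? : ∀ x → Dec (0# ≤ʳ x)
  nonneg? x with ≤ʳ-total 0# x | ≈0? x
  ... | inj₁ p | _ = yes p
  ... | inj₂ p | yes e = yes (≤ʳ-reflexive (≈-sym e))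
  ... | inj₂ p | no ¬e = no λ q → ¬e (antisym p q)

  open import Algebra.Properties.Monoid.Mult +-monoid public using (×-homo-+) renaming (_×_ to _·_)

  ·-nonneg : ∀ n {x} → 0# ≤ʳ x → 0# ≤ʳ (n · x)
  ·-nonneg zero h = ≤ʳ-refl
  ·-nonneg (suc n) h = +-nonneg h (·-nonneg n h)

  ·-nonpos : ∀ n {x} → x ≤ʳ 0# → (n · x) ≤ʳ 0#
  ·-nonpos zero h = ≤ʳ-refl
  ·-nonpos (suc n) {x} h = ≤ʳ-trans (+-mono-≤ x 0# (n · x) h) (≤-respˡ-≈ (≈-sym (+-identityˡ _)) (·-nonpos n h))

  ·-nonzero : ∀ n {x} → ¬ x ≈ 0# → ¬ (suc n · x ≈ 0#)
  ·-nonzero n {x} x≉0 e with ≤ʳ-total 0# x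
  ... | inj₁ p = x≉0 (antisym (≤-respʳ-≈ e (≤-respˡ-≈ (+-identityʳ x) (≤-respʳ-≈ (+-comm (n · x) x)
      (≤-respˡ-≈ (+-comm 0# x) (+-mono-≤ 0# (n · x) x (·-nonneg n p)))))) p)
  ... | inj₂ p = x≉0 (antisym p (≤-respˡ-≈ e (≤-respʳ-≈ (+-identityʳ x) (≤-respˡ-≈ (+-comm (n · x) x)
      (≤-respʳ-≈ (+-comm 0# x) (+-mono-≤ (n · x) 0# x (·-nonpos n p)))))))

  ·-injective : ∀ m n {x} → ¬ x ≈ 0# → m · x ≈ n · x → m ≡ n
  ·-injective zero zero _ _ = refl
  ·-injective zero (suc n) x≉0 e = ⊥-elim (·-nonzero n x≉0 (≈-sym e))
  ·-injective (suc m) zero x≉0 e = ⊥-elim (·-nonzero m x≉0 e)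
  ·-injective (suc m) (suc n) {x} x≉0 e = cong suc (·-injective m n x≉0 (cancel e))
    where
    cancel : x +ʳ m · x ≈ x +ʳ n · x → m · x ≈ n · x
    cancel e = ≈-trans (solve x1 ((x0 :+ x1) :- x0) (x ∷ m · x ∷ []) refl)
      (≈-trans (+-cong e ≈-refl) (solve ((x0 :+ x1) :- x0) x1 (x ∷ n · x ∷ []) refl))

-- Linear functionals on ℝ^d, their orders and their dimension games.

module Space (R : RealNumbers) (d : ℕ) where
  open Field R public hiding (solve; _:+_; _:-_; :0; x0; x1; x2; x3)
  private module F = Field R

  space : AbelianGroup 0ℓ 0ℓ
  space = record
    { Carrier = Point R d
    ; _≈_ = _≈ᵖ_ R
    ; _∙_ = _+ᵖ_ R
    ; ε = 0ᵖ R
    ; _⁻¹ = λ p k → - p k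
    ; isAbelianGroup = record
      { isGroup = record
        { isMonoid = record
          { isSemigroup = record
            { isMagma = record
              { isEquivalence = record { refl = λ k → ≈-refl ; sym = λ e k → ≈-sym (e k) ; trans = λ e f k → ≈-trans (e k) (f k) }
              ; ∙-cong = λ e f k → +-cong (e k) (f k) }
            ; assoc = λ x y z k → +-assoc (x k) (y k) (z k) }
          ; identity = (λ x k → +-identityˡ (x k)) , (λ x k → +-identityʳ (x k)) }
        ; inverse = (λ x k → -‿inverseˡ (x k)) , (λ x k → -‿inverseʳ (x k))
        ; ⁻¹-cong = λ e k → -‿cong (e k) }
      ; comm = λ x y k → +-comm (x k) (y k) } }

  open Core space ¬-dec public renaming (≈-refl to ≈ᵖ-refl; ≈-sym to ≈ᵖ-sym; ≈-trans to ≈ᵖ-trans; _≈_ to _≋_; Carrier to Vector)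
  open import Algebra.Properties.Monoid.Mult monoid public using () renaming (_×_ to _·ᵍ_)
  open Subgroup
  open Cone using (Pos)

  infixr 7 _∙ᵖ_
  _∙ᵖ_ : ℝ → Vector → Vector
  _∙ᵖ_ = _·ᵖ_ R

  record Functional : Set where
    field
      apply : Vector → ℝ
      ap-cong : ∀ {x y} → x ≋ y → apply x ≈ apply y
      ap-+ : ∀ x y → apply (x ⊕ y) ≈ apply x +ʳ apply y
      ap-∙ : ∀ c x → apply (c ∙ᵖ x) ≈ c *ʳ apply x

    private
      x+x≈x : ∀ x → x +ʳ x ≈ x → x ≈ 0#
      x+x≈x x e = ≈-trans (F.solve F.x0 ((F.x0 F.:+ F.x0) F.:- F.x0) (x ∷ []) refl) (≈-trans (+-congʳ e) (-‿inverseʳ x))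

    ap-0 : apply 𝟘 ≈ 0#
    ap-0 = x+x≈x _ (≈-trans (≈-sym (ap-+ 𝟘 𝟘)) (ap-cong (solve (:0 :+ :0) :0 [] refl)))

    ap-⊖ : ∀ x y → apply (x ⊖ y) ≈ apply x -ʳ apply y
    ap-⊖ x y = ≈-trans (F.solve F.x0 ((F.x0 F.:+ F.x1) F.:- F.x1) (apply (x ⊖ y) ∷ apply y ∷ []) refl)
      (+-congʳ (≈-trans (≈-sym (ap-+ (x ⊖ y) y)) (ap-cong (solve ((x0 :- x1) :+ x1) x0 (x ∷ y ∷ []) refl))))

    ap-· : ∀ n x → apply (n ·ᵍ x) ≈ n · apply x
    ap-· zero x = ap-0
    ap-· (suc n) x = ≈-trans (ap-+ x (n ·ᵍ x)) (+-congˡ (ap-· n x))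

    ap-⊖≈0 : ∀ {x y} → apply x ≈ apply y → apply (x ⊖ y) ≈ 0#
    ap-⊖≈0 {x} {y} e = ≈-trans (ap-⊖ x y) (≈-trans (+-congʳ e) (-‿inverseʳ _))

    ap-≈ : ∀ {x y} → apply (x ⊖ y) ≈ 0# → apply x ≈ apply y
    ap-≈ {x} {y} e = ≈-trans (F.solve F.x0 ((F.x0 F.:- F.x1) F.:+ F.x1) (apply x ∷ apply y ∷ []) refl)
      (≈-trans (+-congʳ (≈-trans (≈-sym (ap-⊖ x y)) e)) (+-identityˡ _))

  open Functional

  Zero : List Functional → Vector → Set
  Zero π x = All (λ φ → apply φ x ≈ 0#) π

  kernel : List Functional → Subgroup
  kernel π = record
    { In = Zero π
    ; resp = λ e → All.map (λ {φ} p → ≈-trans (≈-sym (ap-cong φ e)) p)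
    ; zero∈ = All.universal ap-0 π
    ; add = λ p q → All.zipWith (λ { {φ} (a , b) → ≈-trans (ap-+ φ _ _) (≈-trans (+-cong a b) (+-identityˡ 0#)) }) (p , q)
    ; opp = All.map (λ {φ} p → ≈-trans (ap-⊖ φ _ _) (≈-trans (+-cong (ap-0 φ) (-‿cong p)) (-‿inverseʳ 0#)))
    ; dec = λ x → All.all? (λ φ → ≈0? (apply φ x)) π
    }

  trivial-subgroup : Subgroup
  trivial-subgroup = record
    { In = _≋ 𝟘
    ; resp = λ e p → ≈ᵖ-trans (≈ᵖ-sym e) p
    ; zero∈ = ≈ᵖ-refl
    ; add = λ p q → ≈ᵖ-trans (⊕-cong p q) (solve (:0 :+ :0) :0 [] refl)
    ; opp = λ p → ≈ᵖ-trans (⊕-cong ≈ᵖ-refl (AbelianGroup.⁻¹-cong space p)) (solve (:0 :- :0) :0 [] refl)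
    ; dec = λ x → all? (λ k → ≈0? (x k))
    }

  trivial⊆ : ∀ L {x} → In trivial-subgroup x → In L x
  trivial⊆ L e = resp L (≈ᵖ-sym e) (zero∈ L)

  -- Lexicographic order by the values of `π`. Its kernel is exactly `Zero π`, so it orders the
  -- quotient by `kernel π` without ties, as the sumset lemmas require.
  LexPos : List Functional → Vector → Set
  LexPos [] x = ⊤
  LexPos (φ ∷ π) x = (0# ≤ʳ apply φ x) × (apply φ x ≈ 0# → LexPos π x)

  private
    sum-zero : ∀ {x y} → 0# ≤ʳ x → 0# ≤ʳ y → x +ʳ y ≈ 0# → x ≈ 0#
    sum-zero {x} {y} p q e = antisym (≤-respʳ-≈ e (≤-respˡ-≈ (+-identityʳ x) (≤-respʳ-≈ (+-comm y x)
      (≤-respˡ-≈ (+-comm 0# x) (+-mono-≤ 0# y x q))))) p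

  lexicographic : List Functional → Cone
  lexicographic π = record { Pos = LexPos π ; resp = lex-resp π ; add = lex-add π ; total = lex-total π ; dec = lex-dec π }
    where
    lex-resp : ∀ π {x y} → x ≋ y → LexPos π x → LexPos π y
    lex-resp [] e p = tt
    lex-resp (φ ∷ π) e (p , q) = ≤-respʳ-≈ (ap-cong φ e) p , λ z → lex-resp π e (q (≈-trans (ap-cong φ e) z))
    lex-add : ∀ π {x y} → LexPos π x → LexPos π y → LexPos π (x ⊕ y)
    lex-add [] _ _ = tt
    lex-add (φ ∷ π) {x} {y} (p , q) (p' , q') = ≤-respʳ-≈ (≈-sym (ap-+ φ x y)) (+-nonneg p p') ,
      λ z → let z' = ≈-trans (≈-sym (ap-+ φ x y)) z in
        lex-add π (q (sum-zero p p' z')) (q' (sum-zero p' p (≈-trans (+-comm _ _) z')))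
    lex-total : ∀ π x → LexPos π x ⊎ LexPos π (𝟘 ⊖ x)
    lex-total [] x = inj₁ tt
    lex-total (φ ∷ π) x with ≈0? (apply φ x)
    ... | yes e with lex-total π x
    ...   | inj₁ p = inj₁ (≤ʳ-reflexive (≈-sym e) , λ _ → p)
    ...   | inj₂ p = inj₂ (≤ʳ-reflexive (≈-sym (negated e)) , λ _ → p)
      where
      negated : apply φ x ≈ 0# → apply φ (𝟘 ⊖ x) ≈ 0#
      negated e = ≈-trans (ap-⊖ φ 𝟘 x) (≈-trans (+-cong (ap-0 φ) (-‿cong e)) (-‿inverseʳ 0#))
    lex-total (φ ∷ π) x | no ¬e with ≤ʳ-total 0# (apply φ x)
    ...   | inj₁ p = inj₁ (p , λ e → ⊥-elim (¬e e))
    ...   | inj₂ p = inj₂ (≤-respʳ-≈ (≈-sym φ-neg) (≤-respˡ-≈ (-‿inverseʳ (apply φ x)) (+-mono-≤ _ _ (- apply φ x) p)) ,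
      λ e → ⊥-elim (¬e (≈-trans (F.solve F.x0 (F.:0 F.:- (F.:0 F.:- F.x0)) (apply φ x ∷ []) refl)
        (≈-trans (+-congˡ (-‿cong (≈-trans (≈-sym φ-neg) e))) (-‿inverseʳ 0#)))))
      where
      φ-neg : apply φ (𝟘 ⊖ x) ≈ 0# -ʳ apply φ x
      φ-neg = ≈-trans (ap-⊖ φ 𝟘 x) (+-congʳ (ap-0 φ))
    lex-dec : ∀ π x → Dec (LexPos π x)
    lex-dec [] x = yes tt
    lex-dec (φ ∷ π) x with nonneg? (apply φ x) | ≈0? (apply φ x) | lex-dec π x
    ... | no ¬p | _ | _ = no (¬p ∘ proj₁)
    ... | yes p | no ¬e | _ = yes (p , ⊥-elim ∘ ¬e)
    ... | yes p | yes e | yes q = yes (p , λ _ → q)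
    ... | yes p | yes e | no ¬q = no λ (_ , q) → ¬q (q e)

  kernel⊑lexicographic : ∀ π → kernel π ⊑ lexicographic π
  kernel⊑lexicographic [] [] = tt
  kernel⊑lexicographic (φ ∷ π) (e ∷ es) = ≤ʳ-reflexive (≈-sym e) , λ _ → kernel⊑lexicographic π es

  lexicographic-kernel : ∀ π {x} → Cone.Ker (lexicographic π) x → Zero π x
  lexicographic-kernel [] _ = []
  lexicographic-kernel (φ ∷ π) {x} ((p , q) , (p' , q')) = φx≈0 ∷ lexicographic-kernel π (q φx≈0 , q' φ-x≈0)
    where
    φ-neg : apply φ (𝟘 ⊖ x) ≈ 0# -ʳ apply φ x
    φ-neg = ≈-trans (ap-⊖ φ 𝟘 x) (+-congʳ (ap-0 φ))
    φx≈0 : apply φ x ≈ 0#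
    φx≈0 = sum-zero p p' (≈-trans (+-congˡ φ-neg) (F.solve (F.x0 F.:+ (F.:0 F.:- F.x0)) F.:0 (apply φ x ∷ []) refl))
    φ-x≈0 : apply φ (𝟘 ⊖ x) ≈ 0#
    φ-x≈0 = ≈-trans φ-neg (≈-trans (+-congˡ (-‿cong φx≈0)) (-‿inverseʳ 0#))

  combination : ℝ → Functional → ℝ → Functional → Functional
  combination c φ e ψ = record
    { apply = λ x → c *ʳ apply φ x -ʳ e *ʳ apply ψ x
    ; ap-cong = λ h → +-cong (*-congˡ (ap-cong φ h)) (-‿cong (*-congˡ (ap-cong ψ h)))
    ; ap-+ = λ x y → ≈-trans (+-cong (≈-trans (*-congˡ (ap-+ φ x y)) (distribˡ _ _ _)) (-‿cong (≈-trans (*-congˡ (ap-+ ψ x y)) (distribˡ _ _ _))))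
        (F.solve ((F.x0 F.:+ F.x1) F.:- (F.x2 F.:+ F.x3)) ((F.x0 F.:- F.x2) F.:+ (F.x1 F.:- F.x3))
          (c *ʳ apply φ x ∷ c *ʳ apply φ y ∷ e *ʳ apply ψ x ∷ e *ʳ apply ψ y ∷ []) refl)
    ; ap-∙ = λ a x → ≈-trans (+-cong (swap c a (ap-∙ φ a x)) (-‿cong (swap e a (ap-∙ ψ a x))))
        (≈-trans (+-congˡ (-‿distribʳ-* a (e *ʳ apply ψ x))) (≈-sym (distribˡ a _ _)))
    }
    where
    open import Algebra.Properties.Ring ring using (-‿distribʳ-*)
    swap : ∀ c a {x y} → x ≈ a *ʳ y → c *ʳ x ≈ a *ʳ (c *ʳ y)
    swap c a {x} {y} h = ≈-trans (*-congˡ h) (≈-trans (≈-sym (*-assoc c a y)) (≈-trans (*-congʳ (*-comm c a)) (*-assoc a c y)))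

  -- The projection along `u` to the kernel of `ψ`, scaled by ψ(u) to avoid division.
  project : Functional → Vector → Vector → Vector
  project ψ u x = apply ψ u ∙ᵖ x ⊖ apply ψ x ∙ᵖ u

  ap-project : ∀ ρ ψ u x → apply ρ (project ψ u x) ≈ apply ψ u *ʳ apply ρ x -ʳ apply ψ x *ʳ apply ρ u
  ap-project ρ ψ u x = ≈-trans (ap-⊖ ρ _ _) (+-cong (ap-∙ ρ _ x) (-‿cong (ap-∙ ρ _ u)))

  project-zero : ∀ ψ u x → apply ψ (project ψ u x) ≈ 0#
  project-zero ψ u x = ≈-trans (ap-project ψ ψ u x) (≈-trans (+-congˡ (-‿cong (*-comm _ _))) (-‿inverseʳ _))

  ap-project₀ : ∀ ρ ψ u x → apply ρ u ≈ 0# → apply ρ (project ψ u x) ≈ apply ψ u *ʳ apply ρ x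
  ap-project₀ ρ ψ u x e = ≈-trans (ap-project ρ ψ u x) (≈-trans (+-congˡ (-‿cong (≈-trans (*-congˡ e) (zeroʳ _))))
    (F.solve (F.x0 F.:- F.:0) F.x0 (apply ψ u *ʳ apply ρ x ∷ []) refl))

  Nonzero : Functional → Set
  Nonzero ρ = ∃ λ u → ¬ (apply ρ u ≈ 0#)

  -- The functionals that factor through π span a space of dimension at least k, as a game.
  Through : ℕ → List Functional → Set
  Through k π = ∀ vs → length vs < k → ∃ λ ρ → (∀ {x} → Zero π x → apply ρ x ≈ 0#) × All (λ v → apply ρ v ≈ 0#) vs × Nonzero ρ

  -- If `ψ` kills all of `vs`, it is the answer. Otherwise some `v` with ψ(v) ≠ 0 is eliminated:
  -- `ρ₀` answers the projections of the others along `v`, and ρ = ψ(v) ρ₀ - ρ₀(v) ψ is `ρ₀`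
  -- composed with that projection. It is nonzero at `w` or at `u`, according as ρ₀(v) vanishes or
  -- not.
  through-cons : ∀ {k π} → Through k π → ∀ ψ u → Zero π u → ¬ (apply ψ u ≈ 0#) → Through (suc k) (ψ ∷ π)
  through-cons {k} {π} th ψ u πu ψu vs (s≤s lt) with All.all? (λ v → ≈0? (apply ψ v)) vs
  ... | yes p = ψ , (λ { (e ∷ _) → e }) , p , (u , ψu)
  ... | no ¬p with find (Allₚ.¬All⇒Any¬ (λ v → ≈0? (apply ψ v)) vs ¬p)
  ...   | v , v∈ , ψv with without v∈
    where
    without : ∀ {v : Vector} {vs} → v ∈ vs → ∃ λ vs' → (length vs ≡ suc (length vs')) × (∀ {w} → w ∈ vs → w ≡ v ⊎ w ∈ vs')
    without {vs = _ ∷ vs} (here refl) = vs , refl , λ { (here e) → inj₁ e ; (there m) → inj₂ m }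
    without {vs = x ∷ vs} (there m) with without m
    ... | vs' , e , split = x ∷ vs' , cong suc e , λ where
      (here refl) → inj₂ (here refl)
      (there m') → Sum.map₂ there (split m')
  ...     | vs' , len , split with th (map (project ψ v) vs')
            (ℕₚ.≤-trans (ℕₚ.≤-reflexive (trans (cong suc (length-map (project ψ v) vs')) (sym len))) lt)
  ...       | ρ₀ , through , kills , (w , ρ₀w) = ρ , through' , All.tabulate (kills' ∘ split) , nonzero (≈0? (apply ρ₀ v))
    where
    ρ : Functional
    ρ = combination (apply ψ v) ρ₀ (apply ρ₀ v) ψ
    through' : ∀ {x} → Zero (ψ ∷ π) x → apply ρ x ≈ 0#
    through' (e ∷ es) = ≈-trans (+-cong (≈-trans (*-congˡ (through es)) (zeroʳ _)) (-‿cong (≈-trans (*-congˡ e) (zeroʳ _)))) (-‿inverseʳ 0#)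
    kills' : ∀ {x} → x ≡ v ⊎ x ∈ vs' → apply ρ x ≈ 0#
    kills' (inj₁ refl) = ≈-trans (+-congˡ (-‿cong (*-comm _ _))) (-‿inverseʳ _)
    kills' {x} (inj₂ m) = ≈-trans (+-congˡ (-‿cong (*-comm _ _)))
      (≈-trans (≈-sym (ap-project ρ₀ ψ v x)) (All.lookup (Allₚ.map⁻ kills) m))
    nonzero : Dec (apply ρ₀ v ≈ 0#) → Nonzero ρ
    nonzero (yes e) = w , λ h → *-nonzero ψv ρ₀w (≈-trans (F.solve F.x0 ((F.x0 F.:- F.x1) F.:+ F.x1) (apply ψ v *ʳ apply ρ₀ w ∷ apply ρ₀ v *ʳ apply ψ w ∷ []) refl)
      (≈-trans (+-cong h (≈-trans (*-congʳ e) (zeroˡ _))) (+-identityˡ 0#)))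
    nonzero (no ¬e) = u , λ h → *-nonzero ¬e ψu (≈-trans (F.solve F.x1 (F.x0 F.:- (F.x0 F.:- F.x1)) (apply ψ v *ʳ apply ρ₀ u ∷ apply ρ₀ v *ʳ apply ψ u ∷ []) refl)
      (≈-trans (+-cong (≈-trans (*-congˡ (through πu)) (zeroʳ _)) (-‿cong h)) (-‿inverseʳ 0#)))

  -- The functionals restricted to the kernel of π span a space of dimension at least e, as a game.
  Transverse : ℕ → List Functional → Set
  Transverse e π = ∀ vs → length vs < e → ∃ λ ψ → All (λ v → apply ψ v ≈ 0#) vs × ∃ λ u → Zero π u × ¬ (apply ψ u ≈ 0#)

  -- With `u` played as an additional vector, the answer `ψ'` vanishes at `u`. It therefore stays
  -- nonzero when `u'` is projected along `u` into the kernel of `ψ`.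
  transverse-cons : ∀ {e π} → Transverse (suc e) π → ∀ ψ u → Zero π u → ¬ (apply ψ u ≈ 0#) → Transverse e (ψ ∷ π)
  transverse-cons {e} {π} tr ψ u πu ψu vs lt with tr (u ∷ vs) (s≤s lt)
  ... | ψ' , ψ'u ∷ kills , u' , πu' , ψ'u' = ψ' , kills , project ψ u u' ,
    project-zero ψ u u' ∷ All.zipWith (λ { {φ} (a , b) → ≈-trans (ap-project φ ψ u u')
      (≈-trans (+-cong (≈-trans (*-congˡ b) (zeroʳ _)) (-‿cong (≈-trans (*-congˡ a) (zeroʳ _)))) (-‿inverseʳ 0#)) }) (πu , πu') ,
    λ h → *-nonzero ψu ψ'u' (≈-trans (≈-sym (ap-project₀ ψ' ψ u u' ψ'u)) h)

  coordinate : Fin d → Functional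
  coordinate i = record { apply = λ x → x i ; ap-cong = λ e → e i ; ap-+ = λ _ _ → ≈-refl ; ap-∙ = λ _ _ → ≈-refl }

  coordinates : List Functional
  coordinates = map coordinate (allFin d)

  unit-vector : Fin d → Vector
  unit-vector i j with i ≟ j
  ... | yes _ = 1#
  ... | no _ = 0#

  coordinates-through : Through d coordinates
  coordinates-through = subst (λ k → Through k coordinates) (length-tabulate id) (go (allFin d) (Uniqueₚ.allFin⁺ d))
    where
    unit-diag : ∀ i → ¬ (unit-vector i i ≈ 0#)
    unit-diag i with i ≟ i
    ... | yes _ = λ e → 0≉1 (≈-sym e)
    ... | no ¬e = ⊥-elim (¬e refl)
    unit-off : ∀ {i j} → ¬ i ≡ j → unit-vector i j ≈ 0#
    unit-off {i} {j} ne with i ≟ j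
    ... | yes e = ⊥-elim (ne e)
    ... | no _ = ≈-refl
    go : ∀ is → AllPairs (λ i j → ¬ i ≡ j) is → Through (length is) (map coordinate is)
    go [] _ vs ()
    go (i ∷ is) (ne ∷ u) = through-cons (go is u) (coordinate i) (unit-vector i) (Allₚ.map⁺ (All.map unit-off ne)) (unit-diag i)

  transverse-[] : Transverse d []
  transverse-[] vs lt with coordinates-through vs lt
  ... | ρ , _ , kills , (u , ρu) = ρ , kills , u , [] , ρu

  coordinates-kernel : ∀ {x} → Zero coordinates x → x ≋ 𝟘
  coordinates-kernel z i = All.lookup (Allₚ.map⁻ z) (∈-allFin i)

  -- A functional that is constant on the points is constant on their affine span, which is
  -- everything and contains 0. Full dimension enters the argument here.
  nonconstant : ∀ {n} (a : Fin n → Vector) → FullDim R a → ∀ ρ → Nonzero ρ → ¬ (∀ i j → apply ρ (a i) ≈ apply ρ (a j))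
  nonconstant {zero} a full ρ _ _ with full 𝟘
  ... | λ' , 0≈1 , _ = 0≉1 0≈1
  nonconstant {suc n} a full ρ (u , ρu) const = ρu (≈-trans (value u) (≈-trans (≈-sym (value 𝟘)) (ap-0 ρ)))
    where
    κ : ℝ
    κ = apply ρ (a zero)
    linear-sum : ∀ {m} (c : Fin m → ℝ) (b : Fin m → Vector) → (∀ i → apply ρ (b i) ≈ κ) → apply ρ (Σᵖ R (λ i → _·ᵖ_ R (c i) (b i))) ≈ Σˢ R c *ʳ κ
    linear-sum {zero} c b h = ≈-trans (ap-0 ρ) (≈-sym (zeroˡ κ))
    linear-sum {suc m} c b h = ≈-trans (ap-+ ρ _ _) (≈-trans (+-cong (≈-trans (ap-∙ ρ (c zero) (b zero)) (*-congˡ (h zero)))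
      (linear-sum (c ∘ suc) (b ∘ suc) (h ∘ suc))) (≈-sym (distribʳ κ _ _)))
    value : ∀ x → apply ρ x ≈ κ
    value x with full x
    ... | λ' , sum≈1 , e = ≈-trans (≈-sym (ap-cong ρ e)) (≈-trans (linear-sum λ' a (λ i → const i zero)) (≈-trans (*-congʳ sum≈1) (*-identityˡ κ)))

  -- The points stick p 0, stick p 1, … are a model of the fibre of π through p.
  module Stick (π : List Functional) (ψ : Functional) (u : Vector) (πu : Zero π u) (ψu : ¬ (apply ψ u ≈ 0#)) where

    -- `ψ` has the value h ψ(u) at `stick p h`, and every functional of `π` has ψ(u) times its value
    -- at `p`. Height and fibre can thus be read off, and both are additive.
    stick : Vector → ℕ → Vector
    stick p h = project ψ u p ⊕ h ·ᵍ u

    private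
      ψ-stick : ∀ p h → apply ψ (stick p h) ≈ h · apply ψ u
      ψ-stick p h = ≈-trans (ap-+ ψ _ _) (≈-trans (+-cong (project-zero ψ u p) (ap-· ψ h u)) (+-identityˡ _))

      ·-zero : ∀ h {x} → x ≈ 0# → h · x ≈ 0#
      ·-zero zero e = ≈-refl
      ·-zero (suc h) e = ≈-trans (+-cong e (·-zero h e)) (+-identityˡ 0#)

      φ-stick : ∀ φ → apply φ u ≈ 0# → ∀ p h → apply φ (stick p h) ≈ apply ψ u *ʳ apply φ p
      φ-stick φ φu p h = ≈-trans (ap-+ φ _ _) (≈-trans (+-cong (ap-project₀ φ ψ u p φu) (≈-trans (ap-· φ h u) (·-zero h φu))) (+-identityʳ _))

      cancel : ∀ {x y} → apply ψ u *ʳ x ≈ apply ψ u *ʳ y → x ≈ y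
      cancel {x} {y} e with ≈0? (x -ʳ y)
      ... | yes h = ≈-trans (F.solve F.x0 ((F.x0 F.:- F.x1) F.:+ F.x1) (x ∷ y ∷ []) refl) (≈-trans (+-congʳ h) (+-identityˡ y))
      ... | no ¬h = ⊥-elim (*-nonzero ψu ¬h (≈-trans (distribˡ _ x (- y)) (≈-trans (+-cong e (≈-sym (-‿distribʳ-* _ y))) (-‿inverseʳ _))))
        where open import Algebra.Properties.Ring ring using (-‿distribʳ-*)

    stick-injective : ∀ {p q h k} → Zero (ψ ∷ π) (stick p h ⊖ stick q k) → Zero π (p ⊖ q) × h ≡ k
    stick-injective {p} {q} {h} {k} (e ∷ es) =
      All.zipWith (λ { {φ} (φu , e) → ap-⊖≈0 φ (cancel (≈-trans (≈-sym (φ-stick φ φu p h)) (≈-trans (ap-≈ φ e) (φ-stick φ φu q k)))) }) (πu , es) ,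
      ·-injective h k ψu (≈-trans (≈-sym (ψ-stick p h)) (≈-trans (ap-≈ ψ e) (ψ-stick q k)))

    stick-sums : ∀ p q p' q' h k h' k' → Zero π ((p ⊕ q) ⊖ (p' ⊕ q')) → h ℕ.+ k ≡ h' ℕ.+ k' →
      Zero (ψ ∷ π) ((stick p h ⊕ stick q k) ⊖ (stick p' h' ⊕ stick q' k'))
    stick-sums p q p' q' h k h' k' z e =
      ap-⊖≈0 ψ (≈-trans (ψ-sum p q h k) (≈-trans (reflexive (cong (_· apply ψ u) e)) (≈-sym (ψ-sum p' q' h' k')))) ∷
      All.zipWith (λ { {φ} (φu , e) → ap-⊖≈0 φ (≈-trans (φ-sum φ φu p q h k) (≈-trans (*-congˡ (ap-≈ φ e)) (≈-sym (φ-sum φ φu p' q' h' k')))) }) (πu , z)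
      where
      ψ-sum : ∀ p q h k → apply ψ (stick p h ⊕ stick q k) ≈ (h ℕ.+ k) · apply ψ u
      ψ-sum p q h k = ≈-trans (ap-+ ψ _ _) (≈-trans (+-cong (ψ-stick p h) (ψ-stick q k)) (≈-sym (×-homo-+ (apply ψ u) h k)))
      φ-sum : ∀ φ → apply φ u ≈ 0# → ∀ p q h k → apply φ (stick p h ⊕ stick q k) ≈ apply ψ u *ʳ apply φ (p ⊕ q)
      φ-sum φ φu p q h k = ≈-trans (ap-+ φ _ _) (≈-trans (+-cong (φ-stick φ φu p h) (φ-stick φ φu q k))
        (≈-trans (≈-sym (distribˡ _ _ _)) (*-congˡ (≈-sym (ap-+ φ p q)))))

    module _ (ρ : Functional) (through : ∀ {x} → Zero (ψ ∷ π) x → apply ρ x ≈ 0#) where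

      stick-step : ∀ p → apply ρ (stick p 1 ⊖ stick p 0) ≈ 0# → apply ρ u ≈ 0#
      stick-step p e = ≈-trans (ap-cong ρ (solve x1 ((x0 :+ (x1 :+ :0)) :- (x0 :+ :0)) (project ψ u p ∷ u ∷ []) refl)) e

      stick-constant : ∀ p q → apply ρ u ≈ 0# → apply ρ (stick p 0 ⊖ stick q 0) ≈ 0# → apply ρ p ≈ apply ρ q
      stick-constant p q ρu e = cancel (≈-trans (≈-sym (φ-stick ρ ρu p 0)) (≈-trans (ap-≈ ρ e) (φ-stick ρ ρu q 0)))

      fibre-constant : ∀ a p → apply ρ u ≈ 0# → Zero π (a ⊖ p) → apply ρ a ≈ apply ρ p
      fibre-constant a p ρu z = ap-≈ ρ (cancel (≈-trans (≈-sym (ap-project₀ ρ ψ u (a ⊖ p) ρu)) (≈-trans (through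
        (project-zero ψ u (a ⊖ p) ∷ All.zipWith (λ { {φ} (φu , e) → ≈-trans (ap-project₀ φ ψ u (a ⊖ p) φu) (≈-trans (*-congˡ e) (zeroʳ _)) }) (πu , z)))
        (≈-sym (zeroʳ _)))))

-- Counting class by class.

module _ {T : Set} {_∼_ : T → T → Set} (_∼?_ : ∀ s t → Dec (s ∼ t)) (∼-sym : ∀ {s t} → s ∼ t → t ∼ s)
  (∼-trans : ∀ {s t r} → s ∼ t → t ∼ r → s ∼ r) (∼-refl : ∀ {t} → t ∼ t) (height : T → ℕ) where

  private
    tallest : ∀ t ts → ∃ λ g → g ∈ (t ∷ ts) × (∀ {s} → s ∈ (t ∷ ts) → height s ≤ height g)
    tallest t [] = t , here refl , λ { (here refl) → ℕₚ.≤-refl }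
    tallest t (t' ∷ ts) with tallest t' ts
    ... | g , m , top with height g ≤? height t
    ...   | yes le = t , here refl , λ { (here refl) → ℕₚ.≤-refl ; (there m') → ℕₚ.≤-trans (top m') le }
    ...   | no ¬le = g , there m , λ { (here refl) → ℕₚ.<⇒≤ (ℕₚ.≰⇒> ¬le) ; (there m') → top m' }

  -- Distinct heights in one class number at most one more than the greatest of them. The tallest
  -- member represents its class, because it is the one for which `Lines.piece` supplies enough sums
  -- of `A`.
  regroup : ∀ zs → AllPairs (λ s t → ¬ (s ∼ t × height s ≡ height t)) zs →
    ∃ λ gs → All (_∈ zs) gs × AllPairs (λ s t → ¬ s ∼ t) gs × length zs ≤ total (suc ∘ height) gs
  regroup zs = go (length zs) zs ℕₚ.≤-refl
    where
    go : ∀ n zs → length zs ≤ n → AllPairs (λ s t → ¬ (s ∼ t × height s ≡ height t)) zs →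
      ∃ λ gs → All (_∈ zs) gs × AllPairs (λ s t → ¬ s ∼ t) gs × length zs ≤ total (suc ∘ height) gs
    go n [] _ _ = [] , [] , [] , z≤n
    go (suc n) (z ∷ zs) (s≤s le) d@(z≁ ∷ dzs)
      with tallest z (filter (_∼? z) zs) | go n (filter (¬? ∘ (_∼? z)) zs)
        (ℕₚ.≤-trans (ℕₚ.≤-trans (ℕₚ.m≤n+m _ _) (ℕₚ.≤-reflexive (sym (length-filter-∁ (_∼? z) zs)))) le) (Pairsₚ.filter⁺ (¬? ∘ (_∼? z)) dzs)
    ... | g , g∈ , top | gs , gs∈ , dgs , bound = g ∷ gs ,
      ⊆zs g∈ ∷ All.map (there ∘ proj₁ ∘ ∈-filter⁻ (¬? ∘ (_∼? z)) {xs = zs}) gs∈ ,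
      All.map (λ m g∼s → proj₂ (∈-filter⁻ (¬? ∘ (_∼? z)) {xs = zs} m) (∼-trans (∼-sym g∼s) (∼z g∈))) gs∈ ∷ dgs ,
      ℕₚ.≤-trans (ℕₚ.≤-reflexive (cong suc (length-filter-∁ (_∼? z) zs))) (ℕₚ.+-mono-≤ class bound)
      where
      same : List T
      same = z ∷ filter (_∼? z) zs
      ∼z : ∀ {s} → s ∈ same → s ∼ z
      ∼z (here refl) = ∼-refl
      ∼z (there m) = proj₂ (∈-filter⁻ (_∼? z) {xs = zs} m)
      ⊆zs : ∀ {s} → s ∈ same → s ∈ (z ∷ zs)
      ⊆zs (here e) = here e
      ⊆zs (there m) = there (proj₁ (∈-filter⁻ (_∼? z) {xs = zs} m))
      dsame : AllPairs (λ s t → ¬ (s ∼ t × height s ≡ height t)) same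
      dsame = All.tabulate (λ m → All.lookup z≁ (proj₁ (∈-filter⁻ (_∼? z) {xs = zs} m))) ∷ Pairsₚ.filter⁺ (_∼? z) dzs
      class : length same ≤ suc (height g)
      class = ℕₚ.≤-trans (pigeonhole (λ s h → height s ≡ h) same (upTo (suc (height g)))
        (allPairs-map∈ (λ ms mt ¬p h e e' → ¬p (∼-trans (∼z ms) (∼-sym (∼z mt)) , trans e (sym e'))) dsame)
        (All.tabulate λ m → lose (∈-upTo⁺ (s≤s (top m))) refl)) (ℕₚ.≤-reflexive (length-upTo (suc (height g))))

-- The number of translates, when fibres of dimension 1 + e are large to within a factor K.
translate-count : ℕ → ℕ → ℕ → ℕ
translate-count d zero K = suc d * K + (K + suc d * K * (suc d * K) * 3)
translate-count d (suc e) K =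
  suc d * K + (suc d * K * (suc d * K) * (3 + slackC e) + translate-count d e (suc (suc d * K * slackK e)))

-- Fibres of a projection, and the descent to a small flat rich in points.

module Assembly (R : RealNumbers) (d n : ℕ) (a : Fin n → Point R d) (a-distinct : Distinct R a) (a-full : FullDim R a) where
  open Space R d
  open Planar space ¬-dec
  open Sumsets space ¬-dec
  open Freiman space ¬-dec
  open Linear using (linear; _:+_; _:*_; _:≤_; u0; u1; u2; u3; u4; u5; u6; u7)
  open Subgroup
  open Expansion
  open Functional

  A : List Vector
  A = tabulate a

  N : ℕ
  N = length A

  L₀ : Subgroup
  L₀ = trivial-subgroup

  A-distinct : DistinctMod L₀ A
  A-distinct = Pairsₚ.tabulate⁺ λ {i} {j} i≢j e → i≢j (a-distinct i j
    (≈ᵖ-trans (solve x0 ((x0 :- x1) :+ x1) (a i ∷ a j ∷ []) refl) (≈ᵖ-trans (⊕-cong e ≈ᵖ-refl) (solve (:0 :+ x0) x0 (a j ∷ []) refl))))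

  nonconstantᴬ : ∀ ρ → Nonzero ρ → ¬ (∀ {x y} → x ∈ A → y ∈ A → apply ρ x ≈ apply ρ y)
  nonconstantᴬ ρ nz const = nonconstant a a-full ρ nz λ i j → const (∈-tabulate⁺ i) (∈-tabulate⁺ j)

  C₀ : Cone
  C₀ = lexicographic coordinates

  L₀C₀ : L₀ ⊑ C₀
  L₀C₀ e = kernel⊑lexicographic coordinates (trivial⊆ (kernel coordinates) e)

  C₀L₀ : ∀ {x} → Cone.Ker C₀ x → In L₀ x
  C₀L₀ k = coordinates-kernel (lexicographic-kernel coordinates k)

  error : ℕ
  error = triangular d

  Good : ℕ → Set
  Good c = Σ (Expansion L₀ A c) λ E → N * suc d ≤ size E + error

  good-mono : ∀ {c c'} → c ≤ c' → Good c → Good c'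
  good-mono le (E , h) = record { translates = translates E ; translates∈ = translates∈ E ; few = ℕₚ.≤-trans (few E) le
    ; points = points E ; distinct = distinct E ; points∈ = points∈ E } , h

  module Fibres (π : List Functional) where

    Lπ : Subgroup
    Lπ = kernel π

    fibre : Vector → List Vector
    fibre p = filter (λ x → dec Lπ (x ⊖ p)) A

    fibre⊆A : ∀ {p x} → x ∈ fibre p → x ∈ A
    fibre⊆A {p} = proj₁ ∘ ∈-filter⁻ (λ x → dec Lπ (x ⊖ p)) {xs = A}

    fibre-kernel : ∀ {p x} → x ∈ fibre p → Zero π (x ⊖ p)
    fibre-kernel {p} = proj₂ ∘ ∈-filter⁻ (λ x → dec Lπ (x ⊖ p)) {xs = A}

    fibre-distinct : ∀ p → DistinctMod L₀ (fibre p)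
    fibre-distinct p = Pairsₚ.filter⁺ (λ x → dec Lπ (x ⊖ p)) A-distinct

    self∈fibre : ∀ {p} → p ∈ A → p ∈ fibre p
    self∈fibre {p} m = ∈-filter⁺ (λ x → dec Lπ (x ⊖ p)) m (resp Lπ (solve :0 (x0 :- x0) (p ∷ []) refl) (zero∈ Lπ))

    -- A piece stays in the class of `q` modulo `kernel π`, so pieces of different classes are
    -- disjoint and `combine` may add their sizes.
    record Piece (c : ℕ) (q : Vector) (size : ℕ) : Set where
      field
        translates : List Vector
        translates∈ : All (_∈ A) translates
        few : length translates ≤ c
        points : List Vector
        distinct : DistinctMod L₀ points
        points∈ : All (λ x → Sums A translates x × Zero π (x ⊖ q)) points
        large : size ≤ length points

    sums-class : ∀ {p q ws} → All (_∈ fibre q) ws → ∀ {x} → Sums (fibre p) ws x → Sums A ws x × Zero π (x ⊖ (p ⊕ q))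
    sums-class {p} {q} ws∈ {x} (y , w , my , mw , e) = (y , w , fibre⊆A my , mw , e) ,
      resp Lπ (≈ᵖ-trans (solve ((x0 :- x1) :+ (x2 :- x3)) ((x0 :+ x2) :- (x1 :+ x3)) (y ∷ p ∷ w ∷ q ∷ []) refl) (⊕-cong (≈ᵖ-sym e) ≈ᵖ-refl))
        (add Lπ (fibre-kernel my) (fibre-kernel (All.lookup ws∈ mw)))

    -- In `three-translates` the smaller set has to provide the translates, hence the two cases.
    pair-piece : ∀ {p q s} → p ∈ A → q ∈ A → suc s ≤ length (fibre p) + length (fibre q) → Piece 3 (p ⊕ q) s
    pair-piece {p} {q} {s} p∈ q∈ s< with length (fibre q) ≤? length (fibre p)
    ... | yes le with three-translates L₀ C₀ L₀C₀ C₀L₀ (fibre p) (fibre q) (fibre-distinct p) (fibre-distinct q) (self∈fibre q∈) le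
    ...   | ws , ws∈ , few , zs , dzs , zs∈ , bound = record { translates = ws ; translates∈ = All.map fibre⊆A ws∈ ; few = few
            ; points = zs ; distinct = dzs ; points∈ = All.map (sums-class ws∈) zs∈ ; large = ℕₚ.≤-pred (ℕₚ.≤-trans s< bound) }
    pair-piece {p} {q} {s} p∈ q∈ s< | no ¬le with three-translates L₀ C₀ L₀C₀ C₀L₀ (fibre q) (fibre p) (fibre-distinct q) (fibre-distinct p) (self∈fibre p∈) (ℕₚ.<⇒≤ (ℕₚ.≰⇒> ¬le))
    ...   | ws , ws∈ , few , zs , dzs , zs∈ , bound = record { translates = ws ; translates∈ = All.map fibre⊆A ws∈ ; few = few
            ; points = zs ; distinct = dzs
            ; points∈ = All.map (λ {x} h → let s , z = sums-class ws∈ h in s , resp Lπ (solve (x0 :- (x1 :+ x2)) (x0 :- (x2 :+ x1)) (x ∷ q ∷ p ∷ []) refl) z) zs∈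
            ; large = ℕₚ.≤-pred (ℕₚ.≤-trans s< (ℕₚ.≤-trans (ℕₚ.≤-reflexive (ℕₚ.+-comm (length (fibre p)) _)) bound)) }

    module _ {T : Set} (class : T → Vector) (value : T → ℕ) (c : ℕ) where

      combine : ∀ ts → AllPairs (λ s t → ¬ Zero π (class s ⊖ class t)) ts → All (λ t → Piece c (class t) (value t)) ts →
        Σ (Expansion L₀ A (length ts * c)) λ E → total value ts ≤ size E
      combine ts d ps = let E , _ , le = go ts d ps in E , le
        where
        go : ∀ ts → AllPairs (λ s t → ¬ Zero π (class s ⊖ class t)) ts → All (λ t → Piece c (class t) (value t)) ts →
          Σ (Expansion L₀ A (length ts * c)) λ E → All (λ x → Any (λ t → Zero π (x ⊖ class t)) ts) (points E) × total value ts ≤ size E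
        go [] _ _ = trivial , [] , z≤n
        go (t ∷ ts) (t≁ ∷ d) (p ∷ ps) with go ts d ps
        ... | E , classes , le = record
          { translates = P.translates ++ translates E
          ; translates∈ = Allₚ.++⁺ P.translates∈ (translates∈ E)
          ; few = ℕₚ.≤-trans (ℕₚ.≤-reflexive (length-++ P.translates)) (ℕₚ.+-mono-≤ P.few (few E))
          ; points = P.points ++ points E
          ; distinct = Pairsₚ.++⁺ P.distinct (distinct E) (All.map (λ { {x} (_ , xt) → All.map (λ {y} ys e →
              All.lookupWith (λ { {s} ¬ts ys → ¬ts (resp Lπ (solve (((x0 :- x1) :+ (x1 :- x3)) :- (x0 :- x2)) (x2 :- x3) (x ∷ y ∷ class t ∷ class s ∷ []) refl)
                (sub Lπ (add Lπ (trivial⊆ Lπ e) ys) xt)) }) t≁ ys) classes }) P.points∈)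
          ; points∈ = Allₚ.++⁺ (All.map (sums-mono id ∈-++⁺ˡ ∘ proj₁) P.points∈) (All.map (sums-mono id (∈-++⁺ʳ P.translates)) (points∈ E)) } ,
          Allₚ.++⁺ (All.map (here ∘ proj₂) P.points∈) (All.map there classes) ,
          ℕₚ.≤-trans (ℕₚ.+-mono-≤ P.large le) (ℕₚ.≤-reflexive (sym (length-++ P.points)))
          where module P = Piece p

    -- If there are many fibres, then translating a single large fibre by one element of each suffices.
    many-fibres : ∀ K B → DistinctMod Lπ B → All (_∈ A) B → ∀ p → N ≤ length (fibre p) * K → suc d * K ≤ length B → Good (suc d * K)
    many-fibres K B dB B∈ p rich many = record
      { translates = ts
      ; translates∈ = Allₚ.take⁺ (suc d * K) B∈
      ; few = ℕₚ.≤-trans (ℕₚ.≤-reflexive (length-take (suc d * K) B)) (ℕₚ.m⊓n≤m _ _)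
      ; points = sums ts ; distinct = sums-distinct ts (Pairsₚ.take⁺ (suc d * K) dB) ; points∈ = All.map (λ (y , w , my , mw , e) → y , w , fibre⊆A my , mw , e) (sums∈ ts) } ,
      ℕₚ.≤-trans (ℕₚ.≤-trans (ℕₚ.*-monoˡ-≤ (suc d) rich) (ℕₚ.≤-reflexive count)) (ℕₚ.m≤m+n _ error)
      where
      F ts : List Vector
      F = fibre p
      ts = take (suc d * K) B
      sums : List Vector → List Vector
      sums [] = []
      sums (t ∷ ts) = map (_⊕ t) F ++ sums ts
      sums∈ : ∀ ts → All (Sums F ts) (sums ts)
      sums∈ [] = []
      sums∈ (t ∷ ts) = Allₚ.++⁺ (Allₚ.map⁺ (All.tabulate λ {y} my → y , t , my , here refl , ≈ᵖ-refl)) (All.map (sums-mono id there) (sums∈ ts))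
      sums-distinct : ∀ ts → DistinctMod Lπ ts → DistinctMod L₀ (sums ts)
      sums-distinct [] _ = []
      sums-distinct (t ∷ ts) (t≁ ∷ d) = Pairsₚ.++⁺ (distinct-shift L₀ t (fibre-distinct p)) (sums-distinct ts d)
        (Allₚ.map⁺ (All.tabulate λ {x} mx → All.map (λ { {z} (y , w , my , mw , e) h → All.lookup t≁ mw (resp Lπ
          (solve (((x0 :+ x1) :- (x2 :+ x3)) :- ((x0 :- x4) :- (x2 :- x4))) (x1 :- x3) (x ∷ t ∷ y ∷ w ∷ p ∷ []) refl)
          (sub Lπ (trivial⊆ Lπ (≈ᵖ-trans (⊕-cong ≈ᵖ-refl (AbelianGroup.⁻¹-cong space (≈ᵖ-sym e))) h)) (sub Lπ (fibre-kernel mx) (fibre-kernel my)))) }) (sums∈ ts)))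
      sums-length : ∀ ts → length (sums ts) ≡ length ts * length F
      sums-length [] = refl
      sums-length (t ∷ ts) = trans (length-++ (map (_⊕ t) F)) (cong₂ _+_ (length-map (_⊕ t) F) (sums-length ts))
      count : length F * K * suc d ≡ length (sums ts)
      count = trans (ℕₚ.*-assoc (length F) K (suc d)) (trans (ℕₚ.*-comm (length F) (K * suc d)) (trans (cong (_* length F)
        (trans (ℕₚ.*-comm K (suc d)) (sym (trans (length-take (suc d * K) B) (ℕₚ.m≤n⇒m⊓n≡m many))))) (sym (sums-length ts))))

    cover-count : ∀ B → (∀ {x} → x ∈ A → Any (λ p → Zero π (x ⊖ p)) B) → N ≤ total (length ∘ fibre) B
    cover-count B cover = ℕₚ.≤-trans (ℕₚ.≤-reflexive (sym (ℕₚ.*-identityʳ N))) (total-columns (λ x p → dec Lπ (x ⊖ p)) A B 1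
      λ {x} mx → let p , mp , z = find (cover mx) in nonempty (∈-filter⁺ (λ p → dec Lπ (x ⊖ p)) mp z))
      where
      nonempty : ∀ {x : Vector} {xs} → x ∈ xs → 1 ≤ length xs
      nonempty (here _) = s≤s z≤n
      nonempty (there _) = s≤s z≤n

    private
      length-pairs : ∀ (xs ys : List Vector) → length (cartesianProduct xs ys) ≡ length xs * length ys
      length-pairs [] ys = refl
      length-pairs (x ∷ xs) ys = trans (length-++ (map (x ,_) ys)) (cong₂ _+_ (length-map (x ,_) ys) (length-pairs xs ys))

    -- This bounds the number of pieces, and so of translates, independently of |A|.
    few-classes : ∀ {T : Set} (class : T → Vector) (B : List Vector) ts → AllPairs (λ s t → ¬ Zero π (class s ⊖ class t)) ts →
      All (λ t → ∃ λ p → ∃ λ q → p ∈ B × q ∈ B × class t ≡ p ⊕ q) ts → length ts ≤ length B * length B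
    few-classes class B ts d h = ℕₚ.≤-trans (pigeonhole (λ t pq → class t ≡ proj₁ pq ⊕ proj₂ pq) ts (cartesianProduct B B)
      (allPairs-map∈ (λ {s} {t} _ _ ¬z pq e e' → ¬z (subst (λ v → Zero π (class s ⊖ v)) (trans e (sym e'))
        (resp Lπ (solve :0 (x0 :- x0) (class s ∷ []) refl) (zero∈ Lπ)))) d)
      (All.map (λ (p , q , mp , mq , e) → lose (∈-cartesianProduct⁺ mp mq) e) h)) (ℕₚ.≤-reflexive (length-pairs B B))

  -- The bundles serve as index type in `Freiman`, so that the expansion of a fibre travels with its
  -- point.
  with-evidence : ∀ {P : Vector → Set} {I : Set} (pt : I → Vector) → (∀ x → P x → ∃ λ i → pt i ≡ x) → ∀ xs → All P xs → ∃ λ is → map pt is ≡ xs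
  with-evidence pt f [] [] = [] , refl
  with-evidence pt f (x ∷ xs) (p ∷ ps) with f x p | with-evidence pt f xs ps
  ... | i , refl | is , refl = i ∷ is , refl

  -- No fibre of ψ ∷ π is large: the slack in each fibre of π absorbs all errors.
  module Flat (j k : ℕ) (π : List Functional) (dim : k + (2 + j) ≡ d) (through : Through k π) (transverse : Transverse (2 + j) π)
    (m : ℕ) (poor : ∀ ψ u → Zero π u → ¬ (apply ψ u ≈ 0#) → ∀ {p} → p ∈ A → length (Fibres.fibre (ψ ∷ π) p) ≤ m)
    (B : List Vector) (B-distinct : DistinctMod (kernel π) B) (B∈ : All (_∈ A) B)
    (cover : ∀ {x} → x ∈ A → Any (λ p → Zero π (x ⊖ p)) B) (r : ℕ) (B≤r : length B ≤ r) (m-small : r * (m * slackK j) ≤ N) where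
    open Fibres π

    -- The order is that of the functional which answers `vs` in `Transverse`. Its levels within a
    -- fibre of `π` lie in fibres of `ψ ∷ π`, which are small by `poor`.
    directions : ∀ p → Directions L₀ m (fibre p) (2 + j)
    directions p vs lt with transverse vs lt
    ... | ψ , kills , u , πu , ψu = C , (λ e → kernel⊑lexicographic (ψ ∷ []) (trivial⊆ (kernel (ψ ∷ [])) e)) ,
      All.map (λ {v} e → kernel⊑lexicographic (ψ ∷ []) (e ∷ []) , kernel⊑lexicographic (ψ ∷ []) (opp (kernel (ψ ∷ [])) (e ∷ []))) kills ,
      λ x → thin x _ refl
      where
      C : Cone
      C = lexicographic (ψ ∷ [])
      P? : ∀ y → Dec (Zero π (y ⊖ p))
      P? y = dec Lπ (y ⊖ p)
      Q? : ∀ x y → Dec (Cone.Ker C (y ⊖ x))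
      Q? x y = Cone.ker? C (y ⊖ x)
      -- `poor` speaks of fibres through elements of `A`, while `x` is arbitrary; the first entry of
      -- a nonempty level takes its place.
      thin : ∀ x F → F ≡ filter (Q? x) (fibre p) → length F ≤ m
      thin x [] _ = z≤n
      thin x (y ∷ F) eq with ∈-filter⁻ (Q? x) {xs = fibre p} (subst (y ∈_) eq (here refl))
      ... | y∈ , ky = ℕₚ.≤-trans (ℕₚ.≤-reflexive (cong length eq))
        (ℕₚ.≤-trans (length-filter₂ P? (Q? x) (λ z → dec (kernel (ψ ∷ π)) (z ⊖ y)) A
          λ {z} _ zp kz →
            All.head (resp (kernel (ψ ∷ [])) (solve ((x0 :- x1) :- (x2 :- x1)) (x0 :- x2) (z ∷ x ∷ y ∷ []) refl)
              (sub (kernel (ψ ∷ [])) (lexicographic-kernel (ψ ∷ []) kz) (lexicographic-kernel (ψ ∷ []) ky)))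
            ∷ resp Lπ (solve ((x0 :- x1) :- (x2 :- x1)) (x0 :- x2) (z ∷ p ∷ y ∷ []) refl) (sub Lπ zp (fibre-kernel y∈)))
          (poor ψ u πu ψu (fibre⊆A y∈)))

    record Expanded : Set where
      field
        point : Vector
        point∈ : point ∈ B
        expansion : Expansion L₀ (fibre point) (slackC j)
        expands : length (fibre point) * slackP j ≤ size expansion * 100 + m * slackK j

    open Expanded

    abstract
      evidence : ∃ λ is → map point is ≡ B
      evidence = with-evidence point (λ p p∈ → let E , h = slack j m L₀ (fibre p) (fibre-distinct p) (directions p) in
        record { point = p ; point∈ = p∈ ; expansion = E ; expands = h } , refl) B (All.tabulate id)

    is : List Expanded
    is = proj₁ evidence

    -- With `κ` one less than the size x of the fibre, `weight` is x, and a pair of fibres has value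
    -- x + y - 1, the bound of `pair-piece`.
    κ ε : Expanded → ℕ
    κ i = pred (length (fibre (point i)))
    ε i = size (expansion i)

    open Weights Lπ (lexicographic π) (kernel⊑lexicographic π) point κ ε

    point∈A : ∀ i → point i ∈ A
    point∈A i = All.lookup B∈ (point∈ i)

    weight≡ : ∀ i → weight i ≡ length (fibre (point i))
    weight≡ i = suc-pred-∈ (self∈fibre (point∈A i))
      where
      suc-pred-∈ : ∀ {x : Vector} {xs} → x ∈ xs → suc (pred (length xs)) ≡ length xs
      suc-pred-∈ (here _) = refl
      suc-pred-∈ (there _) = refl

    represented : ∀ ρ → (∀ {x} → Zero π x → apply ρ x ≈ 0#) → ∀ {x} → x ∈ A → ∃ λ i → i ∈ is × apply ρ x ≈ apply ρ (point i)
    represented ρ thr {x} mx with find (cover mx)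
    ... | p , p∈ , xp with ∈-map⁻ point (subst (p ∈_) (sym (proj₂ evidence)) p∈)
    ...   | i , i∈ , refl = i , i∈ , ap-≈ ρ {x} {point i} (thr xp)

    -- `ρ` factors through `π`, so its values on `A` are already taken on the points, and full
    -- dimension forbids that they all agree.
    rank : Rank Lπ (lexicographic π) (kernel⊑lexicographic π) point k is
    rank vs lt with through vs lt
    ... | ρ , thr , kills , nz = kernel (ρ ∷ []) , (λ z → thr z ∷ []) , All.map (_∷ []) kills ,
      λ coset → nonconstantᴬ ρ nz λ {x} {y} mx my → same (represented ρ thr mx) (represented ρ thr my) coset
      where
      same : ∀ {x y} → (∃ λ i → i ∈ is × apply ρ x ≈ apply ρ (point i)) → (∃ λ i → i ∈ is × apply ρ y ≈ apply ρ (point i)) →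
        (∀ {i l} → i ∈ is → l ∈ is → Zero (ρ ∷ []) (point i ⊖ point l)) → apply ρ x ≈ apply ρ y
      same (i , i∈ , ex) (l , l∈ , ey) coset = ≈-trans ex (≈-trans (ap-≈ ρ {point i} {point l} (All.head (coset i∈ l∈))) (≈-sym ey))

    piece : ∀ {z} → On is z → Piece (3 + slackC j) (sum-point Lπ (lexicographic π) (kernel⊑lexicographic π) point z) (value z)
    piece (diag {i} _) = record { translates = translates E ; translates∈ = All.map fibre⊆A (translates∈ E)
      ; few = ℕₚ.≤-trans (few E) (ℕₚ.m≤n+m _ 3) ; points = points E ; distinct = distinct E
      ; points∈ = All.map (sums-class (translates∈ E)) (points∈ E) ; large = ℕₚ.≤-refl }
      where
      E = expansion i
    piece (off {i} {l} _ _) = record { translates = P.translates ; translates∈ = P.translates∈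
      ; few = ℕₚ.≤-trans P.few (ℕₚ.m≤m+n 3 _) ; points = P.points ; distinct = P.distinct ; points∈ = P.points∈ ; large = P.large }
      where
      module P = Piece (pair-piece {s = value (off i l)} (point∈A i) (point∈A l)
        (ℕₚ.≤-reflexive (trans (cong suc (sym (ℕₚ.+-suc (κ i) (κ l)))) (cong₂ _+_ (weight≡ i) (weight≡ l)))))

    sum-in : ∀ {z} → On is z → ∃ λ p → ∃ λ q → p ∈ B × q ∈ B × sum-point Lπ (lexicographic π) (kernel⊑lexicographic π) point z ≡ p ⊕ q
    sum-in (diag {i} _) = point i , point i , point∈ i , point∈ i , refl
    sum-in (off {i} {l} _ _) = point i , point l , point∈ i , point∈ l , refl

    total-bound : ∀ is → total weight is * (slackP j + k * 100) ≤ total (λ i → ε i + weight i * k) is * 100 + length is * (m * slackK j)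
    total-bound [] = z≤n
    total-bound (i ∷ is) = begin
      (w + W) * (slackP j + k * 100)                       ≡⟨ ℕₚ.*-distribʳ-+ (slackP j + k * 100) w W ⟩
      w * (slackP j + k * 100) + W * (slackP j + k * 100)  ≤⟨ ℕₚ.+-mono-≤ first (total-bound is) ⟩
      ((ε i + w * k) * 100 + M) + (V * 100 + length is * M) ≤⟨ linear (ε i + w * k ∷ M ∷ V ∷ length is * M ∷ []) [] 0
                                                                ((100 :* u0 :+ u1) :+ (100 :* u2 :+ u3) :≤ 100 :* (u0 :+ u2) :+ (u1 :+ u3)) [] ⟩
      ((ε i + w * k) + V) * 100 + (M + length is * M)       ∎
      where
      open ℕₚ.≤-Reasoning
      w W V M : ℕ
      w = weight i
      W = total weight is
      V = total (λ i → ε i + weight i * k) is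
      M = m * slackK j
      first : w * (slackP j + k * 100) ≤ (ε i + w * k) * 100 + M
      first = begin
        w * (slackP j + k * 100)             ≡⟨ ℕₚ.*-distribˡ-+ w (slackP j) (k * 100) ⟩
        w * slackP j + w * (k * 100)         ≡⟨ cong₂ _+_ (cong (_* slackP j) (weight≡ i)) (sym (ℕₚ.*-assoc w k 100)) ⟩
        length (fibre (point i)) * slackP j + w * k * 100 ≤⟨ ℕₚ.+-monoˡ-≤ _ (expands i) ⟩
        (ε i * 100 + M) + w * k * 100        ≤⟨ linear (ε i ∷ M ∷ w * k ∷ []) [] 0 ((100 :* u0 :+ u1) :+ 100 :* u2 :≤ 100 :* (u0 :+ u2) :+ u1) [] ⟩
        (ε i + w * k) * 100 + M              ∎

    is-length : length is ≡ length B
    is-length = trans (sym (length-map point is)) (cong length (proj₂ evidence))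

    N≤ : N ≤ total weight is
    N≤ = ℕₚ.≤-trans (cover-count B cover) (ℕₚ.≤-reflexive (trans (cong (total (length ∘ fibre)) (sym (proj₂ evidence)))
      (trans (total-map (length ∘ fibre) point is) (total-cong is))))
      where
      total-cong : ∀ is → total (λ i → length (fibre (point i))) is ≡ total weight is
      total-cong [] = refl
      total-cong (i ∷ is) = cong₂ _+_ (sym (weight≡ i)) (total-cong is)

    -- The 3 + j gained inside a fibre and the rank `k` of the set of flats add up to d + 1, and
    -- 1/100 is left over.
    coefficient : slackP j + k * 100 ≡ suc (suc d * 100)
    coefficient = trans (cong (_+ k * 100) (slackP≡ j)) (cong suc (trans (sym (ℕₚ.*-distribʳ-+ 100 (3 + j) k))
      (cong (_* 100) (cong suc (trans (ℕₚ.+-comm (2 + j) k) dim)))))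

    good : ¬ ¬ Good (r * r * (3 + slackC j))
    good ¬good = freiman (lexicographic-kernel π) k is distinct-is rank λ { (zs , dzs , on , bound) →
      let E , le = combine (sum-point Lπ (lexicographic π) (kernel⊑lexicographic π) point) value (3 + slackC j) zs dzs (All.map piece on)
      in ¬good (good-mono (ℕₚ.*-monoˡ-≤ (3 + slackC j) (ℕₚ.≤-trans (few-classes _ B zs dzs (All.map sum-in on)) (ℕₚ.*-mono-≤ B≤r B≤r)))
        (E , arithmetic (size E) (total value zs) le bound)) }
      where
      distinct-is : AllPairs (λ i l → ¬ Zero π (point i ⊖ point l)) is
      distinct-is = Pairsₚ.map⁻ (subst (DistinctMod Lπ) (sym (proj₂ evidence)) B-distinct)
      arithmetic : ∀ s v → v ≤ s → total (λ i → ε i + weight i * k) is ≤ v + triangular k → N * suc d ≤ s + error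
      -- The surplus `N` in `main` absorbs the accumulated error `length is * M` of the fibres, by
      -- `m-small`.
      arithmetic s v v≤s bound = linear (N * suc d ∷ s ∷ v ∷ triangular k ∷ error ∷ V ∷ N ∷ length is * M ∷ [])
        ((1 , 100 :* u0 :+ u6 :≤ 100 :* u5 :+ u7) ∷ (100 , u5 :≤ u2 :+ u3) ∷ (100 , u2 :≤ u1) ∷ (100 , u3 :≤ u4) ∷ (1 , u7 :≤ u6) ∷ [])
        99 (u0 :≤ u1 :+ u4)
        (main ∷ bound ∷ v≤s ∷ triangular-mono (ℕₚ.≤-trans (ℕₚ.m≤m+n k (2 + j)) (ℕₚ.≤-reflexive dim))
          ∷ ℕₚ.≤-trans (ℕₚ.*-monoˡ-≤ M (ℕₚ.≤-trans (ℕₚ.≤-reflexive is-length) B≤r)) m-small ∷ [])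
        where
        open ℕₚ.≤-Reasoning
        V M : ℕ
        V = total (λ i → ε i + weight i * k) is
        M = m * slackK j
        main : N * suc d * 100 + N ≤ V * 100 + length is * M
        main = begin
          N * suc d * 100 + N                     ≡⟨ ℕₚ.+-comm (N * suc d * 100) N ⟩
          N + N * suc d * 100                     ≡⟨ cong (N +_) (ℕₚ.*-assoc N (suc d) 100) ⟩
          N + N * (suc d * 100)                   ≡⟨ ℕₚ.*-suc N (suc d * 100) ⟨
          N * suc (suc d * 100)                   ≤⟨ ℕₚ.*-monoˡ-≤ (suc (suc d * 100)) N≤ ⟩
          total weight is * suc (suc d * 100)     ≡⟨ cong (total weight is *_) coefficient ⟨
          total weight is * (slackP j + k * 100)  ≤⟨ total-bound is ⟩
          V * 100 + length is * M                 ∎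

  -- Freiman's lemma with unit weights and all of `A` as translates; it settles the case of
  -- boundedly many points.
  all-pairs : ¬ ¬ Good N
  all-pairs ¬good = freiman C₀L₀ d A A-distinct rank λ { (zs , dzs , on , bound) →
    ¬good (record { translates = A ; translates∈ = All.tabulate id ; few = ℕₚ.≤-refl
      ; points = map sums zs ; distinct = Pairsₚ.map⁺ dzs ; points∈ = Allₚ.map⁺ (All.map sums∈ on) } ,
      ℕₚ.≤-trans (total-≥ _ (suc d) A (λ _ → ℕₚ.≤-reflexive (cong suc (sym (ℕₚ.*-identityˡ d)))))
        (ℕₚ.≤-trans bound (ℕₚ.+-monoˡ-≤ error (ℕₚ.≤-trans (total-≤ value 1 zs (λ {z} _ → value≤1 z))
          (ℕₚ.≤-reflexive (trans (ℕₚ.*-identityʳ (length zs)) (sym (length-map sums zs)))))))) }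
    where
    open Weights L₀ C₀ L₀C₀ id (λ _ → 0) (λ _ → 1)
    sums : Tag Vector → Vector
    sums = sum-point L₀ C₀ L₀C₀ id
    value≤1 : ∀ z → value z ≤ 1
    value≤1 (diag _) = ℕₚ.≤-refl
    value≤1 (off _ _) = ℕₚ.≤-refl
    sums∈ : ∀ {z} → On A z → Sums A A (sums z)
    sums∈ (diag {i} m) = i , i , m , m , ≈ᵖ-refl
    sums∈ (off {i} {j} m m') = i , j , m , m' , ≈ᵖ-refl
    rank : Rank L₀ C₀ L₀C₀ id d A
    rank vs lt with coordinates-through vs lt
    ... | ρ , _ , kills , nz = kernel (ρ ∷ []) , trivial⊆ (kernel (ρ ∷ [])) , All.map (_∷ []) kills ,
      λ coset → nonconstantᴬ ρ nz λ {x} {y} mx my → ap-≈ ρ {x} {y} (All.head (coset mx my))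

  -- Boundedly many parallel lines, one of them with at least two points: compare with a set of lattice sticks.
  module Lines (k : ℕ) (π : List Functional) (dim : suc k ≡ d) (through : Through k π)
    (ψ : Functional) (u : Vector) (πu : Zero π u) (ψu : ¬ (apply ψ u ≈ 0#))
    (B : List Vector) (B-distinct : DistinctMod (kernel π) B) (B∈ : All (_∈ A) B)
    (cover : ∀ {x} → x ∈ A → Any (λ p → Zero π (x ⊖ p)) B) (r : ℕ) (B≤r : length B ≤ r)
    (p₀ : Vector) (p₀∈ : p₀ ∈ A) (two : 2 ≤ length (Fibres.fibre π p₀)) where
    open Fibres π
    open Stick π ψ u πu ψu

    pt : Vector × ℕ → Vector
    pt (p , h) = stick p h

    sticks : List Vector → List (Vector × ℕ)
    sticks [] = []
    sticks (p ∷ B) = map (p ,_) (upTo (length (fibre p))) ++ sticks B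

    sticks⁻ : ∀ B {s} → s ∈ sticks B → proj₁ s ∈ B × proj₂ s < length (fibre (proj₁ s))
    sticks⁻ (p ∷ B) m with ∈-++⁻ (map (p ,_) (upTo (length (fibre p)))) m
    ... | inj₂ m' = let m'' , lt = sticks⁻ B m' in there m'' , lt
    ... | inj₁ m' with ∈-map⁻ (p ,_) m'
    ...   | h , h∈ , refl = here refl , ∈-upTo⁻ h∈

    sticks⁺ : ∀ {B p h} → p ∈ B → h < length (fibre p) → (p , h) ∈ sticks B
    sticks⁺ (here refl) lt = ∈-++⁺ˡ (∈-map⁺ _ (∈-upTo⁺ lt))
    sticks⁺ {q ∷ B} (there m) lt = ∈-++⁺ʳ (map (q ,_) (upTo (length (fibre q)))) (sticks⁺ m lt)

    sticks-length : ∀ B → length (sticks B) ≡ total (length ∘ fibre) B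
    sticks-length [] = refl
    sticks-length (p ∷ B) = trans (length-++ (map (p ,_) (upTo (length (fibre p)))))
      (cong₂ _+_ (trans (length-map (p ,_) (upTo (length (fibre p)))) (length-upTo _)) (sticks-length B))

    sticks-distinct : ∀ B → DistinctMod Lπ B → AllPairs (λ s t → ¬ Zero (ψ ∷ π) (pt s ⊖ pt t)) (sticks B)
    sticks-distinct [] _ = []
    sticks-distinct (p ∷ B) (p≁ ∷ d) = Pairsₚ.++⁺
      (Pairsₚ.map⁺ (allPairs-map∈ (λ {h} {k} _ _ h≢k z → h≢k (proj₂ (stick-injective {p} {p} {h} {k} z))) (Uniqueₚ.upTo⁺ (length (fibre p)))))
      (sticks-distinct B d)
      (Allₚ.map⁺ (All.tabulate λ {h} _ → All.tabulate λ { {q , k} m z → All.lookup p≁ (proj₁ (sticks⁻ B m)) (proj₁ (stick-injective {p} {q} {h} {k} z)) }))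

    Lψ : Subgroup
    Lψ = kernel (ψ ∷ π)
    Cψ : Cone
    Cψ = lexicographic (ψ ∷ π)

    open Weights Lψ Cψ (kernel⊑lexicographic (ψ ∷ π)) pt (λ _ → 0) (λ _ → 1)

    fibre-mono : ∀ {p q} → Zero π (p ⊖ q) → length (fibre p) ≤ length (fibre q)
    fibre-mono {p} {q} z = length-filter-mono (λ x → dec Lπ (x ⊖ p)) (λ x → dec Lπ (x ⊖ q)) A
      (λ {x} _ e → resp Lπ (solve ((x0 :- x1) :+ (x1 :- x2)) (x0 :- x2) (x ∷ p ∷ q ∷ []) refl) (add Lπ e z))

    fibre-nonempty : ∀ {p} → p ∈ B → 1 ≤ length (fibre p)
    fibre-nonempty p∈ = nonempty (self∈fibre (All.lookup B∈ p∈))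
      where
      nonempty : ∀ {x : Vector} {xs} → x ∈ xs → 1 ≤ length xs
      nonempty (here _) = s≤s z≤n
      nonempty (there _) = s≤s z≤n

    -- A functional constant on the sticks vanishes at `u`, because the stick over the line of `p₀`
    -- has two points. It is then constant on each line, with values that agree from line to line,
    -- hence constant on `A`.
    rank : Rank Lψ Cψ (kernel⊑lexicographic (ψ ∷ π)) pt (suc k) (sticks B)
    rank vs lt with through-cons through ψ u πu ψu vs lt
    ... | ρ , thr , kills , nz = kernel (ρ ∷ []) , (λ z → thr z ∷ []) , All.map (_∷ []) kills , not-constant
      where
      not-constant : ¬ OneCoset Lψ Cψ (kernel⊑lexicographic (ψ ∷ π)) pt (kernel (ρ ∷ [])) (sticks B)
      not-constant coset = nonconstantᴬ ρ nz λ mx my → constant (cover mx) (cover my)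
        where
        vanishes : Any (λ p → Zero π (p₀ ⊖ p)) B → apply ρ u ≈ 0#
        vanishes c with find c
        ... | p , p∈ , z = stick-step ρ thr p (All.head (coset (sticks⁺ p∈ (ℕₚ.≤-trans two (fibre-mono {p₀} {p} z))) (sticks⁺ p∈ (fibre-nonempty p∈))))
        constant : ∀ {x y} → Any (λ p → Zero π (x ⊖ p)) B → Any (λ p → Zero π (y ⊖ p)) B → apply ρ x ≈ apply ρ y
        constant {x} {y} cx cy with find cx | find cy
        ... | p , p∈ , zp | q , q∈ , zq = ≈-trans (fibre-constant ρ thr x p ρu zp)
          (≈-trans (stick-constant ρ thr p q ρu (All.head (coset (sticks⁺ p∈ (fibre-nonempty p∈)) (sticks⁺ q∈ (fibre-nonempty q∈)))))
            (≈-sym (fibre-constant ρ thr y q ρu zq)))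
          where
          ρu : apply ρ u ≈ 0#
          ρu = vanishes (cover p₀∈)

    class : Tag (Vector × ℕ) → Vector
    class (diag (p , h)) = p ⊕ p
    class (off (p , h) (q , k)) = p ⊕ q

    height : Tag (Vector × ℕ) → ℕ
    height (diag (p , h)) = h + h
    height (off (p , h) (q , k)) = h + k

    same-sum : ∀ s t → Zero π (class s ⊖ class t) → height s ≡ height t →
      Zero (ψ ∷ π) (sum-point Lψ Cψ (kernel⊑lexicographic (ψ ∷ π)) pt s ⊖ sum-point Lψ Cψ (kernel⊑lexicographic (ψ ∷ π)) pt t)
    same-sum (diag (p , h)) (diag (q , k)) = stick-sums p p q q h h k k
    same-sum (diag (p , h)) (off (q , k) (q' , k')) = stick-sums p p q q' h h k k'
    same-sum (off (p , h) (p' , h')) (diag (q , k)) = stick-sums p p' q q h h' k k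
    same-sum (off (p , h) (p' , h')) (off (q , k) (q' , k')) = stick-sums p p' q q' h h' k k'

    sum-in : ∀ {z} → On (sticks B) z → ∃ λ p → ∃ λ q → p ∈ B × q ∈ B × class z ≡ p ⊕ q
    sum-in (diag {p , h} m) = p , p , proj₁ (sticks⁻ B m) , proj₁ (sticks⁻ B m) , refl
    sum-in (off {p , h} {q , k} m m') = p , q , proj₁ (sticks⁻ B m) , proj₁ (sticks⁻ B m') , refl

    -- `h` and `k` are smaller than the sizes x and y of the fibres, so `suc (h + k)` is at most x +
    -- y - 1.
    piece : ∀ {z} → On (sticks B) z → Piece 3 (class z) (suc (height z))
    piece (diag {p , h} m) = let p∈ , lt = sticks⁻ B m in pair-piece (All.lookup B∈ p∈) (All.lookup B∈ p∈)
      (ℕₚ.≤-trans (ℕₚ.≤-reflexive (cong suc (sym (ℕₚ.+-suc h h)))) (ℕₚ.+-mono-≤ lt lt))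
    piece (off {p , h} {q , k} m m') = let p∈ , lt = sticks⁻ B m ; q∈ , lt' = sticks⁻ B m' in pair-piece (All.lookup B∈ p∈) (All.lookup B∈ q∈)
      (ℕₚ.≤-trans (ℕₚ.≤-reflexive (cong suc (sym (ℕₚ.+-suc h k)))) (ℕₚ.+-mono-≤ lt lt'))

    value≤1 : ∀ z → value z ≤ 1
    value≤1 (diag _) = ℕₚ.≤-refl
    value≤1 (off _ _) = ℕₚ.≤-refl

    -- In each class the sticks have at most 1 + (greatest height) of the sums found, by `regroup`,
    -- and `A` has at least as many, by `piece`. The bound for the sticks thus passes to `A`.
    good : ¬ ¬ Good (r * r * 3)
    good ¬good = freiman (lexicographic-kernel (ψ ∷ π)) (suc k) (sticks B) (sticks-distinct B B-distinct) rank
      λ { (zs , dzs , on , bound) → finish zs dzs on bound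
        (regroup {_∼_ = λ s t → Zero π (class s ⊖ class t)} (λ s t → dec Lπ (class s ⊖ class t))
          (λ {s} {t} z → resp Lπ (solve (:0 :- (x0 :- x1)) (x1 :- x0) (class s ∷ class t ∷ []) refl) (opp Lπ z))
          (λ {s} {t} {r} z z' → resp Lπ (solve ((x0 :- x1) :+ (x1 :- x2)) (x0 :- x2) (class s ∷ class t ∷ class r ∷ []) refl) (add Lπ z z'))
          (λ {t} → resp Lπ (solve :0 (x0 :- x0) (class t ∷ []) refl) (zero∈ Lπ))
          height zs (allPairs-map∈ (λ {s} {t} _ _ ¬z (z , e) → ¬z (same-sum s t z e)) dzs)) }
      where
      finish : ∀ zs → AllPairs _ zs → All (On (sticks B)) zs →
        total (λ i → 1 + 1 * suc k) (sticks B) ≤ total value zs + triangular (suc k) →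
        (∃ λ gs → All (_∈ zs) gs × AllPairs (λ s t → ¬ Zero π (class s ⊖ class t)) gs × length zs ≤ total (suc ∘ height) gs) → ⊥
      finish zs _ on bound (gs , gs∈ , dgs , le) =
        let on' = All.map (All.lookup on) gs∈
            E , le' = combine class (suc ∘ height) 3 gs dgs (All.map piece on')
        in ¬good (good-mono (ℕₚ.*-monoˡ-≤ 3 (ℕₚ.≤-trans (few-classes class B gs dgs (All.map sum-in on')) (ℕₚ.*-mono-≤ B≤r B≤r)))
          (E , subst (λ d → N * suc d ≤ size E + triangular d) dim
            (ℕₚ.≤-trans (ℕₚ.≤-trans (ℕₚ.*-monoˡ-≤ (suc (suc k)) (ℕₚ.≤-trans (cover-count B cover) (ℕₚ.≤-reflexive (sym (sticks-length B)))))
              (total-≥ (λ i → 1 + 1 * suc k) (suc (suc k)) (sticks B) (λ _ → ℕₚ.≤-reflexive (cong suc (sym (ℕₚ.*-identityˡ (suc k)))))))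
              (ℕₚ.≤-trans bound (ℕₚ.+-monoˡ-≤ (triangular (suc k)) (ℕₚ.≤-trans (total-≤ value 1 zs (λ {z} _ → value≤1 z))
                (ℕₚ.≤-trans (ℕₚ.≤-reflexive (ℕₚ.*-identityʳ (length zs))) (ℕₚ.≤-trans le le'))))))))

  -- Pass to a fibre of a further functional as long as a positive proportion of A stays in one fibre.
  descend : ∀ e k π K → k + suc e ≡ d → Through k π → Transverse (suc e) π → ∀ p → p ∈ A → N ≤ length (Fibres.fibre π p) * K →
    ¬ ¬ Good (translate-count d e K)
  descend e k π K dim through transverse p p∈ rich = start (representatives (kernel π) A)
    where
    r : ℕ
    r = suc d * K

    finish : ∀ e → k + suc e ≡ d → Transverse (suc e) π → ∀ B → DistinctMod (kernel π) B → All (_∈ A) B →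
      (∀ {x} → x ∈ A → Any (λ p → Zero π (x ⊖ p)) B) → length B ≤ r → ¬ ¬ Good (translate-count d e K)

    start : (∃ λ B → DistinctMod (kernel π) B × All (_∈ A) B × (∀ {x} → x ∈ A → Any (λ p → Zero π (x ⊖ p)) B)) → ¬ ¬ Good (translate-count d e K)
    start (B , dB , B∈ , cover) ¬good with r ≤? length B
    ... | yes many = ¬good (good-mono (first e) (Fibres.many-fibres π K B dB B∈ p rich many))
      where
      first : ∀ e → r ≤ translate-count d e K
      first zero = ℕₚ.m≤m+n _ _
      first (suc e) = ℕₚ.m≤m+n _ _
    ... | no ¬many = finish e dim transverse B dB B∈ cover (ℕₚ.<⇒≤ (ℕₚ.≰⇒> ¬many)) ¬good

    -- If N ≤ K, all of `A` may be used as translates. Otherwise the rich fibre must have two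
    -- points, as `Lines` requires.
    finish zero dim transverse B dB B∈ cover B≤r ¬good with N ≤? K | transverse [] (s≤s z≤n)
    ... | yes small | _ = all-pairs λ g → ¬good (good-mono (ℕₚ.≤-trans small (ℕₚ.≤-trans (ℕₚ.m≤m+n K _) (ℕₚ.m≤n+m _ r))) g)
    ... | no ¬small | ψ , _ , u , πu , ψu = Lines.good k π (trans (ℕₚ.+-comm 1 k) dim) through ψ u πu ψu B dB B∈ cover r B≤r p p∈ two
        λ g → ¬good (good-mono (ℕₚ.≤-trans (ℕₚ.m≤n+m _ K) (ℕₚ.m≤n+m _ r)) g)
      where
      two : 2 ≤ length (Fibres.fibre π p)
      two = ℕₚ.≮⇒≥ λ { (s≤s le) → ¬small (ℕₚ.≤-trans rich (ℕₚ.≤-trans (ℕₚ.*-monoˡ-≤ K le) (ℕₚ.≤-reflexive (ℕₚ.*-identityˡ K)))) }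
    finish (suc j) dim transverse B dB B∈ cover B≤r ¬good = poor λ { (ψ , u , πu , ψu , q , q∈ , rich') →
        descend j (suc k) (ψ ∷ π) K' (trans (sym (ℕₚ.+-suc k (suc j))) dim) (through-cons through ψ u πu ψu)
          (transverse-cons transverse ψ u πu ψu) q q∈ rich'
          λ g → ¬good (good-mono (ℕₚ.≤-trans (ℕₚ.m≤n+m _ (r * r * (3 + slackC j))) (ℕₚ.m≤n+m _ r)) g) }
      where
      K' m : ℕ
      -- With m = N / K', the total error r m `slackK j` in `Flat` is at most N, whereas a fibre of
      -- more than m points has a proportion of at least 1 / K' of `A`. The successor keeps the
      -- divisor positive.
      K' = suc (r * slackK j)
      m = N / K'
      Rich : Set
      Rich = ∃ λ ψ → ∃ λ u → Zero π u × ¬ (apply ψ u ≈ 0#) × ∃ λ q → q ∈ A × N ≤ length (Fibres.fibre (ψ ∷ π) q) * K'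
      m-small : r * (m * slackK j) ≤ N
      m-small = ℕₚ.≤-trans (ℕₚ.≤-reflexive (trans (sym (ℕₚ.*-assoc r m (slackK j))) (trans (cong (_* slackK j) (ℕₚ.*-comm r m)) (ℕₚ.*-assoc m r (slackK j)))))
        (ℕₚ.≤-trans (ℕₚ.*-monoʳ-≤ m (ℕₚ.n≤1+n (r * slackK j))) (m/n*n≤m N K'))
      -- `Rich` quantifies over all functionals, so the two alternatives are joined under a double
      -- negation instead of being decided.
      poor : ¬ ¬ Rich
      poor ¬rich = Flat.good j k π dim through transverse m
        (λ ψ u πu ψu {q} q∈ → ℕₚ.≤-trans (ℕₚ.≤-reflexive (sym (m*n/n≡m (length (Fibres.fibre (ψ ∷ π) q)) K')))
          (/-monoˡ-≤ K' (ℕₚ.<⇒≤ (ℕₚ.≰⇒> λ le → ¬rich (ψ , u , πu , ψu , q , q∈ , le)))))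
        B dB B∈ cover r B≤r m-small
        λ g → ¬good (good-mono (ℕₚ.≤-trans (ℕₚ.m≤m+n _ _) (ℕₚ.m≤n+m _ r)) g)

  whole : ∀ e → suc e ≡ d → ∀ p → p ∈ A → ¬ ¬ Good (translate-count d e 1)
  whole e refl p p∈ = descend e 0 [] 1 refl (λ _ ()) transverse-[] p p∈
    (ℕₚ.≤-trans (length-filter-all (λ x → dec (kernel []) (x ⊖ p)) A (λ _ → [])) (ℕₚ.≤-reflexive (sym (ℕₚ.*-identityʳ _))))

-- From the double negation to explicit translates by finite search.

vec-any? : ∀ {n} c {P : Vec (Fin n) c → Set} → (∀ v → Dec (P v)) → Dec (∃ P)
vec-any? zero P? = map′ (λ p → [] , p) (λ { ([] , p) → p }) (P? [])
vec-any? (suc c) P? = map′ (λ (i , v , p) → i ∷ v , p) (λ { (i ∷ v , p) → i , v , p }) (any? λ i → vec-any? c λ v → P? (i ∷ v))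

allPairs-lookup : ∀ {A : Set} {R : A → A → Set} {xs : List A} → AllPairs R xs → ∀ i j →
  i ≡ j ⊎ R (lookup xs i) (lookup xs j) ⊎ R (lookup xs j) (lookup xs i)
allPairs-lookup (_ ∷ _) zero zero = inj₁ refl
allPairs-lookup {xs = _ ∷ xs} (p ∷ _) zero (suc j) = inj₂ (inj₁ (All.lookup p (∈-lookup j)))
allPairs-lookup {xs = _ ∷ xs} (p ∷ _) (suc i) zero = inj₂ (inj₂ (All.lookup p (∈-lookup i)))
allPairs-lookup (_ ∷ ps) (suc i) (suc j) with allPairs-lookup ps i j
... | inj₁ e = inj₁ (cong suc e)
... | inj₂ r = inj₂ r

triangular≤5[1+d]³ : ∀ d → triangular d ≤ 5 * suc d ^ 3
triangular≤5[1+d]³ d = ℕₚ.≤-trans (square d)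
  (ℕₚ.≤-trans (ℕₚ.*-monoʳ-≤ (suc d) (ℕₚ.m≤m*n (suc d) (suc d * 1))) (ℕₚ.m≤n*m (suc d ^ 3) 5))
  where
  square : ∀ k → triangular k ≤ suc k * suc k
  square zero = z≤n
  square (suc k) = ℕₚ.+-mono-≤ (ℕₚ.n≤1+n (suc k)) (ℕₚ.≤-trans (square k) (ℕₚ.*-monoʳ-≤ (suc k) (ℕₚ.n≤1+n (suc k))))

module Extraction (R : RealNumbers) (d n : ℕ) (a : Fin n → Point R d) (a-distinct : Distinct R a) (a-full : FullDim R a) where
  open Space R d
  open Sumsets space ¬-dec using (representatives)
  open Assembly R d n a a-distinct a-full
  open Subgroup
  open Expansion

  private
    sums : ∀ {c} → Vec (Fin n) c → List Vector
    sums v = cartesianProductWith _⊕_ A (tabulate (λ j → a (Vec.lookup v j)))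

    -- Equality of points is decidable, so duplicates can be removed, `length (reps v)` is the exact
    -- size of the sumset, and `Enough` is a comparison of numbers.
    reps : ∀ {c} → Vec (Fin n) c → List Vector
    reps v = proj₁ (representatives L₀ (sums v))

    Enough : ∀ {c} → Vec (Fin n) c → Set
    Enough v = N * suc d ≤ length (reps v) + error

    -- The default `i₀` pads the list to exactly `c` translates, the number fixed by the theorem.
    indices : Fin n → ∀ c ws → All (_∈ A) ws → length ws ≤ c → ∃ λ (v : Vec (Fin n) c) → ∀ {w} → w ∈ ws → w ∈ tabulate (λ j → a (Vec.lookup v j))
    indices i₀ c [] [] _ = Vec.replicate c i₀ , λ ()
    indices i₀ (suc c) (w ∷ ws) (m ∷ ms) (s≤s le) with ∈-tabulate⁻ m | indices i₀ c ws ms le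
    ... | i , refl | v , h = i ∷ v , λ { (here e) → here e ; (there m) → there (h m) }

    good⇒enough : Fin n → ∀ {c} → Good c → ∃ λ (v : Vec (Fin n) c) → Enough v
    good⇒enough i₀ {c} (E , le) with indices i₀ c (translates E) (translates∈ E) (few E)
    ... | v , h = v , ℕₚ.≤-trans le (ℕₚ.+-monoˡ-≤ error (pigeonhole (λ x y → In L₀ (x ⊖ y)) (points E) (reps v)
      (allPairs-map∈ (λ {x} {y} _ _ ¬p z p q → ¬p (resp L₀ (solve ((x0 :- x2) :- (x1 :- x2)) (x0 :- x1) (x ∷ y ∷ z ∷ []) refl) (sub L₀ p q))) (distinct E))
      (All.map (λ { {x} (y , w , my , mw , e) → Any.map (λ {z} p → resp L₀ (⊕-cong (≈ᵖ-sym e) ≈ᵖ-refl) p)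
        (proj₂ (proj₂ (proj₂ (representatives L₀ (sums v)))) (∈-cartesianProductWith⁺ _⊕_ my (h mw))) }) (points∈ E))))

    enough⇒sumset : ∀ {c} (v : Vec (Fin n) c) → SumsetAtLeast R a (λ j → a (Vec.lookup v j)) (length (reps v))
    enough⇒sumset v = lookup (reps v) , unique , sum
      where
      properties = proj₂ (representatives L₀ (sums v))
      difference : ∀ {x y} → x ≋ y → In L₀ (x ⊖ y)
      difference {x} {y} e = ≈ᵖ-trans (⊕-cong e ≈ᵖ-refl) (solve (x0 :- x0) :0 (y ∷ []) refl)
      unique : Distinct R (lookup (reps v))
      unique i j e with allPairs-lookup (proj₁ properties) i j
      ... | inj₁ eq = eq
      ... | inj₂ (inj₁ ne) = ⊥-elim (ne (difference e))
      ... | inj₂ (inj₂ ne) = ⊥-elim (ne (difference (≈ᵖ-sym e)))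
      sum : ∀ k → ∃[ i ] ∃[ j ] (lookup (reps v) k ≋ (a i ⊕ a (Vec.lookup v j)))
      sum k with ∈-cartesianProductWith⁻ _⊕_ A (tabulate (λ j → a (Vec.lookup v j))) (All.lookup (proj₁ (proj₂ properties)) (∈-lookup {xs = reps v} k))
      ... | x , y , mx , my , eq with ∈-tabulate⁻ {f = a} mx | ∈-tabulate⁻ {f = λ j → a (Vec.lookup v j)} my
      ...   | i , refl | j , refl = i , j , λ l → reflexive (cong (λ f → f l) eq)

  extract : Fin n → ∀ c → ¬ ¬ Good c →
    Σ (Fin c → Fin n) λ f → ∃[ m ] (SumsetAtLeast R a (λ j → a (f j)) m × (suc d * n ≤ m + 5 * suc d ^ 3))
  extract i₀ c ¬¬good with decidable-stable (vec-any? c (λ v → N * suc d ≤? length (reps v) + error)) (λ ¬p → ¬¬good λ g → ¬p (good⇒enough i₀ g))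
  ... | v , enough = Vec.lookup v , length (reps v) , enough⇒sumset v ,
    ℕₚ.≤-trans (ℕₚ.≤-reflexive (trans (ℕₚ.*-comm (suc d) n) (cong (_* suc d) (sym (length-tabulate a)))))
      (ℕₚ.≤-trans enough (ℕₚ.+-monoʳ-≤ (length (reps v)) (triangular≤5[1+d]³ d)))

theorem1p2 : (R : RealNumbers) → (d : ℕ) → ∃[ c ] (∀ (n : ℕ) → (a : Fin n → Point R d) →
    NonZero n → Distinct R a → FullDim R a →
    Σ (Fin c → Fin n) λ f → ∃[ m ] (SumsetAtLeast R a (λ j → a (f j)) m × (suc d * n ≤ m + 5 * suc d ^ 3)))
theorem1p2 R zero = 0 , λ where
  -- In dimension 0 all points coincide, so n = 1, and without any translate the bound reads 1 ≤ 0 +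
  -- 5.
  (suc zero) a _ _ _ → (λ ()) , 0 , ((λ ()) , (λ ()) , λ ()) , s≤s z≤n
  (suc (suc n)) a _ a-distinct _ → ⊥-elim (0≢1+n (a-distinct zero (suc zero) λ ()))
theorem1p2 R (suc e) = translate-count (suc e) e 1 , λ where
  (suc n) a _ a-distinct a-full →
    Extraction.extract R (suc e) (suc n) a a-distinct a-full zero (translate-count (suc e) e 1)
      (Assembly.whole R (suc e) (suc n) a a-distinct a-full e refl (a zero) (here refl))
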